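{- If $F$ is a forest, then $\mathcal{M}(F)$ is finite if and only if $F=tK_2$ (a matching with $t$ edges) for some $t$.
   Context: For a graph $G$, let $F_{G,1}$ be the set of maps $f:E(G)\to E(G)$ with $f(e)\neq e$ for all $e$. A subgraph $G'$ of $G$ is $f$-free if $f(e)\notin E(G')$ for all $e\in E(G')$. A graph $G$ is unavoidable for $H$ if for every $f\in F_{G,1}$ there exists an $f$-free copy of $H$ in $G$. $\mathcal{M}(H)$ is the set (up to isomorphism) of minimal unavoidable graphs for $H$, i.e. unavoidable graphs none of whose proper subgraphs is unavoidable.
   Formalization: F is assumed to have no isolated vertices (for F = K_1, M(F) = {K_1} is finite although F is not tK_2), and an unavoidable graph must also contain a copy of H, since otherwise K_2, for which F_{G,1} is empty, would be vacuously unavoidable for every H. -}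

module Defs where

open import Data.Nat as ℕ using (ℕ; zero; suc; _*_; _/_)
open import Data.Nat.Properties using (≡ᵇ⇒≡; ≡⇒≡ᵇ)
open import Data.Bool using (Bool; true; false; _∧_; not)
open import Data.Bool.Properties using (∧-comm)
open import Data.Fin using (Fin; toℕ; _<_; inject₁; fromℕ) renaming (zero to fzero; suc to fsuc)
open import Data.Product using (Σ; Σ-syntax; ∃; ∃-syntax; _×_; _,_)
open import Data.List using (List)
open import Data.List.Relation.Unary.Any using (Any)
open import Function.Definitions using (Injective)
open import Relation.Binary.PropositionalEquality using (_≡_; refl; cong; cong₂)
open import Relation.Nullary using (¬_)

record Graph : Set where
  field
    n     : ℕ
    adj   : Fin n → Fin n → Bool
    adj-sym : ∀ i j → adj i j ≡ adj j i
    irrefl : ∀ i → adj i i ≡ false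
open Graph public

-- Edges of G: unordered pairs {u,v} represented with u < v.
record Edge (G : Graph) : Set where
  constructor edge
  field
    u   : Fin (n G)
    v   : Fin (n G)
    u<v : u < v
    isE : adj G u v ≡ true
open Edge public

SameEdge : {G : Graph} → Edge G → Edge G → Set
SameEdge e e' = (u e ≡ u e') × (v e ≡ v e')

F1 : Graph → Set
F1 G = Σ[ f ∈ (Edge G → Edge G) ] (∀ e → ¬ SameEdge (f e) e)

-- Copies (subgraphs isomorphic to H) given by embeddings H ↪ G.

Hom : (H G : Graph) → (Fin (n H) → Fin (n G)) → Set
Hom H G φ = ∀ i j → adj H i j ≡ true → adj G (φ i) (φ j) ≡ true

record Copy (H G : Graph) : Set where
  constructor copy
  field
    map  : Fin (n H) → Fin (n G)
    inj  : Injective _≡_ _≡_ map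
    hom  : Hom H G map
open Copy public

InCopy : {H G : Graph} → Copy H G → Edge G → Set
InCopy {H} c e =
  Σ[ i ∈ Fin (n H) ] Σ[ j ∈ Fin (n H) ]
    (adj H i j ≡ true × map c i ≡ u e × map c j ≡ v e)

FFree : {H G : Graph} → Copy H G → (Edge G → Edge G) → Set
FFree c f = ∀ e → InCopy c e → ¬ InCopy c (f e)

Unavoidable : (H G : Graph) → Set
Unavoidable H G =
  Copy H G × ((f : F1 G) → Σ[ c ∈ Copy H G ] FFree c (Data.Product.proj₁ f))

ProperSub : (G' G : Graph) → Set
ProperSub G' G =
  Σ[ c ∈ Copy G' G ]
    ¬ ((∀ x → ∃[ i ] map c i ≡ x) × (∀ (e : Edge G) → InCopy c e))

MinUnavoidable : (H G : Graph) → Set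
MinUnavoidable H G = Unavoidable H G × (∀ G' → ProperSub G' G → ¬ Unavoidable H G')

_≅_ : Graph → Graph → Set
G ≅ H = Σ[ φ ∈ (Fin (n G) → Fin (n H)) ] Σ[ ψ ∈ (Fin (n H) → Fin (n G)) ]
  ((∀ x → ψ (φ x) ≡ x) × (∀ y → φ (ψ y) ≡ y) × (∀ i j → adj H (φ i) (φ j) ≡ adj G i j))

MFinite : Graph → Set
MFinite H = Σ[ L ∈ List Graph ] (∀ G → MinUnavoidable H G → Any (G ≅_) L)

last : (m : ℕ) → Fin (suc m)
last m = fromℕ m

Forest : Graph → Set
Forest G = ∀ (k : ℕ) (c : Fin (suc (suc (suc k))) → Fin (n G)) →
  Injective _≡_ _≡_ c →
  (∀ (i : Fin (suc (suc k))) → adj G (c (inject₁ i)) (c (fsuc i)) ≡ true) →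
  ¬ (adj G (c (last (suc (suc k)))) (c fzero) ≡ true)

NoIsolated : Graph → Set
NoIsolated G = ∀ i → ∃[ j ] adj G i j ≡ true

private
  ≡ᵇ-sym : ∀ a b → (a ℕ.≡ᵇ b) ≡ (b ℕ.≡ᵇ a)
  ≡ᵇ-sym zero zero = refl
  ≡ᵇ-sym zero (suc b) = refl
  ≡ᵇ-sym (suc a) zero = refl
  ≡ᵇ-sym (suc a) (suc b) = ≡ᵇ-sym a b

  ≡ᵇ-refl : ∀ a → (a ℕ.≡ᵇ a) ≡ true
  ≡ᵇ-refl zero = refl
  ≡ᵇ-refl (suc a) = ≡ᵇ-refl a

  madj : ∀ {m} → Fin m → Fin m → Bool
  madj i j = ((toℕ i / 2) ℕ.≡ᵇ (toℕ j / 2)) ∧ not (toℕ i ℕ.≡ᵇ toℕ j)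

  madj-sym : ∀ {m} (i j : Fin m) → madj i j ≡ madj j i
  madj-sym i j = cong₂ _∧_ (≡ᵇ-sym (toℕ i / 2) (toℕ j / 2)) (cong not (≡ᵇ-sym (toℕ i) (toℕ j)))

  madj-irr : ∀ {m} (i : Fin m) → madj i i ≡ false
  madj-irr i rewrite ≡ᵇ-refl (toℕ i) | ≡ᵇ-refl (toℕ i / 2) = refl

matching : ℕ → Graph
matching t = record { n = t * 2 ; adj = madj ; adj-sym = madj-sym ; irrefl = madj-irr }

{-# OPTIONS --safe #-}

-- Let F be a matching with t edges and G minimal unavoidable for F.  An edge at a vertex of very large degree is
-- superfluous: a map f on the other edges extends to it by a value that f takes often at that vertex, and in a
-- free copy the edge can be exchanged for another one at the same vertex.  Moreover 3t + 3 disjoint edges are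
-- already unavoidable, since a map without fixed points has an independent set containing a third of the points.
-- So G has bounded degree, no isolated vertex and no large matching, which bounds its size.
--
-- If F is not a matching, it suffices to find for every N an unavoidable graph whose subgraphs on at most N
-- vertices are all avoidable.  If F contains a path with three edges, every forest is avoidable (send each edge to
-- the next one towards a root) while every dense graph is unavoidable, so dense graphs of large girth will do.
-- Otherwise F is a disjoint union of stars, the largest with s ≥ 2 edges.  Take many copies of a long cycle with
-- 3(s − 2) leaves at every vertex and one further leaf at one of them: to block all stars with s edges in a copy,
-- f would need one more edge than there is, but it succeeds as soon as a single cycle vertex is missing.

module Submission where

open import Defs
open import Data.Bool using (Bool; true; false; _∧_; _∨_; not; if_then_else_; T)
open import Data.Bool.Properties using (∨-comm; ∨-zeroʳ; ∧-comm; ∧-idem) renaming (_≟_ to _≟ᵇ_)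
open import Data.Empty using (⊥; ⊥-elim)
open import Data.Fin as Fin using (Fin; toℕ; inject₁; fromℕ; combine; remQuot; fromℕ<; finToFun; funToFin) renaming (zero to fzero; suc to fsuc)
import Data.Fin.Properties as Finₚ
open import Data.Fin.Relation.Unary.Top using (view; ‵fromℕ; ‵inject₁)
open import Data.List.Base as List using (List; []; _∷_; _++_; length; filter; allFin; concatMap; cartesianProduct)
open import Data.List.Membership.Propositional using (_∈_; _∉_; find; lose)
open import Data.List.Membership.Propositional.Properties using (∈-filter⁺; ∈-filter⁻; ∈-∃++; ∈-++⁺ˡ; ∈-++⁺ʳ; ∈-++⁻; ∈-map⁺; ∈-map⁻; ∈-allFin; ∈-concatMap⁺; ∈-cartesianProduct⁺; ∈-lookup; ∈-upTo⁺)
open import Data.List.Properties using (length-++; length-map; length-tabulate)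
open import Data.List.Relation.Unary.All as All using (All; []; _∷_)
open import Data.List.Relation.Unary.AllPairs using ([]; _∷_)
open import Data.List.Relation.Unary.Any as Any using (Any; here; there)
open import Data.List.Relation.Unary.Any.Properties using (lookup-index)
open import Data.List.Relation.Unary.Unique.Propositional using (Unique)
import Data.List.Relation.Unary.Unique.Propositional.Properties as Uniqueₚ
open import Data.Maybe.Base using (Maybe; just; nothing)
import Data.Maybe.Properties as Maybeₚ
open import Data.Nat using (ℕ; zero; suc; _+_; _*_; _≤_; _<_; z≤n; s≤s; s≤s⁻¹; _∸_; _≤?_; _<?_; _^_; _≡ᵇ_)
open import Data.Nat.DivMod using (_/_; m*n/n≡m; +-distrib-/-∣ˡ; m<n⇒m/n≡0)
open import Data.Nat.Divisibility using (m∣m*n)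
open import Data.Nat.Properties
open import Data.Nat.Tactic.RingSolver using (solve-∀)
open import Data.Product using (Σ; ∃-syntax; _×_; _,_; proj₁; proj₂)
import Data.Product.Properties as Productₚ
open import Data.Sum using (_⊎_; inj₁; inj₂; swap; [_,_]′)
import Data.Sum.Properties as Sumₚ
open import Data.Unit using (tt)
open import Data.Vec.Base as Vec using (Vec; []; _∷_)
open import Data.Vec.Properties using (lookup∘tabulate)
open import Function using (_∘_; id; case_of_)
open import Function.Bundles using (_⇔_; mk⇔)
open import Function.Definitions using (Injective)
open import Relation.Binary.Definitions using (DecidableEquality; tri<; tri≈; tri>)
open import Relation.Binary.PropositionalEquality using (_≡_; _≢_; refl; sym; trans; cong; cong₂; subst; _≗_; subst₂)
open import Relation.Nullary using (¬_; Dec; yes; no; does; contradiction; ¬?)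
open import Relation.Nullary.Decidable using (dec-true; dec-false; _×-dec_; _⊎-dec_; map′; _→-dec_)

-- A copy is f-free exactly when its edge set is independent in the digraph with an arc from each e
-- to f(e), so unavoidability is a question about independent sets in digraphs of out-degree one.
-- The constants of the caterpillar come from counting arcs. Put k = s - 1. To leave no k + 1
-- independent edges at a vertex, the cheapest arrangement is k cliques of nearly equal size: at an
-- ordinary cycle vertex, of degree 3k - 1, these are k - 1 triangles and a single arc, 3k - 2 arcs
-- in all; at the vertex with the further leaf, of degree 3k, they are k triangles with 3k arcs. A
-- cycle of length m thus asks for m(3k - 2) + 2 arcs, but the copy has only m(3k - 2) + 1 edges,
-- each the tail of one arc. The cycle is long so that a bounded subgraph misses one of its
-- vertices. Many copies are needed because F may consist of several stars and f may send a star in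
-- one copy into a star in another.

variable
  A B : Set

-- Counting in lists

∑ : List A → (A → ℕ) → ℕ
∑ []       g = 0
∑ (x ∷ xs) g = g x + ∑ xs g

⟦_⟧ : Bool → ℕ
⟦ true ⟧  = 1
⟦ false ⟧ = 0

count : (A → Bool) → List A → ℕ
count p xs = ∑ xs (λ x → ⟦ p x ⟧)

keep : (A → Bool) → List A → List A
keep p = filter (λ x → p x ≟ᵇ true)

witness : {P : Set} (d : Dec P) → does d ≡ true → P
witness (yes p) _ = p

true≢false : ∀ {b} → b ≡ true → b ≡ false → ⊥
true≢false refl ()

∧-true : ∀ a {b} → a ∧ b ≡ true → a ≡ true × b ≡ true
∧-true true eq = refl , eq

∨-false : ∀ a {b} → a ∨ b ≡ false → a ≡ false × b ≡ false
∨-false false eq = refl , eq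

not-true : ∀ {b} → b ≢ true → b ≡ false
not-true {true}  h = contradiction refl h
not-true {false} _ = refl

∑-mono : ∀ xs {g h : A → ℕ} → (∀ {x} → x ∈ xs → g x ≤ h x) → ∑ xs g ≤ ∑ xs h
∑-mono []       _ = z≤n
∑-mono (x ∷ xs) le = +-mono-≤ (le (here refl)) (∑-mono xs (le ∘ there))

∑-+ : ∀ (xs : List A) g h → ∑ xs (λ x → g x + h x) ≡ ∑ xs g + ∑ xs h
∑-+ []       g h = refl
∑-+ (x ∷ xs) g h rewrite ∑-+ xs g h = shuffle (g x) (h x) (∑ xs g) (∑ xs h)
  where
  shuffle : ∀ a b c d → (a + b) + (c + d) ≡ (a + c) + (b + d)
  shuffle = solve-∀

∑-const : ∀ (xs : List A) c → ∑ xs (λ _ → c) ≡ length xs * c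
∑-const []       c = refl
∑-const (x ∷ xs) c = cong (c +_) (∑-const xs c)

∑-cong : ∀ (xs : List A) {g h : A → ℕ} → g ≗ h → ∑ xs g ≡ ∑ xs h
∑-cong []       _  = refl
∑-cong (x ∷ xs) eq = cong₂ _+_ (eq x) (∑-cong xs eq)

∑-bound : ∀ (xs : List A) {g : A → ℕ} {c} → (∀ {x} → x ∈ xs → g x ≤ c) → ∑ xs g ≤ length xs * c
∑-bound xs {c = c} le = ≤-trans (∑-mono xs le) (≤-reflexive (∑-const xs c))

∑-swap : ∀ (xs : List A) (ys : List B) (h : A → B → ℕ) →
         ∑ xs (λ x → ∑ ys (h x)) ≡ ∑ ys (λ y → ∑ xs (λ x → h x y))
∑-swap []       ys h = sym (trans (∑-const ys 0) (*-zeroʳ (length ys)))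
∑-swap (x ∷ xs) ys h rewrite ∑-swap xs ys h = sym (∑-+ ys (h x) _)

∑-++ : ∀ (xs ys : List A) g → ∑ (xs ++ ys) g ≡ ∑ xs g + ∑ ys g
∑-++ []       ys g = refl
∑-++ (x ∷ xs) ys g rewrite ∑-++ xs ys g = sym (+-assoc (g x) _ _)

∑-*ˡ : ∀ (xs : List A) c g → ∑ xs (λ x → c * g x) ≡ c * ∑ xs g
∑-*ˡ []       c g = sym (*-zeroʳ c)
∑-*ˡ (x ∷ xs) c g rewrite ∑-*ˡ xs c g = sym (*-distribˡ-+ c (g x) _)

∑-⊆ : ∀ {xs ys : List A} g → Unique xs → (∀ {x} → x ∈ xs → x ∈ ys) → ∑ xs g ≤ ∑ ys g
∑-⊆ {xs = []} g _ _ = z≤n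
∑-⊆ {xs = x ∷ xs} g ux@(_ ∷ u) sub with ∈-∃++ (sub (here refl))
... | as , bs , refl rewrite ∑-++ as (x ∷ bs) g = begin
  g x + ∑ xs g           ≤⟨ +-monoʳ-≤ (g x) (∑-⊆ g u sub′) ⟩
  g x + ∑ (as ++ bs) g   ≡⟨ cong (g x +_) (∑-++ as bs g) ⟩
  g x + (∑ as g + ∑ bs g) ≡⟨ shuffle (g x) (∑ as g) (∑ bs g) ⟩
  ∑ as g + (g x + ∑ bs g) ∎
  where
  open ≤-Reasoning
  shuffle : ∀ a b c → a + (b + c) ≡ b + (a + c)
  shuffle = solve-∀
  sub′ : ∀ {y} → y ∈ xs → y ∈ as ++ bs
  sub′ y∈ with ∈-++⁻ as (sub (there y∈))
  ... | inj₁ y∈as          = ∈-++⁺ˡ y∈as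
  ... | inj₂ (here refl)   = contradiction y∈ (Uniqueₚ.Unique[x∷xs]⇒x∉xs ux)
  ... | inj₂ (there y∈bs)  = ∈-++⁺ʳ as y∈bs

length-∑ : (xs : List A) → length xs ≡ ∑ xs (λ _ → 1)
length-∑ xs = sym (trans (∑-const xs 1) (*-identityʳ _))

length-⊆ : ∀ {xs ys : List A} → Unique xs → (∀ {x} → x ∈ xs → x ∈ ys) → length xs ≤ length ys
length-⊆ {xs = xs} {ys} u sub rewrite length-∑ xs | length-∑ ys = ∑-⊆ _ u sub

length-keep : ∀ (p : A → Bool) xs → length (keep p xs) ≡ count p xs
length-keep p [] = refl
length-keep p (x ∷ xs) with p x
... | true  = cong suc (length-keep p xs)
... | false = length-keep p xs

∈-keep⁺ : ∀ (p : A → Bool) {x xs} → x ∈ xs → p x ≡ true → x ∈ keep p xs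
∈-keep⁺ p = ∈-filter⁺ (λ x → p x ≟ᵇ true)

∈-keep⁻ : ∀ (p : A → Bool) {x xs} → x ∈ keep p xs → x ∈ xs × p x ≡ true
∈-keep⁻ p = ∈-filter⁻ (λ x → p x ≟ᵇ true)

keep-unique : ∀ (p : A → Bool) {xs} → Unique xs → Unique (keep p xs)
keep-unique p = Uniqueₚ.filter⁺ (λ x → p x ≟ᵇ true)

∑-split : ∀ (p : A → Bool) xs g → ∑ xs g ≡ ∑ (keep p xs) g + ∑ (keep (not ∘ p) xs) g
∑-split p [] g = refl
∑-split p (x ∷ xs) g with p x
... | true  = trans (cong (g x +_) (∑-split p xs g)) (sym (+-assoc (g x) _ _))
... | false = trans (cong (g x +_) (∑-split p xs g)) (shuffle (g x) (∑ (keep p xs) g) _)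
  where
  shuffle : ∀ a b c → a + (b + c) ≡ b + (a + c)
  shuffle = solve-∀

count-none : ∀ (p : A → Bool) {xs} → (∀ {x} → x ∈ xs → p x ≡ false) → count p xs ≡ 0
count-none p {[]}     _ = refl
count-none p {x ∷ xs} h rewrite h (here refl) = count-none p (h ∘ there)

count≤1 : ∀ {xs : List A} (p : A → Bool) → Unique xs →
          (∀ {x y} → x ∈ xs → y ∈ xs → p x ≡ true → p y ≡ true → x ≡ y) → count p xs ≤ 1
count≤1 {xs = []} p _ _ = z≤n
count≤1 {xs = x ∷ xs} p ux@(_ ∷ u) one with p x in px
... | false = count≤1 p u (λ a b → one (there a) (there b))
... | true  = s≤s (≤-reflexive (count-none p λ {y} y∈ → not-true λ py →
                contradiction (subst (_∈ xs) (sym (one (here refl) (there y∈) px py)) y∈)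
                              (Uniqueₚ.Unique[x∷xs]⇒x∉xs ux)))

count-does≤1 : ∀ {P : A → Set} {xs} (P? : ∀ x → Dec (P x)) → Unique xs →
               (∀ {x y} → x ∈ xs → y ∈ xs → P x → P y → x ≡ y) → count (λ x → does (P? x)) xs ≤ 1
count-does≤1 P? u one = count≤1 _ u λ {x} {y} x∈ y∈ p q → one x∈ y∈ (witness (P? x) p) (witness (P? y) q)

count-∨ : ∀ (p q : A → Bool) xs → count (λ x → p x ∨ q x) xs ≤ count p xs + count q xs
count-∨ p q xs = ≤-trans (∑-mono xs (λ {x} _ → ⟦∨⟧ (p x) (q x))) (≤-reflexive (∑-+ xs (λ x → ⟦ p x ⟧) (λ x → ⟦ q x ⟧)))
  where
  ⟦∨⟧ : ∀ a b → ⟦ a ∨ b ⟧ ≤ ⟦ a ⟧ + ⟦ b ⟧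
  ⟦∨⟧ true  b = s≤s z≤n
  ⟦∨⟧ false b = ≤-refl

count-pos : ∀ (p : A → Bool) {x xs} → x ∈ xs → p x ≡ true → 1 ≤ count p xs
count-pos p (here refl) px rewrite px = s≤s z≤n
count-pos p {xs = y ∷ _} (there x∈) px = ≤-trans (count-pos p x∈ px) (m≤n+m _ ⟦ p y ⟧)

search : {P : A → Set} → (∀ x → Dec (P x)) → ∀ xs → (∃[ x ] x ∈ xs × P x) ⊎ (∀ {x} → x ∈ xs → ¬ P x)
search P? xs with Any.any? P? xs
... | yes a = inj₁ (find a)
... | no ¬a = inj₂ λ x∈ px → ¬a (lose x∈ px)

-- Union bound: if every y were bad for some i, counting the bad pairs in the other order would give
-- at least `length ys` of them. This is how all vertices and edges avoiding finitely many
-- obstructions are chosen.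
escape : ∀ (is : List B) (ys : List A) (bad : B → A → Bool) →
         ∑ is (λ i → count (bad i) ys) < length ys →
         ∃[ y ] y ∈ ys × (∀ {i} → i ∈ is → bad i y ≡ false)
escape is ys bad lt with search (λ y → count (λ i → bad i y) is ≤? 0) ys
... | inj₁ (y , y∈ , c≤0) = y , y∈ , λ i∈ → not-true λ b →
        contradiction (≤-trans (count-pos (λ i → bad i y) i∈ b) c≤0) λ ()
... | inj₂ h = contradiction lt (≤⇒≯ (begin
    length ys                                  ≡⟨ length-∑ ys ⟩
    ∑ ys (λ _ → 1)                             ≤⟨ ∑-mono ys (λ y∈ → ≰⇒> (h y∈)) ⟩
    ∑ ys (λ y → count (λ i → bad i y) is)      ≡⟨ ∑-swap ys is (λ y i → ⟦ bad i y ⟧) ⟩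
    ∑ is (λ i → count (bad i) ys)              ∎))
  where open ≤-Reasoning

∑-exceeds : ∀ (xs : List A) (g h : A → ℕ) → ∑ xs g < ∑ xs h → ∃[ x ] x ∈ xs × g x < h x
∑-exceeds xs g h lt with search (λ x → g x <? h x) xs
... | inj₁ r = r
... | inj₂ f = contradiction lt (≤⇒≯ (∑-mono xs (λ x∈ → ≮⇒≥ (f x∈))))

argmin : ∀ (g : A → ℕ) x xs → ∃[ m ] m ∈ x ∷ xs × (∀ {y} → y ∈ x ∷ xs → g m ≤ g y)
argmin g x [] = x , here refl , λ where (here refl) → ≤-refl
argmin g x (y ∷ ys) with argmin g y ys
... | m , m∈ , least with ≤-total (g x) (g m)
...   | inj₁ x≤m = x , here refl , λ where
          (here refl) → ≤-refl
          (there z∈)  → ≤-trans x≤m (least z∈)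
...   | inj₂ m≤x = m , there m∈ , λ where
          (here refl) → m≤x
          (there z∈)  → least z∈

module Delete {A : Set} (_≟_ : DecidableEquality A) where

  differs : A → A → Bool
  differs x y = not (does (y ≟ x))

  delete : A → List A → List A
  delete x = keep (differs x)

  ∈-delete⁺ : ∀ {x y xs} → y ∈ xs → y ≢ x → y ∈ delete x xs
  ∈-delete⁺ {x} {y} y∈ y≢x = ∈-keep⁺ (differs x) y∈ (cong not (dec-false (y ≟ x) y≢x))

  ∈-delete⁻ : ∀ {x y xs} → y ∈ delete x xs → y ∈ xs × y ≢ x
  ∈-delete⁻ {x} {y} {xs} y∈ with ∈-keep⁻ (differs x) {xs = xs} y∈
  ... | y∈xs , ok = y∈xs , λ y≡x → true≢false ok (cong not (dec-true (y ≟ x) y≡x))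

  delete-unique : ∀ x {xs} → Unique xs → Unique (delete x xs)
  delete-unique x = keep-unique (differs x)

  delete-length : ∀ {x xs} → Unique xs → x ∈ xs → length (delete x xs) < length xs
  delete-length {x} {xs} ux x∈ = length-⊆ {xs = x ∷ delete x xs} {xs}
    (All.tabulate (λ y∈ x≡y → proj₂ (∈-delete⁻ {xs = xs} y∈) (sym x≡y)) ∷ delete-unique x ux)
    λ where
      (here refl) → x∈
      (there y∈)  → proj₁ (∈-delete⁻ {xs = xs} y∈)

-- Independent sets

record Independent (R : A → A → Bool) (xs : List A) : Set where
  field
    elems  : List A
    unique : Unique elems
    sub    : ∀ {x} → x ∈ elems → x ∈ xs
    indep  : ∀ {x y} → x ∈ elems → y ∈ elems → R x y ≡ false
open Independent public

-- Turán's bound in linear form.  A vertex of least degree δ is selected and its closed neighbourhood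
-- deleted; the step loses nothing because (q − δ)(q − δ − 1) ≥ 0.
module _ {A : Set} (_≟_ : DecidableEquality A) (R : A → A → Bool)
         (R-sym : ∀ x y → R x y ≡ R y x) (R-irrefl : ∀ x → R x x ≡ false) (q : ℕ) where

  private
    step-bound : ∀ δ → 2 * q * suc δ ≤ q * suc q + suc δ * δ
    -- Truncated subtraction rules out the product form of the surplus, so it is exhibited as e + e
    -- * e, with e the distance from q to δ in one case and from δ + 1 to q in the other.
    step-bound δ with q ≤? δ
    ... | yes q≤δ = subst (λ d → 2 * q * suc d ≤ q * suc q + suc d * d) (m+[n∸m]≡n q≤δ)
                      (subst (2 * q * suc (q + e) ≤_) (sym (expand q e)) (m≤m+n _ _))
      where
      e = δ ∸ q
      expand : ∀ q e → q * suc q + suc (q + e) * (q + e) ≡ 2 * q * suc (q + e) + (e + e * e)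
      expand = solve-∀
    ... | no q≰δ = subst (λ q → 2 * q * suc δ ≤ q * suc q + suc δ * δ) (m+[n∸m]≡n (≰⇒> q≰δ))
                     (subst (2 * (suc δ + e) * suc δ ≤_) (sym (expand δ e)) (m≤m+n _ _))
      where
      e = q ∸ suc δ
      expand : ∀ δ e → (suc δ + e) * suc (suc δ + e) + suc δ * δ ≡ 2 * (suc δ + e) * suc δ + (e + e * e)
      expand = solve-∀

    degrees : List A → ℕ
    degrees xs = ∑ xs (λ x → count (R x) xs)

    go : ∀ k xs → length xs ≤ k → Unique xs →
         Σ (Independent R xs) λ I → 2 * q * length xs ≤ q * suc q * length (elems I) + degrees xs
    go k [] _ _ = record { elems = [] ; unique = [] ; sub = id ; indep = λ () } , ≤-trans (≤-reflexive (*-zeroʳ (2 * q))) z≤n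
    go (suc k) xs@(x₀ ∷ xs₀) (s≤s len) ux = I′ , bound
      where
      m = argmin (λ x → count (R x) xs) x₀ xs₀
      v₀ = proj₁ m
      v∈ : v₀ ∈ xs
      v∈ = proj₁ (proj₂ m)
      δ = count (R v₀) xs
      kill : A → Bool
      kill y = does (v₀ ≟ y) ∨ R v₀ y
      dead = keep kill xs
      rest = keep (not ∘ kill) xs
      -- Irreflexivity makes the two alternatives exclusive, so the closed neighbourhood has exactly
      -- δ + 1 elements; the induction uses this equality.
      ⟦kill⟧ : ∀ y → ⟦ kill y ⟧ ≡ ⟦ does (v₀ ≟ y) ⟧ + ⟦ R v₀ y ⟧
      ⟦kill⟧ y with v₀ ≟ y
      ... | yes refl rewrite R-irrefl v₀ = refl
      ... | no _ = refl
      dead-size : length dead ≡ suc δ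
      dead-size = trans (length-keep kill xs) (trans (∑-cong xs ⟦kill⟧) (trans (∑-+ xs (λ y → ⟦ does (v₀ ≟ y) ⟧) (λ y → ⟦ R v₀ y ⟧)) (cong (_+ δ) once)))
        where
        once : count (λ y → does (v₀ ≟ y)) xs ≡ 1
        once = ≤-antisym
          (count-does≤1 (v₀ ≟_) ux λ _ _ p q → trans (sym p) q)
          (count-pos _ v∈ (dec-true (v₀ ≟ v₀) refl))
      split-length : length xs ≡ length dead + length rest
      split-length = trans (length-∑ xs) (trans (∑-split kill xs (λ _ → 1))
                       (sym (cong₂ _+_ (length-∑ dead) (length-∑ rest))))
      rest-small : length rest ≤ k
      rest-small = ≤-trans (s≤s⁻¹ (subst (suc (length rest) ≤_)
                     (sym (trans split-length (cong (_+ length rest) dead-size))) (s≤s (m≤n+m _ δ)))) len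
      IH = go k rest rest-small (keep-unique (not ∘ kill) ux)
      I₀ = proj₁ IH
      apart : ∀ {y} → y ∈ elems I₀ → kill y ≡ false
      apart {y} y∈ with kill y | proj₂ (∈-keep⁻ (not ∘ kill) {xs = xs} (sub I₀ y∈))
      ... | false | _ = refl
      apartR : ∀ {y} → y ∈ elems I₀ → R v₀ y ≡ false
      apartR {y} y∈ with does (v₀ ≟ y) | apart y∈
      ... | false | eq = eq
      I′ : Independent R xs
      I′ .elems = v₀ ∷ elems I₀
      I′ .unique = All.tabulate (λ {y} y∈ v≡y → true≢false (cong (_∨ R v₀ y) (dec-true (v₀ ≟ y) v≡y)) (apart y∈)) ∷ unique I₀
      I′ .sub (here refl) = v∈
      I′ .sub (there y∈)  = proj₁ (∈-keep⁻ (not ∘ kill) (sub I₀ y∈))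
      I′ .indep (here refl) (here refl) = R-irrefl _
      I′ .indep (here refl) (there y∈)  = apartR y∈
      I′ .indep (there x∈)  (here refl) = trans (R-sym _ _) (apartR x∈)
      I′ .indep (there x∈)  (there y∈)  = indep I₀ x∈ y∈
      -- Each deleted vertex has degree at least δ by the choice of `v₀`, and the degrees of the
      -- others can only drop.
      degrees-split : suc δ * δ + degrees rest ≤ degrees xs
      degrees-split = begin
        suc δ * δ + degrees rest                        ≡⟨ cong (λ z → z * δ + degrees rest) (sym dead-size) ⟩
        length dead * δ + degrees rest                  ≡⟨ cong (_+ degrees rest) (sym (∑-const dead δ)) ⟩
        ∑ dead (λ _ → δ) + degrees rest                 ≤⟨ +-mono-≤
            (∑-mono dead λ x∈ → proj₂ (proj₂ m) (proj₁ (∈-keep⁻ kill x∈)))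
            (∑-mono rest λ {x} _ → ∑-⊆ (λ y → ⟦ R x y ⟧) (keep-unique (not ∘ kill) ux) (proj₁ ∘ ∈-keep⁻ (not ∘ kill))) ⟩
        ∑ dead (λ x → count (R x) xs) + ∑ rest (λ x → count (R x) xs) ≡⟨ sym (∑-split kill xs _) ⟩
        degrees xs ∎
        where open ≤-Reasoning
      bound : 2 * q * length xs ≤ q * suc q * suc (length (elems I₀)) + degrees xs
      bound = begin
        2 * q * length xs                                    ≡⟨ cong (2 * q *_) (trans split-length (cong (_+ length rest) dead-size)) ⟩
        2 * q * (suc δ + length rest)                        ≡⟨ *-distribˡ-+ (2 * q) (suc δ) _ ⟩
        2 * q * suc δ + 2 * q * length rest                  ≤⟨ +-mono-≤ (step-bound δ) (proj₂ IH) ⟩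
        (q * suc q + suc δ * δ) + (q * suc q * length (elems I₀) + degrees rest)
                                                             ≡⟨ shuffle (q * suc q) (suc δ * δ) (length (elems I₀)) (degrees rest) ⟩
        q * suc q * suc (length (elems I₀)) + (suc δ * δ + degrees rest) ≤⟨ +-monoʳ-≤ (q * suc q * suc (length (elems I₀))) degrees-split ⟩
        q * suc q * suc (length (elems I₀)) + degrees xs ∎
        where
        open ≤-Reasoning
        shuffle : ∀ a b c d → (a + b) + (a * c + d) ≡ a * suc c + (b + d)
        shuffle = solve-∀

  -- The bound is sharp for disjoint unions of cliques with q or q + 1 vertices, so q is chosen
  -- according to the cliques expected in the extremal case.
  turán : ∀ xs → Unique xs →
          Σ (Independent R xs) λ I → 2 * q * length xs ≤ q * suc q * length (elems I) + ∑ xs (λ x → count (R x) xs)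
  turán xs = go (length xs) xs ≤-refl

-- Forgetting directions turns each arc into at most two units of the degree sum, hence the factor
-- 2.
turán-directed : (_≟_ : DecidableEquality A) (D : A → A → Bool) → (∀ x → D x x ≡ false) → ∀ q xs → Unique xs →
  Σ (Independent D xs) λ I → 2 * q * length xs ≤ q * suc q * length (elems I) + 2 * ∑ xs (λ x → count (D x) xs)
turán-directed _≟_ D D-irrefl q xs ux
  with turán _≟_ (λ x y → D x y ∨ D y x) (λ x y → ∨-comm (D x y) (D y x)) (λ x → cong₂ _∨_ (D-irrefl x) (D-irrefl x)) q xs ux
... | I , bound = record { elems = elems I ; unique = unique I ; sub = sub I ; indep = λ {x} {y} x∈ y∈ → proj₁ (∨-false (D x y) (indep I x∈ y∈)) }
                , ≤-trans bound (+-monoʳ-≤ (q * suc q * length (elems I)) arcs)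
  where
  open ≤-Reasoning
  out = ∑ xs (λ x → count (D x) xs)
  arcs : ∑ xs (λ x → count (λ y → D x y ∨ D y x) xs) ≤ 2 * out
  arcs = begin
    ∑ xs (λ x → count (λ y → D x y ∨ D y x) xs)               ≤⟨ ∑-mono xs (λ {x} _ → count-∨ (D x) (λ y → D y x) xs) ⟩
    ∑ xs (λ x → count (D x) xs + count (λ y → D y x) xs)      ≡⟨ ∑-+ xs _ _ ⟩
    out + ∑ xs (λ x → ∑ xs (λ y → ⟦ D y x ⟧))                 ≡⟨ cong (out +_) (∑-swap xs xs (λ x y → ⟦ D y x ⟧)) ⟩
    out + out                                                 ≡⟨ cong (out +_) (sym (+-identityʳ out)) ⟩
    2 * out ∎

module _ {A : Set} (_≟_ : DecidableEquality A) (g : A → A) where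

  maps-to : A → A → Bool
  maps-to x y = does (g x ≟ y)

  -- With q = 2 and at most one arc per element, Turán's bound reads 4n ≤ 6α + 2n. Directed
  -- triangles show that a third is best possible.
  functional-independent : (∀ x → g x ≢ x) → ∀ xs → Unique xs →
                           Σ (Independent maps-to xs) λ I → length xs ≤ 3 * length (elems I)
  functional-independent g≢ xs ux with turán-directed _≟_ maps-to (λ x → dec-false (g x ≟ x) (g≢ x)) 2 xs ux
  ... | I , bound = I , *-cancelˡ-≤ 2 (+-cancelʳ-≤ (2 * length xs) _ _ (begin
      2 * length xs + 2 * length xs                            ≡⟨ double (length xs) ⟩
      4 * length xs                                            ≤⟨ bound ⟩
      6 * length (elems I) + 2 * ∑ xs (λ x → count (maps-to x) xs)
        ≤⟨ +-monoʳ-≤ (6 * length (elems I)) (*-monoʳ-≤ 2 (∑-bound xs λ {x} _ →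
              count-does≤1 (g x ≟_) ux λ _ _ p q → trans (sym p) q)) ⟩
      6 * length (elems I) + 2 * (length xs * 1)               ≡⟨ regroup (length (elems I)) (length xs) ⟩
      2 * (3 * length (elems I)) + 2 * length xs ∎))
    where
    open ≤-Reasoning
    double : ∀ a → 2 * a + 2 * a ≡ 4 * a
    double = solve-∀
    regroup : ∀ a b → 6 * a + 2 * (b * 1) ≡ 2 * (3 * a) + 2 * b
    regroup = solve-∀

-- Edges and copies

edge-≡ : ∀ {G} {e e′ : Edge G} → u e ≡ u e′ → v e ≡ v e′ → e ≡ e′
edge-≡ {e = edge a b p q} {edge .a .b p′ q′} refl refl with <-irrelevant p p′ | q | q′
... | refl | s | t = cong (edge a b p) (uip s t)
  where
  uip : ∀ {x y : Bool} (s t : x ≡ y) → s ≡ t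
  uip refl refl = refl

_≟ᵉ_ : ∀ {G} → DecidableEquality (Edge G)
e ≟ᵉ e′ = map′ (λ (p , q) → edge-≡ p q) (λ where refl → refl , refl) ((u e Fin.≟ u e′) ×-dec (v e Fin.≟ v e′))

data Joins {G : Graph} (e : Edge G) (x y : Fin (n G)) : Set where
  fwd : u e ≡ x → v e ≡ y → Joins e x y
  bwd : u e ≡ y → v e ≡ x → Joins e x y

joins-sym : ∀ {G} {e : Edge G} {x y} → Joins e x y → Joins e y x
joins-sym (fwd p q) = bwd p q
joins-sym (bwd p q) = fwd p q

joins-unique : ∀ {G} {e e′ : Edge G} {x y} → Joins e x y → Joins e′ x y → e ≡ e′
joins-unique (fwd refl refl) (fwd p q) = edge-≡ (sym p) (sym q)
joins-unique (bwd refl refl) (bwd p q) = edge-≡ (sym p) (sym q)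
joins-unique {e = e} {e′} (fwd refl refl) (bwd refl refl) = contradiction (u<v e) (<-asym (u<v e′))
joins-unique {e = e} {e′} (bwd refl refl) (fwd refl refl) = contradiction (u<v e) (<-asym (u<v e′))

joins-ends : ∀ {G} {e : Edge G} {a b x y} → Joins e a b → Joins e x y → (a ≡ x × b ≡ y) ⊎ (a ≡ y × b ≡ x)
joins-ends (fwd refl refl) (fwd p q) = inj₁ (p , q)
joins-ends (fwd refl refl) (bwd p q) = inj₂ (p , q)
joins-ends (bwd refl refl) (fwd p q) = inj₂ (q , p)
joins-ends (bwd refl refl) (bwd p q) = inj₁ (q , p)

joins-adj : ∀ {G} {e : Edge G} {x y} → Joins e x y → adj G x y ≡ true
joins-adj {e = e} (fwd refl refl) = isE e
joins-adj {G} {e} (bwd refl refl) = trans (adj-sym G _ _) (isE e)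

adj-≢ : ∀ G {x y} → adj G x y ≡ true → x ≢ y
adj-≢ G {x} a refl = true≢false a (irrefl G x)

link : ∀ G x y → adj G x y ≡ true → Edge G
link G x y a with Finₚ.<-cmp x y
... | tri< x<y _ _ = edge x y x<y a
... | tri≈ _ x≡y _ = contradiction x≡y (adj-≢ G a)
... | tri> _ _ y<x = edge y x y<x (trans (adj-sym G y x) a)

link-joins : ∀ G x y a → Joins (link G x y a) x y
link-joins G x y a with Finₚ.<-cmp x y
... | tri< _ _ _   = fwd refl refl
... | tri≈ _ x≡y _ = contradiction x≡y (adj-≢ G a)
... | tri> _ _ _   = bwd refl refl

self-joins : ∀ {G} (e : Edge G) → Joins e (u e) (v e)
self-joins e = fwd refl refl

edgesBetween : ∀ G (x y : Fin (n G)) → List (Edge G)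
edgesBetween G x y with x Finₚ.<? y | adj G x y ≟ᵇ true
... | yes x<y | yes a = edge x y x<y a ∷ []
... | _       | _     = []

∈-edgesBetween : ∀ G x y (x<y : x Fin.< y) (a : adj G x y ≡ true) → edge x y x<y a ∈ edgesBetween G x y
∈-edgesBetween G x y x<y a with x Finₚ.<? y | adj G x y ≟ᵇ true
... | yes _  | yes _ = here (edge-≡ refl refl)
... | no x≮y | _     = contradiction x<y x≮y
... | yes _  | no ¬a = contradiction a ¬a

allEdges : ∀ G → List (Edge G)
allEdges G = concatMap (λ x → concatMap (edgesBetween G x) (allFin (n G))) (allFin (n G))

∈-allEdges : ∀ {G} (e : Edge G) → e ∈ allEdges G
∈-allEdges {G} (edge x y x<y a) =
  ∈-concatMap⁺ (λ x → concatMap (edgesBetween G x) (allFin (n G)))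
    (lose (∈-allFin x) (∈-concatMap⁺ (edgesBetween G x) (lose (∈-allFin y) (∈-edgesBetween G x y x<y a))))

searchEdge : ∀ {G} {P : Edge G → Set} → (∀ e → Dec (P e)) → (∃[ e ] P e) ⊎ (∀ e → ¬ P e)
searchEdge {G} P? with search P? (allEdges G)
... | inj₁ (e , _ , p) = inj₁ (e , p)
... | inj₂ h           = inj₂ λ e → h (∈-allEdges e)

F1-≢ : ∀ {G} (f : F1 G) e → proj₁ f e ≢ e
F1-≢ f e eq = proj₂ f e (cong u eq , cong v eq)

mkF1 : ∀ {G} (f : Edge G → Edge G) → (∀ e → f e ≢ e) → F1 G
mkF1 f f≢ = f , λ e (p , q) → f≢ e (edge-≡ p q)

inCopy⁺ : ∀ {H G} (c : Copy H G) {e i j} → adj H i j ≡ true → Joins e (map c i) (map c j) → InCopy c e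
inCopy⁺ c {i = i} {j} a (fwd p q) = i , j , a , sym p , sym q
inCopy⁺ {H} c {i = i} {j} a (bwd p q) = j , i , trans (adj-sym H j i) a , sym p , sym q

_∘ᶜ_ : ∀ {G₁ G₂ G₃} → Copy G₂ G₃ → Copy G₁ G₂ → Copy G₁ G₃
d ∘ᶜ c = copy (map d ∘ map c) (inj c ∘ inj d) (λ i j a → hom d _ _ (hom c i j a))

push : ∀ {H G} → Copy H G → Edge H → Edge G
push {G = G} c e = link G (map c (u e)) (map c (v e)) (hom c _ _ (isE e))

push-joins : ∀ {H G} (c : Copy H G) {e x y} → Joins e x y → Joins (push c e) (map c x) (map c y)
push-joins c {e} (fwd refl refl) = link-joins _ _ _ _
push-joins c {e} (bwd refl refl) = joins-sym (link-joins _ _ _ _)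

push-injective : ∀ {H G} (c : Copy H G) {e e′} → push c e ≡ push c e′ → e ≡ e′
push-injective c {e} {e′} eq with joins-ends (push-joins c (self-joins e)) (subst (λ z → Joins z _ _) (sym eq) (push-joins c (self-joins e′)))
... | inj₁ (p , q) = edge-≡ (inj c p) (inj c q)
... | inj₂ (p , q) = joins-unique (self-joins e) (bwd (inj c (sym q)) (inj c (sym p)))

-- Completes a partial map to a total one without fixed points. Outside the domain of `B` the value
-- is a, and at a itself it is b, which is why two distinct edges must be at hand.
adversary : ∀ {G} (B : Edge G → Edge G → Set) → (∀ e e′ → Dec (B e e′)) →
            (∀ {e e₁ e₂} → B e e₁ → B e e₂ → e₁ ≡ e₂) → (∀ {e} → ¬ B e e) →
            (a b : Edge G) → a ≢ b →
            Σ (F1 G) λ f → ∀ {e e′} → B e e′ → proj₁ f e ≡ e′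
adversary {G} B B? functional B-irrefl a b a≢b = mkF1 f f≢ , f-B
  where
  other : Edge G → Edge G
  other e with a ≟ᵉ e
  ... | yes _ = b
  ... | no _  = a
  other≢ : ∀ e → other e ≢ e
  other≢ e with a ≟ᵉ e
  ... | yes a≡e = λ b≡e → a≢b (trans a≡e (sym b≡e))
  ... | no a≢e  = a≢e
  f : Edge G → Edge G
  f e with searchEdge (B? e)
  ... | inj₁ (e′ , _) = e′
  ... | inj₂ _        = other e
  f≢ : ∀ e → f e ≢ e
  f≢ e with searchEdge (B? e)
  ... | inj₁ (e′ , r) = λ eq → B-irrefl (subst (B e) eq r)
  ... | inj₂ _        = other≢ e
  f-B : ∀ {e e′} → B e e′ → f e ≡ e′
  f-B {e} {e′} r with searchEdge (B? e)
  ... | inj₁ (_ , r′) = functional r′ r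
  ... | inj₂ h        = contradiction r (h e′)

-- Carries a map on the edges of a subgraph over to the whole graph, so that unavoidability of the
-- latter can be applied to it. Only the value on edges outside the subgraph is left to choose.
module Extension {G′ G} (κ : Copy G′ G) (f : F1 G′) (default : Edge G → Edge G)
                 (default≢ : ∀ e → (∀ e′ → push κ e′ ≢ e) → default e ≢ e) where

  private
    g : Edge G → Edge G
    g e with searchEdge (λ e′ → push κ e′ ≟ᵉ e)
    ... | inj₁ (e′ , _) = push κ (proj₁ f e′)
    ... | inj₂ _        = default e

    g≢ : ∀ e → g e ≢ e
    g≢ e with searchEdge (λ e′ → push κ e′ ≟ᵉ e)
    ... | inj₁ (e′ , refl) = λ eq → F1-≢ f e′ (push-injective κ eq)
    ... | inj₂ h           = default≢ e h

  extended : F1 G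
  extended = mkF1 g g≢

  extended-push : ∀ e′ → proj₁ extended (push κ e′) ≡ push κ (proj₁ f e′)
  extended-push e′ with searchEdge (λ e″ → push κ e″ ≟ᵉ push κ e′)
  ... | inj₁ (e″ , eq) = cong (push κ ∘ proj₁ f) (push-injective κ eq)
  ... | inj₂ h         = contradiction refl (h e′)

  extended-new : ∀ e → (∀ e′ → push κ e′ ≢ e) → proj₁ extended e ≡ default e
  extended-new e h with searchEdge (λ e′ → push κ e′ ≟ᵉ e)
  ... | inj₁ (e′ , eq) = contradiction eq (h e′)
  ... | inj₂ _         = refl

  pull-free : ∀ {F} (c : Copy F G) (c′ : Copy F G′) → (∀ x → map κ (map c′ x) ≡ map c x) →
              FFree c (proj₁ extended) → FFree c′ (proj₁ f)
  pull-free c c′ eq free e e∈ fe∈ = free (push κ e) (lift {e} e∈) (subst (InCopy c) (sym (extended-push e)) (lift {proj₁ f e} fe∈))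
    where
    lift : ∀ {e} → InCopy c′ e → InCopy c (push κ e)
    lift {e} (i , j , a , p , q) = inCopy⁺ c a (subst₂ (Joins (push κ e)) (eq i) (eq j) (push-joins κ {e} (fwd (sym p) (sym q))))

-- Minimal unavoidable subgraphs

Part : Graph → Set
Part G = Fin (n G) ⊎ Fin (n G) × Fin (n G)

_≟ᵖ_ : ∀ {G} → DecidableEquality (Part G)
_≟ᵖ_ = Sumₚ.≡-dec Fin._≟_ (Productₚ.≡-dec Fin._≟_ Fin._≟_)

adjᵖ : ∀ G → Fin (n G) × Fin (n G) → Bool
adjᵖ G (x , y) = adj G x y

pairs : ∀ m → List (Fin m × Fin m)
pairs m = cartesianProduct (allFin m) (allFin m)

-- Their number is the measure for the descent to a minimal graph. Adjacent pairs occur in both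
-- orders, which makes the list stable under embeddings that reverse the order of two end points.
parts : ∀ G → List (Part G)
parts G = List.map inj₁ (allFin (n G)) ++ List.map inj₂ (keep (adjᵖ G) (pairs (n G)))

parts-unique : ∀ G → Unique (parts G)
parts-unique G = Uniqueₚ.++⁺
  (Uniqueₚ.map⁺ Sumₚ.inj₁-injective (Uniqueₚ.allFin⁺ (n G)))
  (Uniqueₚ.map⁺ Sumₚ.inj₂-injective (keep-unique (adjᵖ G) (Uniqueₚ.cartesianProduct⁺ (Uniqueₚ.allFin⁺ _) (Uniqueₚ.allFin⁺ _))))
  λ (p , q) → case ∈-map⁻ inj₁ p of λ where
    (_ , _ , refl) → case ∈-map⁻ inj₂ q of λ where (_ , _ , ())

vertex∈parts : ∀ G x → inj₁ x ∈ parts G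
vertex∈parts G x = ∈-++⁺ˡ (∈-map⁺ inj₁ (∈-allFin x))

pair∈parts : ∀ G {x y} → adj G x y ≡ true → inj₂ (x , y) ∈ parts G
pair∈parts G {x} {y} a = ∈-++⁺ʳ (List.map inj₁ (allFin (n G)))
  (∈-map⁺ inj₂ (∈-keep⁺ (adjᵖ G) (∈-cartesianProduct⁺ (∈-allFin x) (∈-allFin y)) a))

pair∈parts⁻ : ∀ G {x y} → inj₂ (x , y) ∈ parts G → adj G x y ≡ true
pair∈parts⁻ G p∈ with ∈-++⁻ (List.map inj₁ (allFin (n G))) p∈
... | inj₁ q = case ∈-map⁻ inj₁ q of λ where (_ , _ , ())
... | inj₂ q with ∈-map⁻ inj₂ q
...   | _ , r , refl = proj₂ (∈-keep⁻ (adjᵖ G) {xs = pairs (n G)} r)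

covers : DecidableEquality A → ∀ {xs ys : List A} → Unique xs → (∀ {x} → x ∈ xs → x ∈ ys) →
         length ys ≤ length xs → ∀ {y} → y ∈ ys → y ∈ xs
covers _≟_ {xs} {ys} ux sub le {y} y∈ with Any.any? (y ≟_) xs
... | yes y∈xs = y∈xs
... | no y∉xs  = contradiction le (<⇒≱ (length-⊆ {xs = y ∷ xs} {ys} (All.tabulate (λ z∈ y≡z → y∉xs (lose z∈ y≡z)) ∷ ux)
                   λ where (here refl) → y∈ ; (there z∈) → sub z∈))

-- If the measure did not drop, the injection that the embedding induces on parts would be onto, and
-- every vertex and edge would be in the image.
properSub-smaller : ∀ {G′ G} → ProperSub G′ G → length (parts G′) < length (parts G)
properSub-smaller {G′} {G} (κ , proper) with length (parts G′) <? length (parts G)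
... | yes lt = lt
... | no ≮   = contradiction ((λ x → vertex (back (vertex∈parts G x))) , λ e → pair e (back (pair∈parts G (isE e)))) proper
  where
  κᵖ : Part G′ → Part G
  κᵖ (inj₁ x)       = inj₁ (map κ x)
  κᵖ (inj₂ (x , y)) = inj₂ (map κ x , map κ y)
  κᵖ-injective : ∀ {p q} → κᵖ p ≡ κᵖ q → p ≡ q
  κᵖ-injective {inj₁ _} {inj₁ _} eq = cong inj₁ (inj κ (Sumₚ.inj₁-injective eq))
  κᵖ-injective {inj₂ _} {inj₂ _} eq =
    let (p , q) = Productₚ.,-injective (Sumₚ.inj₂-injective eq) in cong inj₂ (cong₂ _,_ (inj κ p) (inj κ q))
  forth : ∀ {p} → p ∈ List.map κᵖ (parts G′) → p ∈ parts G
  forth p∈ with ∈-map⁻ κᵖ p∈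
  ... | inj₁ x , _ , refl       = vertex∈parts G _
  ... | inj₂ (x , y) , q , refl = pair∈parts G (hom κ x y (pair∈parts⁻ G′ q))
  back : ∀ {p} → p ∈ parts G → p ∈ List.map κᵖ (parts G′)
  back = covers (_≟ᵖ_ {G}) (Uniqueₚ.map⁺ κᵖ-injective (parts-unique G′)) forth
           (subst (length (parts G) ≤_) (sym (length-map κᵖ (parts G′))) (≮⇒≥ ≮))
  vertex : ∀ {x} → inj₁ x ∈ List.map κᵖ (parts G′) → ∃[ i ] map κ i ≡ x
  vertex p∈ with ∈-map⁻ κᵖ p∈
  ... | inj₁ i , _ , refl = i , refl
  pair : ∀ e → inj₂ (u e , v e) ∈ List.map κᵖ (parts G′) → InCopy κ e
  pair e p∈ with ∈-map⁻ κᵖ p∈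
  ... | inj₂ (i , j) , q , eq = let (p , r) = Productₚ.,-injective (Sumₚ.inj₂-injective eq) in
          i , j , pair∈parts⁻ G′ q , sym p , sym r

-- Descent on the measure. Whether some proper subgraph is still unavoidable is not decided, hence
-- the double negation; it is harmless where a contradiction is being derived.
minimal-subgraph : ∀ {F} k G → length (parts G) ≤ k → Unavoidable F G →
                   ¬ ¬ (Σ Graph λ G′ → MinUnavoidable F G′ × Copy G′ G)
minimal-subgraph k G le un none = none (G , (un , minimal k le) , copy id id (λ _ _ a → a))
  where
  minimal : ∀ k → length (parts G) ≤ k → ∀ G′ → ProperSub G′ G → ¬ Unavoidable _ G′
  minimal zero    le G′ sub _ = contradiction (≤-trans (properSub-smaller sub) le) λ ()
  minimal (suc k) le G′ sub un′ =
    minimal-subgraph k G′ (s≤s⁻¹ (≤-trans (properSub-smaller sub) le)) un′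
      λ (G″ , min , c) → none (G″ , min , proj₁ sub ∘ᶜ c)

≅-size : ∀ {G H} → G ≅ H → n G ≤ n H
≅-size (φ , ψ , ψφ , _) = Finₚ.injective⇒≤ {f = φ} λ {x} {y} eq → trans (sym (ψφ x)) (trans (cong ψ eq) (ψφ y))

infinite-criterion : ∀ F →
  (∀ N → Σ Graph λ G → Unavoidable F G × (∀ G′ → Copy G′ G → n G′ ≤ N → ¬ Unavoidable F G′)) → ¬ MFinite F
-- The sum of the vertex numbers in the list exceeds or equals each of them, so a minimal graph
-- isomorphic to a listed one would be small.
infinite-criterion F large (L , complete) with large (∑ L n)
... | G , un , small = minimal-subgraph _ G ≤-refl un λ (G′ , min , c) →
  let (X , X∈ , iso) = find (complete G′ min)
  in small G′ c (≤-trans (≅-size {G′} {X} iso) (∈-∑ X∈)) (proj₁ min)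
  where
  ∈-∑ : ∀ {X L} → X ∈ L → n X ≤ ∑ L n
  ∈-∑ (here refl) = m≤m+n _ _
  ∈-∑ {L = Y ∷ _} (there X∈) = ≤-trans (∈-∑ X∈) (m≤n+m _ (n Y))

-- Forests

count≤1⇒≡ : ∀ (p : A → Bool) {xs} {x y : A} → count p xs ≤ 1 → x ∈ xs → y ∈ xs → p x ≡ true → p y ≡ true → DecidableEquality A → x ≡ y
count≤1⇒≡ p {xs} {x} {y} le x∈ y∈ px py _≟_ with x ≟ y
... | yes eq = eq
... | no x≢y = contradiction (≤-trans (subst (2 ≤_) (length-keep p xs) two) le) λ where (s≤s ())
  where
  two : 2 ≤ length (keep p xs)
  two = length-⊆ {xs = x ∷ y ∷ []} ((x≢y ∷ []) ∷ ([] ∷ [])) λ where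
    (here refl)         → ∈-keep⁺ p x∈ px
    (there (here refl)) → ∈-keep⁺ p y∈ py

record Path (H : Graph) (S : List (Fin (n H))) (l : ℕ) : Set where
  field
    at       : Fin (suc l) → Fin (n H)
    at-inj   : Injective _≡_ _≡_ at
    at-adj   : ∀ i j → toℕ j ≡ suc (toℕ i) → adj H (at i) (at j) ≡ true
    at-∈     : ∀ i → at i ∈ S

module _ {H : Graph} (forest : Forest H) {S : List (Fin (n H))} (S-unique : Unique S) where
  open Path

  no-cycle : ∀ {l} (P : Path H S l) j → 2 ≤ toℕ j → adj H (at P fzero) (at P j) ≢ true
  no-cycle {l} P j 2≤j a = forest k c (λ eq → Finₚ.inject≤-injective _ _ _ _ (at-inj P eq))
      (λ i → at-adj P _ _ (trans (Finₚ.toℕ-inject≤ (fsuc i) bound) (cong suc (sym (trans (Finₚ.toℕ-inject≤ _ _) (Finₚ.toℕ-inject₁ i))))))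
      (trans (cong₂ (adj H) (cong (at P) (Finₚ.toℕ-injective (trans (Finₚ.toℕ-inject≤ _ bound) (trans (Finₚ.toℕ-fromℕ _) 2+k)))) refl)
             (trans (adj-sym H _ _) a))
    where
    -- `Forest` writes cycle lengths as 3 + k; the chord from position 0 to position j closes a
    -- cycle on j + 1 vertices.
    k = toℕ j ∸ 2
    2+k : 2 + k ≡ toℕ j
    2+k = m+[n∸m]≡n 2≤j
    bound : 3 + k ≤ suc l
    bound = subst (λ z → suc z ≤ suc l) (sym 2+k) (Finₚ.toℕ<n j)
    c : Fin (3 + k) → Fin (n H)
    c i = at P (Fin.inject≤ i bound)

  module _ (branching : ∀ {x} → x ∈ S → 2 ≤ count (adj H x) S) where

    neighbour-avoiding : ∀ {x} w → x ∈ S → ∃[ y ] y ∈ S × adj H x y ≡ true × y ≢ w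
    neighbour-avoiding {x} w x∈ with escape (w ∷ []) (keep (adj H x) S) (λ w y → does (y Fin.≟ w))
        (≤-trans (s≤s (subst (_≤ 1) (sym (+-identityʳ _)) (count-does≤1 (Fin._≟ w) (keep-unique (adj H x) S-unique)
           λ _ _ p q → trans p (sym q)))) (≤-trans (branching x∈) (≤-reflexive (sym (length-keep (adj H x) S)))))
    ... | y , y∈ , ok = y , proj₁ (∈-keep⁻ (adj H x) y∈) , proj₂ (∈-keep⁻ (adj H x) {xs = S} y∈)
                      , λ y≡w → true≢false (dec-true (y Fin.≟ w) y≡w) (ok (here refl))

    -- The vertex to which the path must not turn back. A path of length 0 has none; its only vertex
    -- is a harmless substitute, as no vertex is its own neighbour.
    second : ∀ {l} → Path H S l → Fin (n H)
    second {zero}  P = at P fzero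
    second {suc l} P = at P (fsuc fzero)

    -- A path is prolonged at its first vertex until the new vertex already lies on it, which closes a cycle.
    grow : ∀ fuel {l} → Path H S l → n H ≤ l + fuel → ⊥
    grow zero {l} P le = <⇒≱ (Finₚ.injective⇒≤ (at-inj P)) (subst (n H ≤_) (+-identityʳ l) le)
    grow (suc fuel) {l} P le with neighbour-avoiding (second P) (at-∈ P fzero)
    ... | y , y∈ , a , y≢ with Finₚ.any? (λ j → at P j Fin.≟ y)
    ...   | no fresh = grow fuel P′ (subst (n H ≤_) (+-suc l fuel) le)
      where
      P′ : Path H S (suc l)
      P′ .at fzero    = y
      P′ .at (fsuc i) = at P i
      P′ .at-inj {fzero}  {fzero}  eq = refl
      P′ .at-inj {fzero}  {fsuc j} eq = contradiction (j , sym eq) fresh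
      P′ .at-inj {fsuc i} {fzero}  eq = contradiction (i , eq) fresh
      P′ .at-inj {fsuc i} {fsuc j} eq = cong fsuc (at-inj P eq)
      P′ .at-adj fzero    (fsuc fzero) eq = trans (adj-sym H _ _) a
      P′ .at-adj (fsuc i) (fsuc j)     eq = at-adj P i j (suc-injective eq)
      P′ .at-∈ fzero    = y∈
      P′ .at-∈ (fsuc i) = at-∈ P i
    ...   | yes (fzero , refl) = adj-≢ H a refl
    grow (suc fuel) {suc l} P le | y , y∈ , a , y≢ | yes (fsuc fzero , refl) = y≢ refl
    ...   | yes (fsuc (fsuc j) , refl) = no-cycle P (fsuc (fsuc j)) (s≤s (s≤s z≤n)) a

  -- Otherwise every vertex of S has two neighbours in S, and a path could be prolonged beyond `n H`
  -- vertices.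
  leaf : ∀ {x} → x ∈ S → ∃[ y ] y ∈ S × count (adj H y) S ≤ 1
  leaf {x} x∈ with search (λ y → count (adj H y) S ≤? 1) S
  ... | inj₁ r = r
  ... | inj₂ h = ⊥-elim (grow (λ y∈ → ≰⇒> (h y∈)) (n H) {0} start ≤-refl)
    where
    start : Path H S 0
    start .at _ = x
    start .at-inj {fzero} {fzero} _ = refl
    start .at-adj fzero fzero ()
    start .at-∈ _ = x∈

-- The tail is what remains when the head is deleted as a leaf or an isolated vertex. In the latter
-- case p is arbitrary and need not lie in S. Read from the end, the list is an order for embedding
-- the forest.
data Elimination (H : Graph) : List (Fin (n H)) → Set where
  []     : Elimination H []
  remove : ∀ {x S} → x ∉ S → (p : Fin (n H)) → (∀ {y} → y ∈ S → adj H x y ≡ true → y ≡ p) →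
           Elimination H S → Elimination H (x ∷ S)

elimination : ∀ {H} → Forest H → Σ (List (Fin (n H))) λ S → Elimination H S × (∀ x → x ∈ S)
elimination {H} forest = let (S , E , all , _) = go (n H) (allFin (n H)) (Uniqueₚ.allFin⁺ _) (≤-reflexive (length-tabulate id))
                         in S , E , λ x → all (∈-allFin x)
  where
  open Delete (Fin._≟_ {n H})
  go : ∀ k R → Unique R → length R ≤ k →
       Σ (List (Fin (n H))) λ S → Elimination H S × (∀ {x} → x ∈ R → x ∈ S) × (∀ {x} → x ∈ S → x ∈ R)
  go k [] _ _ = [] , [] , id , id
  go (suc k) R@(x₀ ∷ R₀) uR len with leaf {H} forest uR (here {xs = R₀} (refl {x = x₀}))
  ... | x , x∈ , deg≤1 with go k (delete x R) (delete-unique x uR) (s≤s⁻¹ (≤-trans (delete-length uR x∈) len))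
  ... | S , E , sup , sub = x ∷ S , remove x∉S (proj₁ parent) (λ y∈ a → proj₂ parent (below y∈) a) E , sup′ , sub′
    where
    below : ∀ {y} → y ∈ S → y ∈ R
    below y∈ = proj₁ (∈-delete⁻ {xs = R} (sub y∈))
    x∉S : x ∉ S
    x∉S x∈S = proj₂ (∈-delete⁻ {xs = R} (sub x∈S)) refl
    parent : ∃[ p ] (∀ {y} → y ∈ R → adj H x y ≡ true → y ≡ p)
    parent with search (λ y → adj H x y ≟ᵇ true) R
    ... | inj₁ (p , p∈ , a) = p , λ y∈ b → count≤1⇒≡ (adj H x) deg≤1 y∈ p∈ b a Fin._≟_
    ... | inj₂ none         = x , λ y∈ b → contradiction b (none y∈)
    sup′ : ∀ {y} → y ∈ R → y ∈ x ∷ S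
    sup′ {y} y∈ with y Fin.≟ x
    ... | yes refl = here refl
    ... | no y≢x   = there (sup (∈-delete⁺ y∈ y≢x))
    sub′ : ∀ {y} → y ∈ x ∷ S → y ∈ R
    sub′ (here refl) = x∈
    sub′ (there y∈)  = below y∈

Oriented : ∀ H → (Fin (n H) → Fin (n H)) → List (Fin (n H)) → Set
Oriented H p S = ∀ {x y} → x ∈ S → y ∈ S → adj H x y ≡ true → p x ≡ y ⊎ p y ≡ x

update : ∀ {m} → (Fin m → A) → Fin m → A → Fin m → A
update φ x a z with z Fin.≟ x
... | yes _ = a
... | no _  = φ z

update-same : ∀ {m} (φ : Fin m → A) x a → update φ x a x ≡ a
update-same φ x a with x Fin.≟ x
... | yes _ = refl
... | no h  = contradiction refl h

update-other : ∀ {m} (φ : Fin m → A) {x z} a → z ≢ x → update φ x a z ≡ φ z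
update-other φ {x} {z} a z≢x with z Fin.≟ x
... | yes eq = contradiction eq z≢x
... | no _   = refl

orientation : ∀ {H S} → Elimination H S → ∃[ p ] Oriented H p S
orientation [] = id , λ ()
orientation {H} {x ∷ S} (remove x∉S q toq E) with orientation E
... | p , ok = update p x q , ok′
  where
  off : ∀ {z} → z ∈ S → update p x q z ≡ p z
  off z∈ = update-other p q λ where refl → x∉S z∈
  ok′ : Oriented H (update p x q) (x ∷ S)
  ok′ (here refl) (here refl) a = contradiction refl (adj-≢ H a)
  ok′ (here refl) (there y∈)  a = inj₁ (trans (update-same p x q) (sym (toq y∈ a)))
  ok′ (there y∈)  (here refl) a = inj₂ (trans (update-same p x q) (sym (toq y∈ (trans (adj-sym H _ _) a))))
  ok′ (there y∈)  (there z∈)  a with ok y∈ z∈ a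
  ... | inj₁ eq = inj₁ (trans (off y∈) eq)
  ... | inj₂ eq = inj₂ (trans (off z∈) eq)

joins? : ∀ {G} (e : Edge G) x y → Dec (Joins e x y)
joins? e x y = map′ (λ where (inj₁ (p , q)) → fwd p q ; (inj₂ (p , q)) → bwd p q)
                    (λ where (fwd p q) → inj₁ (p , q) ; (bwd p q) → inj₂ (p , q))
                    (((u e Fin.≟ x) ×-dec (v e Fin.≟ y)) ⊎-dec ((u e Fin.≟ y) ×-dec (v e Fin.≟ x)))

-- A walk a-b-c-d along three edges; in a forest it is a path.
record Walk₃ (F : Graph) : Set where
  field
    a b c d : Fin (n F)
    ab  : adj F a b ≡ true
    bc  : adj F b c ≡ true
    cd  : adj F c d ≡ true
    a≢c : a ≢ c
    b≢d : b ≢ d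

-- Send every edge {x, p x} to {p x, p (p x)}: of two consecutive edges x-y-z with p y = z the first is
-- sent to the second, and every walk a-b-c-d contains such a pair.
forest-avoidable : ∀ {F G} → Walk₃ F → Forest G → ¬ Unavoidable F G
forest-avoidable {F} {G} w forest (c₀ , free) = absurd (free (proj₁ adv))
  where
  open Walk₃ w
  elim : Σ (List (Fin (n G))) λ S → Elimination G S × (∀ x → x ∈ S)
  elim = elimination forest
  p : Fin (n G) → Fin (n G)
  p = proj₁ (orientation (proj₁ (proj₂ elim)))
  oriented : ∀ {x y} → adj G x y ≡ true → p x ≡ y ⊎ p y ≡ x
  oriented = proj₂ (orientation (proj₁ (proj₂ elim))) (proj₂ (proj₂ elim) _) (proj₂ (proj₂ elim) _)
  -- The clause `p y ≢ x` serves twice: it keeps the image distinct from the edge, and it lets at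
  -- most one direction of an edge qualify.
  To : Fin (n G) → Fin (n G) → Edge G → Set
  To x y e = p x ≡ y × p y ≢ x × Joins e y (p y)
  to? : ∀ x y e → Dec (To x y e)
  to? x y e = (p x Fin.≟ y) ×-dec ((¬? (p y Fin.≟ x)) ×-dec joins? e y (p y))
  R : Edge G → Edge G → Set
  R e e′ = To (u e) (v e) e′ ⊎ To (v e) (u e) e′
  functional : ∀ {e e₁ e₂} → R e e₁ → R e e₂ → e₁ ≡ e₂
  functional (inj₁ (_ , _ , j)) (inj₁ (_ , _ , k)) = joins-unique j k
  functional (inj₂ (_ , _ , j)) (inj₂ (_ , _ , k)) = joins-unique j k
  functional (inj₁ (_ , h , _)) (inj₂ (eq , _ , _)) = contradiction eq h
  functional (inj₂ (_ , h , _)) (inj₁ (eq , _ , _)) = contradiction eq h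
  irreflexive : ∀ {e} → ¬ R e e
  irreflexive {e} (inj₁ (_ , h , j)) with joins-ends (self-joins e) j
  ... | inj₁ (eq , _) = contradiction (u<v e) (<-irrefl (cong toℕ eq))
  ... | inj₂ (eq , _) = h (sym eq)
  irreflexive {e} (inj₂ (_ , h , j)) with joins-ends (self-joins e) j
  ... | inj₁ (_ , eq) = h (sym eq)
  ... | inj₂ (_ , eq) = contradiction (u<v e) (<-irrefl (cong toℕ (sym eq)))
  edgeOf : (k : Copy F G) → ∀ {i j} → adj F i j ≡ true → Edge G
  edgeOf k a = link G _ _ (hom k _ _ a)
  ab≢bc : edgeOf c₀ ab ≢ edgeOf c₀ bc
  ab≢bc eq with joins-ends (link-joins G _ _ (hom c₀ _ _ ab)) (subst (λ z → Joins z _ _) (sym eq) (link-joins G _ _ (hom c₀ _ _ bc)))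
  ... | inj₁ (p , _) = adj-≢ F ab (inj c₀ p)
  ... | inj₂ (p , _) = a≢c (inj c₀ p)
  adv = adversary R (λ e e′ → to? (u e) (v e) e′ ⊎-dec to? (v e) (u e) e′)
          (λ {e} {e₁} {e₂} → functional {e} {e₁} {e₂}) (λ {e} → irreflexive {e}) (edgeOf c₀ ab) (edgeOf c₀ bc) ab≢bc
  f = proj₁ (proj₁ adv)
  advance : ∀ {e e′ x y z} → Joins e x y → Joins e′ y z → p x ≡ y → p y ≡ z → z ≢ x → f e ≡ e′
  advance {e} {e′} (fwd refl refl) j p₁ refl z≢x = proj₂ adv {e} {e′} (inj₁ (p₁ , z≢x , j))
  advance {e} {e′} (bwd refl refl) j p₁ refl z≢x = proj₂ adv {e} {e′} (inj₂ (p₁ , z≢x , j))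
  -- As p y = z differs from x, the edge xy must be oriented by p x = y, and so it is sent to yz.
  blocked : ∀ (k : Copy F G) {x y z} → adj F x y ≡ true → adj F y z ≡ true → x ≢ z →
            p (map k y) ≡ map k z → ¬ FFree k f
  blocked k {x} {y} {z} xy yz x≢z py free with oriented (hom k _ _ xy)
  ... | inj₂ py′ = x≢z (inj k (trans (sym py′) py))
  ... | inj₁ px  = free (edgeOf k xy) (inCopy⁺ k xy (link-joins G _ _ (hom k _ _ xy)))
      (subst (InCopy k) (sym (advance (link-joins G _ _ (hom k _ _ xy)) (link-joins G _ _ (hom k _ _ yz)) px py (λ eq → x≢z (sym (inj k eq)))))
        (inCopy⁺ k yz (link-joins G _ _ (hom k _ _ yz))))
  absurd : Σ (Copy F G) (λ k → FFree k f) → ⊥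
  -- The middle edge is oriented towards c or towards b; the second case is the first one for the
  -- reversed walk.
  absurd (k , fr) with oriented (hom k _ _ bc)
  ... | inj₁ pb = blocked k ab bc a≢c pb fr
  ... | inj₂ pc = blocked k (trans (adj-sym F _ _) cd) (trans (adj-sym F _ _) bc) (b≢d ∘ sym) pc fr

-- Graphs given by labelled edges

data Ends {V L : Set} (src dst : L → V) (l : L) (a b : V) : Set where
  fwd : src l ≡ a → dst l ≡ b → Ends src dst l a b
  bwd : src l ≡ b → dst l ≡ a → Ends src dst l a b

-- Lets vertices and edges keep their natural index types. A label determines an edge without
-- ordering its ends, whereas `Edge` depends on the numbering by `Fin`.
record Net : Set₁ where
  field
    size        : ℕ
    Vertex      : Set
    enc         : Vertex → Fin size
    dec         : Fin size → Vertex
    dec-enc     : ∀ a → dec (enc a) ≡ a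
    enc-dec     : ∀ i → enc (dec i) ≡ i
    Label       : Set
    _≟ˡ_        : DecidableEquality Label
    labels      : List Label
    complete    : ∀ l → l ∈ labels
    labels-uniq : Unique labels
    src dst     : Label → Vertex
    loopless    : ∀ l → src l ≢ dst l
    simple      : ∀ {l l′ a b} → Ends src dst l a b → Ends src dst l′ a b → l ≡ l′

module NetGraph (N : Net) where
  open Net N

  Links : Label → Vertex → Vertex → Set
  Links = Ends src dst

  ends-sym : ∀ {l a b} → Links l a b → Links l b a
  ends-sym (fwd p q) = bwd p q
  ends-sym (bwd p q) = fwd p q

  ends-≢ : ∀ {l a b} → Links l a b → a ≢ b
  ends-≢ (fwd refl refl) eq = loopless _ eq
  ends-≢ (bwd refl refl) eq = loopless _ (sym eq)

  enc-injective : ∀ {a b} → enc a ≡ enc b → a ≡ b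
  enc-injective {a} {b} eq = trans (sym (dec-enc a)) (trans (cong dec eq) (dec-enc b))

  dec-injective : ∀ {i j} → dec i ≡ dec j → i ≡ j
  dec-injective {i} {j} eq = trans (sym (enc-dec i)) (trans (cong enc eq) (enc-dec j))

  _≟ᵛ_ : DecidableEquality Vertex
  a ≟ᵛ b = map′ enc-injective (cong enc) (enc a Fin.≟ enc b)

  ends? : ∀ l a b → Dec (Links l a b)
  ends? l a b = map′ (λ where (inj₁ (p , q)) → fwd p q ; (inj₂ (p , q)) → bwd p q)
                     (λ where (fwd p q) → inj₁ (p , q) ; (bwd p q) → inj₂ (p , q))
                     (((src l ≟ᵛ a) ×-dec (dst l ≟ᵛ b)) ⊎-dec ((src l ≟ᵛ b) ×-dec (dst l ≟ᵛ a)))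

  linked? : ∀ a b → Dec (Any (λ l → Links l a b) labels)
  linked? a b = Any.any? (λ l → ends? l a b) labels

  linked-does : ∀ {l a b} → Links l a b → does (linked? a b) ≡ true
  linked-does {l} {a} {b} e = dec-true (linked? a b) (lose (complete l) e)

  does-linked : ∀ {a b} → does (linked? a b) ≡ true → ∃[ l ] Links l a b
  does-linked {a} {b} eq with find (witness (linked? a b) eq)
  ... | l , _ , e = l , e

  graph : Graph
  graph .n = size
  graph .adj i j = does (linked? (dec i) (dec j))
  graph .adj-sym i j with does (linked? (dec i) (dec j)) in p | does (linked? (dec j) (dec i)) in q
  ... | true  | true  = refl
  ... | false | false = refl
  ... | true  | false = ⊥-elim (true≢false (linked-does (ends-sym (proj₂ (does-linked p)))) q)
  ... | false | true  = ⊥-elim (true≢false (linked-does (ends-sym (proj₂ (does-linked q)))) p)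
  graph .irrefl i = not-true λ eq → ends-≢ (proj₂ (does-linked eq)) refl

  label : ∀ {i j} → adj graph i j ≡ true → ∃[ l ] Links l (dec i) (dec j)
  label = does-linked

  linked : ∀ {l a b} → Links l a b → adj graph (enc a) (enc b) ≡ true
  linked {a = a} {b} e rewrite dec-enc a | dec-enc b = linked-does e

  name : Edge graph → Label
  name e = proj₁ (label (isE e))

  name-ends : ∀ {e i j} → Joins {graph} e i j → Links (name e) (dec i) (dec j)
  name-ends {e} (fwd refl refl) = proj₂ (label (isE e))
  name-ends {e} (bwd refl refl) = ends-sym (proj₂ (label (isE e)))

  edgeOf : Label → Edge graph
  edgeOf l = link graph (enc (src l)) (enc (dst l)) (linked (fwd refl refl))

  name-edgeOf : ∀ l → name (edgeOf l) ≡ l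
  name-edgeOf l = simple (name-ends (link-joins graph _ _ (linked {l} (fwd refl refl)))) (fwd (sym (dec-enc _)) (sym (dec-enc _)))

  encoded : ∀ {a i} → a ≡ dec i → i ≡ enc a
  encoded eq = trans (sym (enc-dec _)) (cong enc (sym eq))

  edge-from-ends : ∀ {e l a b} → name e ≡ l → Links l a b → Joins {graph} e (enc a) (enc b)
  edge-from-ends {e} refl end with end | proj₂ (label (isE e))
  ... | fwd refl refl | fwd p q = fwd (encoded p) (encoded q)
  ... | fwd refl refl | bwd p q = bwd (encoded q) (encoded p)
  ... | bwd refl refl | fwd p q = bwd (encoded p) (encoded q)
  ... | bwd refl refl | bwd p q = fwd (encoded q) (encoded p)

  name-injective : ∀ {e e′} → name e ≡ name e′ → e ≡ e′
  name-injective {e} {e′} eq = joins-unique (edge-from-ends {e} refl (fwd refl refl)) (edge-from-ends {e′} (sym eq) (fwd refl refl))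

  -- `Chosen` may be larger than the edge set of the copy: the constructions deliver a large
  -- independent set first and find F inside it.
  record Placement (F : Graph) (g : Label → Label) : Set₁ where
    field
      place      : Fin (n F) → Vertex
      injective  : ∀ {i j} → place i ≡ place j → i ≡ j
      Chosen     : Label → Set
      separated  : ∀ {l l′} → Chosen l → Chosen l′ → g l ≢ l′
      realised   : ∀ {i j} → adj F i j ≡ true → ∃[ l ] Chosen l × Links l (place i) (place j)

  -- `Unavoidable` also asks for a bare copy. It is obtained by placing F for some map without fixed
  -- points, and two distinct labels ensure that one exists.
  net-unavoidable : ∀ {F} {l₁ l₂ : Label} → l₁ ≢ l₂ → (∀ g → (∀ l → g l ≢ l) → Placement F g) → Unavoidable F graph
  net-unavoidable {F} {l₁} {l₂} l₁≢l₂ placed = toCopy (placed divert divert≢) , λ f → let P = placed (onLabels f) (onLabels≢ f) in toCopy P , toFree f P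
    where
    open Placement
    toCopy : ∀ {g} → Placement F g → Copy F graph
    toCopy P = copy (enc ∘ place P) (λ eq → injective P (enc-injective eq)) λ i j a → linked (proj₂ (proj₂ (realised P a)))
    divert : Label → Label
    divert l with l₁ ≟ˡ l
    ... | yes _ = l₂
    ... | no _  = l₁
    divert≢ : ∀ l → divert l ≢ l
    divert≢ l with l₁ ≟ˡ l
    ... | yes eq = λ eq′ → l₁≢l₂ (trans eq (sym eq′))
    ... | no ne  = ne
    onLabels : F1 graph → Label → Label
    onLabels f l = name (proj₁ f (edgeOf l))
    onLabels≢ : ∀ f l → onLabels f l ≢ l
    onLabels≢ f l eq = F1-≢ f (edgeOf l) (name-injective (trans eq (sym (name-edgeOf l))))
    chosen : ∀ {g} (P : Placement F g) e → InCopy (toCopy P) e → Chosen P (name e)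
    chosen P e (i , j , a , p , q) with realised P a
    ... | l , ch , end = subst (Chosen P) (simple end
          (subst₂ (Links (name e)) (dec-enc (place P i)) (dec-enc (place P j)) (name-ends {e} (fwd (sym p) (sym q))))) ch
    toFree : ∀ f (P : Placement F (onLabels f)) → FFree (toCopy P) (proj₁ f)
    toFree f P e e∈ fe∈ = separated P (chosen P e e∈) (chosen P (proj₁ f e) fe∈)
      (cong (name ∘ proj₁ f) (name-injective (name-edgeOf (name e))))

  module Sub {G′ : Graph} (κ : Copy G′ graph) where

    vertex : Fin (n G′) → Vertex
    vertex x = dec (map κ x)

    vertex-injective : ∀ {x y} → vertex x ≡ vertex y → x ≡ y
    vertex-injective eq = inj κ (dec-injective eq)

    subname : Edge G′ → Label
    subname e = name (push κ e)

    subname-injective : ∀ {e e′} → subname e ≡ subname e′ → e ≡ e′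
    subname-injective eq = push-injective κ (name-injective eq)

    subname-ends : ∀ {e x y} → Joins e x y → Links (subname e) (vertex x) (vertex y)
    subname-ends j = name-ends (push-joins κ j)

    net-adversary : ∀ (nxt : Label → Label) → (∀ l → nxt l ≢ l) → (a b : Edge G′) → a ≢ b →
                    Σ (F1 G′) λ f → ∀ {e e′} → nxt (subname e) ≡ subname e′ → proj₁ f e ≡ e′
    net-adversary nxt nxt≢ = adversary (λ e e′ → nxt (subname e) ≡ subname e′) (λ e e′ → nxt (subname e) ≟ˡ subname e′)
      (λ p q → subname-injective (trans (sym p) q)) (λ {e} → nxt≢ (subname e))

  -- A dense graph has a subgraph of large minimum degree, into which a forest embeds greedily.

  incident : Vertex → Label → Bool
  incident a l = does (src l ≟ᵛ a) ∨ does (dst l ≟ᵛ a)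

  other : Vertex → Label → Vertex
  other a l with src l ≟ᵛ a
  ... | yes _ = dst l
  ... | no _  = src l

  other-ends : ∀ {a l} → incident a l ≡ true → Links l a (other a l)
  other-ends {a} {l} eq with src l ≟ᵛ a
  ... | yes p = fwd p refl
  ... | no h  = bwd refl (witness (dst l ≟ᵛ a) (trans (cong (_∨ does (dst l ≟ᵛ a)) (sym (dec-false (src l ≟ᵛ a) h))) eq))

  incident-ends : ∀ {a b l} → Links l a b → incident a l ≡ true
  incident-ends {a} {b} {l} (fwd p _) rewrite dec-true (src l ≟ᵛ a) p = refl
  incident-ends {a} {b} {l} (bwd _ q) rewrite dec-true (dst l ≟ᵛ a) q = ∨-zeroʳ _

  -- The vertices of the core are implicit, namely the ends of its edges. `base` is one vertex of
  -- large degree known in advance, near which each component of the forest can be started.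
  record Core (δ : ℕ) (ys : List Label) : Set where
    field
      core      : List Label
      core-⊆    : ∀ {l} → l ∈ core → l ∈ ys
      core-uniq : Unique core
      base      : Vertex
      base-rich : δ < count (incident base) core
      rich      : ∀ {l a b} → l ∈ core → Links l a b → δ < count (incident a) core

  -- Deleting a vertex with at most δ edges lowers `δ * length S` by at least δ and the number of
  -- edges by at most δ, so the strict inequality survives until all remaining degrees exceed δ.
  dense-core : ∀ δ k S ys → length S ≤ k → Unique S → Unique ys → (∀ {l a b} → l ∈ ys → Links l a b → a ∈ S) →
               δ * length S < length ys → Core δ ys
  dense-core δ k S ys le uS uys inside lt with search (λ a → count (incident a) ys ≤? δ) S
  ... | inj₂ all = record
    { core = ys ; core-⊆ = id ; core-uniq = uys ; base = proj₁ someone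
    ; base-rich = ≰⇒> (all (proj₂ someone)) ; rich = λ l∈ e → ≰⇒> (all (inside l∈ e)) }
    where
    nonempty : ∀ zs → δ * length S < length zs → ∃[ l ] l ∈ zs
    nonempty (l ∷ _) _ = l , here refl
    someone : ∃[ a ] a ∈ S
    someone = let (l , l∈) = nonempty ys lt in src l , inside l∈ (fwd refl refl)
  dense-core δ zero (x ∷ S) ys () uS uys inside lt | inj₁ (a , a∈ , few)
  dense-core δ (suc k) S ys le uS uys inside lt | inj₁ (a , a∈ , few) =
    let C = dense-core δ k (delete a S) rest (s≤s⁻¹ (≤-trans (delete-length uS a∈) le)) (delete-unique a uS)
              (keep-unique missing uys) inside′ lt′
    in record { Core C ; core-⊆ = λ l∈ → proj₁ (∈-keep⁻ missing (Core.core-⊆ C l∈)) }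
    where
    open Delete _≟ᵛ_
    missing : Label → Bool
    missing l = not (incident a l)
    rest = keep missing ys
    inside′ : ∀ {l b c} → l ∈ rest → Links l b c → b ∈ delete a S
    inside′ {l} l∈ e with ∈-keep⁻ missing {xs = ys} l∈
    ... | l∈ys , ok = ∈-delete⁺ (inside l∈ys e) λ where refl → true≢false ok (cong not (incident-ends e))
    lt′ : δ * length (delete a S) < length rest
    lt′ = +-cancelˡ-< δ _ _ (begin-strict
      δ + δ * length (delete a S)       ≡⟨ sym (*-suc δ _) ⟩
      δ * suc (length (delete a S))     ≤⟨ *-monoʳ-≤ δ (delete-length uS a∈) ⟩
      δ * length S                      <⟨ lt ⟩
      length ys                         ≡⟨ length-∑ ys ⟩
      ∑ ys (λ _ → 1)                    ≡⟨ ∑-split (incident a) ys (λ _ → 1) ⟩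
      ∑ (keep (incident a) ys) (λ _ → 1) + ∑ rest (λ _ → 1)
        ≡⟨ sym (cong₂ _+_ (trans (sym (length-keep (incident a) ys)) (length-∑ (keep (incident a) ys))) (length-∑ rest)) ⟩
      count (incident a) ys + length rest ≤⟨ +-monoˡ-≤ _ few ⟩
      δ + length rest ∎)
      where open ≤-Reasoning

  module _ {δ ys} (C : Core δ ys) (F : Graph) where
    open Core C

    record Partial (S : List (Fin (n F))) : Set where
      field
        φ     : Fin (n F) → Vertex
        φ-inj : ∀ {x y} → x ∈ S → y ∈ S → φ x ≡ φ y → x ≡ y
        φ-rich : ∀ {x} → x ∈ S → δ < count (incident (φ x)) core
        φ-adj : ∀ {x y} → x ∈ S → y ∈ S → adj F x y ≡ true → ∃[ l ] l ∈ core × Links l (φ x) (φ y)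
    open Partial

    fresh-neighbour : ∀ {S} (P : Partial S) → length S ≤ δ → ∀ t → δ < count (incident t) core →
                      ∃[ l ] ∃[ z ] l ∈ core × Links l t z × (∀ {y} → y ∈ S → z ≢ φ P y)
    fresh-neighbour {S} P len t t-rich with escape S (keep (incident t) core) (λ s l → does (other t l ≟ᵛ φ P s)) few
      where
      ends : ∀ {l z} → l ∈ keep (incident t) core → other t l ≡ z → Links l t z
      ends {l} l∈ eq = subst (Links l t) eq (other-ends (proj₂ (∈-keep⁻ (incident t) {xs = core} l∈)))
      few : ∑ S (λ s → count (λ l → does (other t l ≟ᵛ φ P s)) (keep (incident t) core)) < length (keep (incident t) core)
      few = ≤-<-trans (≤-trans (∑-bound S λ {s} _ → count-does≤1 (λ l → other t l ≟ᵛ φ P s) (keep-unique (incident t) core-uniq)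
                        λ l∈ l′∈ q q′ → simple (ends l∈ q) (ends l′∈ q′))
                      (≤-trans (≤-reflexive (*-identityʳ _)) len))
                      (subst (δ <_) (sym (length-keep (incident t) core)) t-rich)
    ... | l , l∈ , ok = l , other t l , proj₁ (∈-keep⁻ (incident t) l∈) , other-ends (proj₂ (∈-keep⁻ (incident t) {xs = core} l∈))
                      , λ {y} y∈ eq → true≢false (dec-true (other t l ≟ᵛ φ P y) eq) (ok y∈)

    module _ {S} (P : Partial S) {x} (x∉S : x ∉ S) {l t z} (l∈ : l ∈ core) (end : Links l t z)
             (fresh : ∀ {y} → y ∈ S → z ≢ φ P y) (anchored : ∀ {y} → y ∈ S → adj F x y ≡ true → t ≡ φ P y) where

      private
        φ′ : Fin (n F) → Vertex
        φ′ = update (φ P) x z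
        new : φ′ x ≡ z
        new = update-same (φ P) x z
        old : ∀ {y} → y ∈ S → φ′ y ≡ φ P y
        old y∈ = update-other (φ P) z λ where refl → x∉S y∈
        fresh′ : ∀ {y} → y ∈ S → φ′ x ≢ φ′ y
        fresh′ y∈ eq = fresh y∈ (trans (sym new) (trans eq (old y∈)))
        new-adj : ∀ {y} → y ∈ S → adj F x y ≡ true → ∃[ l ] l ∈ core × Links l (φ′ x) (φ′ y)
        new-adj y∈ a = l , l∈ , subst₂ (Links l) (sym new) (trans (anchored y∈ a) (sym (old y∈))) (ends-sym end)

      extend : Partial (x ∷ S)
      extend .φ = φ′
      extend .φ-inj (here refl) (here refl) _  = refl
      extend .φ-inj (here refl) (there y∈)  eq = contradiction eq (fresh′ y∈)
      extend .φ-inj (there y∈)  (here refl) eq = contradiction (sym eq) (fresh′ y∈)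
      extend .φ-inj (there y∈)  (there z∈)  eq = φ-inj P y∈ z∈ (trans (sym (old y∈)) (trans eq (old z∈)))
      extend .φ-rich (here refl) = subst (λ w → δ < count (incident w) core) (sym new) (rich l∈ (ends-sym end))
      extend .φ-rich (there y∈)  = subst (λ w → δ < count (incident w) core) (sym (old y∈)) (φ-rich P y∈)
      extend .φ-adj (here refl) (here refl) a = contradiction refl (adj-≢ F a)
      extend .φ-adj (here refl) (there y∈)  a = new-adj y∈ a
      extend .φ-adj (there y∈)  (here refl) a with new-adj y∈ (trans (adj-sym F _ _) a)
      ... | l , l∈ , e = l , l∈ , ends-sym e
      extend .φ-adj (there y∈)  (there z∈)  a with φ-adj P y∈ z∈ a
      ... | l , l∈ , e = l , l∈ , subst₂ (Links l) (sym (old y∈)) (sym (old z∈)) e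

    -- Vertices are placed in the reverse order of elimination, so a new one has at most one placed
    -- neighbour p. More than δ core edges leave the image of p, and at most δ vertices are
    -- occupied.
    embed-forest : ∀ {S} → Elimination F S → length S ≤ suc δ → Partial S
    embed-forest [] _ = record { φ = λ _ → base ; φ-inj = λ () ; φ-rich = λ () ; φ-adj = λ () }
    embed-forest {x ∷ S} (remove x∉S p top E) (s≤s len) with embed-forest E (m≤n⇒m≤1+n len)
    ... | P with Any.any? (p Fin.≟_) S
    ...   | yes p∈ = let (l , z , l∈ , end , fresh) = fresh-neighbour P len (φ P p) (φ-rich P p∈)
                     in extend P x∉S l∈ end fresh λ y∈ a → cong (φ P) (sym (top y∈ a))
    -- A new component: `base` itself may be occupied, but a fresh neighbour of it serves as well.
    ...   | no p∉  = let (l , z , l∈ , end , fresh) = fresh-neighbour P len base base-rich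
                     in extend P x∉S l∈ end fresh λ y∈ a → contradiction (subst (_∈ S) (top y∈ a) y∈) p∉

  elimination-unique : ∀ {F S} → Elimination F S → Unique S
  elimination-unique [] = []
  elimination-unique (remove x∉S _ _ E) = All.tabulate (λ y∈ x≡y → x∉S (subst (_∈ _) (sym x≡y) y∈)) ∷ elimination-unique E

  -- A third of the edges is independent for g, and these are still more than `n F` per vertex;
  -- hence the factor 3.
  dense-unavoidable : ∀ {F} → Forest F → {l₁ l₂ : Label} → l₁ ≢ l₂ → 3 * (n F * size) < length labels → Unavoidable F graph
  dense-unavoidable {F} forest l₁≢l₂ many = net-unavoidable l₁≢l₂ λ g g≢ →
    let (I , third) = functional-independent _≟ˡ_ g g≢ labels labels-uniq
        C = dense-core (n F) _ vertices (elems I) ≤-refl vertices-unique (unique I) (λ _ _ → vertex∈ _)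
              (subst (λ z → n F * z < length (elems I)) (sym vertices-length) (*-cancelˡ-< 3 _ _ (<-≤-trans many third)))
        (S , E , all) = elimination forest
        P = embed-forest C F E (m≤n⇒m≤1+n (≤-trans (length-⊆ (elimination-unique E) (λ _ → ∈-allFin _)) (≤-reflexive (length-tabulate id))))
        open Partial P
    in record
      { place = φ ; injective = φ-inj (all _) (all _)
      ; Chosen = _∈ elems I
      ; separated = λ {l} {l′} l∈ l′∈ eq → true≢false (dec-true (g l ≟ˡ l′) eq) (indep I l∈ l′∈)
      ; realised = λ a → let (l , l∈ , e) = φ-adj (all _) (all _) a in l , Core.core-⊆ C l∈ , e }
    where
    vertices = List.map dec (allFin size)
    vertices-unique : Unique vertices
    vertices-unique = Uniqueₚ.map⁺ dec-injective (Uniqueₚ.allFin⁺ size)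
    vertex∈ : ∀ a → a ∈ vertices
    vertex∈ a = subst (_∈ vertices) (dec-enc a) (∈-map⁺ dec (∈-allFin (enc a)))
    vertices-length : length vertices ≡ size
    vertices-length = trans (length-map dec (allFin size)) (length-tabulate id)

-- Dense graphs of large girth

lookup-injective : ∀ {xs : List A} → Unique xs → ∀ {i j} → List.lookup xs i ≡ List.lookup xs j → i ≡ j
lookup-injective (_ ∷ _) {fzero}  {fzero}  _  = refl
lookup-injective {xs = x ∷ xs} ux@(_ ∷ _) {fzero} {fsuc j} eq =
  contradiction (subst (_∈ xs) (sym eq) (∈-lookup j)) (Uniqueₚ.Unique[x∷xs]⇒x∉xs ux)
lookup-injective {xs = x ∷ xs} ux@(_ ∷ _) {fsuc i} {fzero} eq =
  contradiction (subst (_∈ xs) eq (∈-lookup i)) (Uniqueₚ.Unique[x∷xs]⇒x∉xs ux)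
lookup-injective (_ ∷ u) {fsuc i} {fsuc j} eq = cong fsuc (lookup-injective u eq)

length-cartesianProduct : ∀ (xs : List A) (ys : List B) → length (cartesianProduct xs ys) ≡ length xs * length ys
length-cartesianProduct []       ys = refl
length-cartesianProduct (x ∷ xs) ys = trans (length-++ (List.map (x ,_) ys)) (cong₂ _+_ (length-map _ ys) (length-cartesianProduct xs ys))

funToFin-cong : ∀ {m k} {f g : Fin m → Fin k} → f ≗ g → funToFin f ≡ funToFin g
funToFin-cong {zero}  eq = refl
funToFin-cong {suc m} eq = cong₂ combine (eq fzero) (funToFin-cong (eq ∘ fsuc))

-- On a finite set these are the permutations, so this is the symmetric group, listed among all m ^
-- m functions in order to be indexed by a `Fin`. Working with injections avoids carrying inverses.
module Injections (m : ℕ) where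

  private
    Inj : Fin (m ^ m) → Set
    Inj k = ∀ i j → finToFun {m} {m} k i ≡ finToFun k j → i ≡ j

    inj? : ∀ k → Dec (Inj k)
    inj? k = Finₚ.all? λ i → Finₚ.all? λ j → (finToFun {m} {m} k i Fin.≟ finToFun k j) →-dec (i Fin.≟ j)

    codes : List (Fin (m ^ m))
    codes = filter inj? (allFin (m ^ m))

    codes-unique : Unique codes
    codes-unique = Uniqueₚ.filter⁺ inj? (Uniqueₚ.allFin⁺ (m ^ m))

  total : ℕ
  total = length codes

  fn : Fin total → Fin m → Fin m
  fn p = finToFun (List.lookup codes p)

  fn-injective : ∀ p {i j} → fn p i ≡ fn p j → i ≡ j
  fn-injective p = proj₂ (∈-filter⁻ inj? {xs = allFin (m ^ m)} (∈-lookup {xs = codes} p)) _ _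

  fn-ext : ∀ {p q} → fn p ≗ fn q → p ≡ q
  fn-ext {p} {q} eq = lookup-injective codes-unique
    (trans (sym (Finₚ.funToFin-finToFin {m} {m} _)) (trans (funToFin-cong eq) (Finₚ.funToFin-finToFin {m} {m} _)))

  index : (h : Fin m → Fin m) → (∀ {i j} → h i ≡ h j → i ≡ j) → ∃[ p ] fn p ≗ h
  index h h-inj = Any.index h∈ , λ i → trans (cong (λ k → finToFun k i) (sym (lookup-index h∈))) (Finₚ.finToFun-funToFin h i)
    where
    h∈ : funToFin h ∈ codes
    h∈ = ∈-filter⁺ inj? (∈-allFin (funToFin h)) λ i j eq →
      h-inj (trans (sym (Finₚ.finToFun-funToFin h i)) (trans eq (Finₚ.finToFun-funToFin h j)))

-- The path 0 - 1 - … - k with its edges coloured by a word: `flip c` exchanges the two ends of every edge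
-- of colour c (of two consecutive edges of colour c only the first is used).
module _ {d : ℕ} where

  flip : ∀ {k} → Fin d → Vec (Fin d) k → Fin (suc k) → Fin (suc k)
  flip c []          i = i
  flip c (a ∷ w)     i with a Fin.≟ c
  flip c (a ∷ w)     fzero           | yes _ = fsuc fzero
  flip c (a ∷ w)     (fsuc fzero)    | yes _ = fzero
  flip c (a ∷ b ∷ w) (fsuc (fsuc i)) | yes _ = fsuc (fsuc (flip c w i))
  flip c (a ∷ w)     fzero           | no _  = fzero
  flip c (a ∷ w)     (fsuc i)        | no _  = fsuc (flip c w i)

  flip-involutive : ∀ {k} c (w : Vec (Fin d) k) i → flip c w (flip c w i) ≡ i
  flip-involutive c []          i = refl
  flip-involutive c (a ∷ w)     i with a Fin.≟ c
  flip-involutive c (a ∷ w)     fzero           | yes p = refl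
  flip-involutive c (a ∷ w)     (fsuc fzero)    | yes p = refl
  flip-involutive c (a ∷ b ∷ w) (fsuc (fsuc i)) | yes p = cong (fsuc ∘ fsuc) (flip-involutive c w i)
  flip-involutive c (a ∷ w)     fzero           | no _ = refl
  flip-involutive c (a ∷ w)     (fsuc i)        | no _ = cong fsuc (flip-involutive c w i)

  -- In a run of edges of colour c every other edge is used, beginning with the first. If the
  -- preceding edge has another colour, edge i begins a run and is used.
  flip-down : ∀ {k} c (w : Vec (Fin d) k) i → Vec.lookup w i ≡ c →
              (∀ j → toℕ i ≡ suc (toℕ j) → Vec.lookup w j ≢ c) → flip c w (fsuc i) ≡ inject₁ i
  flip-down c (a ∷ w) i eq before with a Fin.≟ c
  flip-down c (a ∷ w) fzero eq before | yes _ = refl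
  flip-down c (a ∷ w) (fsuc fzero) eq before | yes p = contradiction p (before fzero refl)
  flip-down c (a ∷ b ∷ w) (fsuc (fsuc i)) eq before | yes p =
    cong (fsuc ∘ fsuc) (flip-down c w i eq (λ j e → before (fsuc (fsuc j)) (cong (suc ∘ suc) e)))
  flip-down c (a ∷ w) fzero eq before | no q = contradiction eq q
  flip-down c (a ∷ w) (fsuc i) eq before | no q = cong fsuc (flip-down c w i eq (λ j e → before (fsuc j) (cong suc e)))

-- A bipartite Cayley graph.  Let X be the disjoint union of all paths of length K coloured with d colours, on
-- which every colour acts by flipping.  Both sides of the bipartition consist of the injections of X into
-- itself, and p on the left is joined to p ∘ σ c on the right.
module Girth (d K₀ : ℕ) where

  K = suc K₀
  X-size = d ^ K * suc K

  open Injections X-size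

  word : Fin (d ^ K) → Vec (Fin d) K
  word w = Vec.tabulate (finToFun w)

  σ : Fin d → Fin X-size → Fin X-size
  σ c x = let (w , i) = remQuot (suc K) x in combine w (flip c (word w) i)

  σ-combine : ∀ c w i → σ c (combine w i) ≡ combine w (flip c (word w) i)
  σ-combine c w i = cong (λ (w , i) → combine w (flip c (word w) i)) (Finₚ.remQuot-combine w i)

  σ-involutive : ∀ c x → σ c (σ c x) ≡ x
  σ-involutive c x = let (w , i) = remQuot (suc K) x in
    trans (σ-combine c w _) (trans (cong (combine w) (flip-involutive c (word w) i)) (Finₚ.combine-remQuot {d ^ K} (suc K) x))

  σ-injective : ∀ c {x y} → σ c x ≡ σ c y → x ≡ y
  σ-injective c {x} {y} eq = trans (sym (σ-involutive c x)) (trans (cong (σ c) eq) (σ-involutive c y))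

  codeWord : (Fin K → Fin d) → Fin (d ^ K)
  codeWord = funToFin

  lookup-codeWord : ∀ h i → Vec.lookup (word (codeWord h)) i ≡ h i
  lookup-codeWord h i = trans (lookup∘tabulate (finToFun (codeWord h)) i) (Finₚ.finToFun-funToFin h i)

  σ-down : ∀ c (h : Fin K → Fin d) i → h i ≡ c → (∀ j → toℕ i ≡ suc (toℕ j) → h j ≢ c) →
           σ c (combine (codeWord h) (fsuc i)) ≡ combine (codeWord h) (inject₁ i)
  σ-down c h i eq before = trans (σ-combine c (codeWord h) _) (cong (combine (codeWord h))
    (flip-down c (word (codeWord h)) i (trans (lookup-codeWord h i) eq) λ j e q → before j e (trans (sym (lookup-codeWord h j)) q)))

  -- On the path all of whose edges have colour c, the colour c moves vertex 1 to vertex 0 and every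
  -- other colour leaves it in place. This needs a path with an edge, hence `K = suc K₀`.
  σ-faithful : ∀ {c c′} → σ c ≗ σ c′ → c ≡ c′
  σ-faithful {c} {c′} same with c Fin.≟ c′
  ... | yes eq = eq
  ... | no c≢  = contradiction (Finₚ.combine-injectiveʳ W fzero W _ (trans (sym (σ-down c (λ _ → c) fzero refl (λ _ ()))) (trans (same _) (σ-combine c′ W _)))) stay
    where
    W = codeWord (λ _ → c)
    stay : fzero ≢ flip c′ (word W) (fsuc fzero)
    stay with finToFun {d} {K} W fzero Fin.≟ c′
    ... | yes eq = contradiction (trans (sym (Finₚ.finToFun-funToFin (λ (_ : Fin K) → c) fzero)) eq) c≢
    ... | no _   = λ ()

  act : Fin total → Fin d → Fin total
  act p c = proj₁ (index (fn p ∘ σ c) (λ eq → σ-injective c (fn-injective p eq)))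

  fn-act : ∀ p c → fn (act p c) ≗ fn p ∘ σ c
  fn-act p c = proj₂ (index (fn p ∘ σ c) (λ eq → σ-injective c (fn-injective p eq)))

  identity : Fin total
  identity = proj₁ (index id id)

  act-injective : ∀ {p c c′} → act p c ≡ act p c′ → c ≡ c′
  act-injective {p} {c} {c′} eq = σ-faithful λ x →
    fn-injective p (trans (sym (fn-act p c x)) (trans (cong (λ q → fn q x) eq) (fn-act p c′ x)))

  -- Two sides give each edge a unique left end and thereby a unique label. On a single set of
  -- permutations the involution σ c would make `(p , c)` and `(act p c , c)` name the same edge.
  source target : Fin total × Fin d → Fin 2 × Fin total
  source (p , c) = fzero , p
  target (p , c) = fsuc fzero , act p c

  net : Net
  net = record
    { size = 2 * total
    ; Vertex = Fin 2 × Fin total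
    ; enc = λ (b , p) → combine b p
    ; dec = remQuot {2} total
    ; dec-enc = λ (b , p) → Finₚ.remQuot-combine b p
    ; enc-dec = Finₚ.combine-remQuot {2} total
    ; Label = Fin total × Fin d
    ; _≟ˡ_ = Productₚ.≡-dec Fin._≟_ Fin._≟_
    ; labels = cartesianProduct (allFin total) (allFin d)
    ; complete = λ (p , c) → ∈-cartesianProduct⁺ (∈-allFin p) (∈-allFin c)
    ; labels-uniq = Uniqueₚ.cartesianProduct⁺ (Uniqueₚ.allFin⁺ total) (Uniqueₚ.allFin⁺ d)
    ; src = source
    ; dst = target
    ; loopless = λ _ ()
    ; simple = simple
    }
    where
    same : ∀ {p p′ c c′} → (Fin.Fin.zero {1} , p) ≡ (fzero , p′) → (Fin.Fin.suc {1} fzero , act p c) ≡ (fsuc fzero , act p′ c′) → (p , c) ≡ (p′ , c′)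
    same {p} refl eq = cong (p ,_) (act-injective (cong proj₂ eq))
    simple : ∀ {l l′ a b} → Ends source target l a b → Ends source target l′ a b → l ≡ l′
    simple (fwd p q) (fwd p′ q′) = same (trans p (sym p′)) (trans q (sym q′))
    simple (bwd p q) (bwd p′ q′) = same (trans p (sym p′)) (trans q (sym q′))
    simple (fwd refl _) (bwd _ ())
    simple (bwd _ refl) (fwd () _)

  open NetGraph net

  Step : Fin 2 × Fin total → Fin d → Fin 2 × Fin total → Set
  Step (a , p) c (b , q) = a ≢ b × fn q ≗ fn p ∘ σ c

  link-step : ∀ {l a b} → Links l a b → ∃[ c ] Step a c b
  link-step {p , c} (fwd refl refl) = c , (λ ()) , fn-act p c
  link-step {p , c} (bwd refl refl) = c , (λ ()) , λ x → sym (trans (fn-act p c (σ c x)) (cong (fn p) (σ-involutive c x)))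

  -- Since σ c is an involution, using a colour twice in a row means turning back. Consecutive
  -- colours along a cycle therefore differ, which is what `σ-down` requires.
  step-back : ∀ {a b a′ c} → Step a c b → Step b c a′ → a ≡ a′
  step-back {a , p} {b , q} {a′ , p′} {c} (a≢b , e) (b≢a′ , e′) =
    cong₂ _,_ (opposite a b a′ a≢b b≢a′) (fn-ext λ x → sym (trans (e′ x) (trans (e (σ c x)) (cong (fn p) (σ-involutive c x)))))
    where
    opposite : ∀ (a b a′ : Fin 2) → a ≢ b → b ≢ a′ → a ≡ a′
    opposite fzero        _            fzero        _ _ = refl
    opposite (fsuc fzero) _            (fsuc fzero) _ _ = refl
    opposite fzero        fzero        (fsuc fzero) h _ = contradiction refl h
    opposite fzero        (fsuc fzero) (fsuc fzero) _ h = contradiction refl h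
    opposite (fsuc fzero) fzero        fzero        _ h = contradiction refl h
    opposite (fsuc fzero) (fsuc fzero) fzero        h _ = contradiction refl h

  -- Along a closed walk with colours w₀ w₁ … the value at the i-th point of the path coloured w is constant.
  no-short-cycle : ∀ L → 1 ≤ L → L ≤ K → (x : ℕ → Fin 2 × Fin total) → x L ≡ x 0 →
    (∀ i → i < L → ∃[ c ] Step (x i) c (x (suc i))) → (∀ i → suc (suc i) ≤ L → x i ≢ x (suc (suc i))) → ⊥
  no-short-cycle (suc L₀) _ L≤K x closed steps turns =
    -- If the walk closes up, the injection at `x 0` takes the same value at positions L and 0 of
    -- the path.
    contradiction (cong toℕ (Finₚ.combine-injectiveʳ W (pos L (s≤s L≤K)) W fzero (fn-injective (proj₂ (x 0)) end)))
                  λ eq → contradiction (trans (sym (Finₚ.toℕ-fromℕ< (s≤s L≤K))) eq) λ ()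
    where
    L = suc L₀
    col : ℕ → Fin d
    col i with i <? L
    ... | yes i<L = proj₁ (steps i i<L)
    -- A word has K letters, possibly more than L. The first colour pads it, and the walk stops
    -- before reading the padding.
    ... | no _    = proj₁ (steps 0 (s≤s z≤n))
    step : ∀ i → i < L → Step (x i) (col i) (x (suc i))
    step i i<L with i <? L
    ... | yes p = proj₂ (steps i p)
    ... | no h  = contradiction i<L h
    reduced : ∀ i → suc i < L → col i ≢ col (suc i)
    reduced i lt eq = turns i lt (step-back (step i (<-trans (n<1+n i) lt)) (subst (λ c → Step (x (suc i)) c (x (suc (suc i)))) (sym eq) (step (suc i) lt)))
    W = codeWord (col ∘ toℕ)
    pos : ∀ i → i < suc K → Fin (suc K)
    pos i lt = fromℕ< lt
    value : ∀ i (le : i ≤ L) (lt : i < suc K) → fn (proj₂ (x i)) (combine W (pos i lt)) ≡ fn (proj₂ (x 0)) (combine W fzero)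
    value zero le (s≤s _) = refl
    value (suc i) i<L (s≤s i<K) = trans (proj₂ (step i i<L) _) (trans (cong (fn (proj₂ (x i))) moved) (value i (<⇒≤ i<L) (m≤n⇒m≤1+n i<K)))
      where
      toℕ-i : toℕ (fromℕ< i<K) ≡ i
      toℕ-i = Finₚ.toℕ-fromℕ< i<K
      moved : σ (col i) (combine W (fsuc (fromℕ< i<K))) ≡ combine W (pos i (m≤n⇒m≤1+n i<K))
      moved = trans (σ-down (col i) (col ∘ toℕ) (fromℕ< i<K) (cong col toℕ-i)
          (λ j e q → reduced (toℕ j) (subst (_< L) (trans (sym toℕ-i) e) i<L) (trans q (cong col (trans (sym toℕ-i) e)))))
        (cong (combine W) (Finₚ.toℕ-injective (trans (Finₚ.toℕ-inject₁ _) (trans toℕ-i (sym (Finₚ.toℕ-fromℕ< _))))))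
    end : fn (proj₂ (x 0)) (combine W (pos L (s≤s L≤K))) ≡ fn (proj₂ (x 0)) (combine W fzero)
    end = trans (cong (λ a → fn (proj₂ a) (combine W (pos L (s≤s L≤K)))) (sym closed)) (value L ≤-refl (s≤s L≤K))

  small-forest : ∀ {G′} → Copy G′ graph → n G′ ≤ K → Forest G′
  small-forest {G′} κ small k c c-inj consecutive closing =
    no-short-cycle L (s≤s z≤n) (≤-trans (Finₚ.injective⇒≤ {f = c} c-inj) small) x closed steps turns
    where
    open Sub κ
    L = 3 + k
    y : ℕ → Fin (n G′)
    y i with i <? L
    ... | yes i<L = c (fromℕ< i<L)
    ... | no _    = c fzero
    x = vertex ∘ y
    y-in : ∀ (j : Fin L) i → toℕ j ≡ i → y i ≡ c j
    y-in j i eq with i <? L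
    ... | yes i<L = cong c (Finₚ.toℕ-injective (trans (Finₚ.toℕ-fromℕ< i<L) (sym eq)))
    ... | no h    = contradiction (subst (_< L) eq (Finₚ.toℕ<n j)) h
    y-end : y L ≡ c fzero
    y-end with L <? L
    ... | yes L<L = contradiction L<L (<-irrefl refl)
    ... | no _    = refl
    closed : x L ≡ x 0
    closed = cong vertex (trans y-end (sym (y-in fzero 0 refl)))
    adjacent : ∀ i → i < L → adj G′ (y i) (y (suc i)) ≡ true
    adjacent i (s≤s i≤) with m≤n⇒m<n∨m≡n i≤
    ... | inj₁ i< = trans (cong₂ (adj G′) (y-in (inject₁ j) i (trans (Finₚ.toℕ-inject₁ j) j≡)) (y-in (fsuc j) (suc i) (cong suc j≡))) (consecutive j)
      where
      j = fromℕ< i<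
      j≡ : toℕ j ≡ i
      j≡ = Finₚ.toℕ-fromℕ< i<
    ... | inj₂ refl = trans (cong₂ (adj G′) (y-in (last (2 + k)) i (Finₚ.toℕ-fromℕ _)) y-end) closing
    steps : ∀ i → i < L → ∃[ s ] Step (x i) s (x (suc i))
    steps i i<L = link-step (subname-ends (link-joins G′ (y i) (y (suc i)) (adjacent i i<L)))
    turns : ∀ i → suc (suc i) ≤ L → x i ≢ x (suc (suc i))
    turns i le eq with m≤n⇒m<n∨m≡n le
    ... | inj₁ lt = contradiction (trans (sym (Finₚ.toℕ-fromℕ< i<L)) (trans (cong toℕ (c-inj (trans (sym (y-in _ i (Finₚ.toℕ-fromℕ< i<L)))
                      (trans (vertex-injective eq) (y-in _ (2 + i) (Finₚ.toℕ-fromℕ< lt)))))) (Finₚ.toℕ-fromℕ< lt))) (m≢1+n+m i {1})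
      where
      i<L : i < L
      i<L = <-trans (n<1+n i) (<-trans (n<1+n (suc i)) lt)
    -- Here i + 2 = L, where the walk is back at the first vertex, while i = L - 2 is at least 1.
    ... | inj₂ refl = contradiction (trans (sym (Finₚ.toℕ-fromℕ< i<L)) (cong toℕ (c-inj (trans (sym (y-in _ i (Finₚ.toℕ-fromℕ< i<L)))
                      (trans (vertex-injective eq) y-end))))) λ ()
      where
      i<L : i < L
      i<L = <-trans (n<1+n i) (n<1+n (suc i))

  -- There are d edges per left vertex and two vertices per permutation, so 3 `n F` edges per vertex
  -- become 6 `n F` colours.
  girth-unavoidable : ∀ {F} → Forest F → {c₁ c₂ : Fin d} → c₁ ≢ c₂ → 6 * n F < d → Unavoidable F graph
  girth-unavoidable {F} forest c₁≢c₂ big = dense-unavoidable forest {identity , _} {identity , _} (λ eq → c₁≢c₂ (cong proj₂ eq)) (begin-strict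
    3 * (n F * (2 * total))   ≡⟨ regroup (n F) total ⟩
    total * (6 * n F)         <⟨ *-monoʳ-< total ⦃ Finₚ.nonZeroIndex identity ⦄ big ⟩
    total * d                 ≡⟨ sym (cong₂ _*_ (length-tabulate {n = total} id) (length-tabulate {n = d} id)) ⟩
    length (allFin total) * length (allFin d) ≡⟨ sym (length-cartesianProduct (allFin total) (allFin d)) ⟩
    length (cartesianProduct (allFin total) (allFin d)) ∎)
    where
    open ≤-Reasoning
    regroup : ∀ a b → 3 * (a * (2 * b)) ≡ b * (6 * a)
    regroup = solve-∀

walk-infinite : ∀ {F} → Forest F → Walk₃ F → ¬ MFinite F
walk-infinite {F} forest w = infinite-criterion F λ N →
  -- Two colours beyond 6 `n F` put d above the threshold and exhibit two distinct colours.
  let open Girth (suc (suc (6 * n F))) N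
  in NetGraph.graph net
   , girth-unavoidable forest {fzero} {fsuc fzero} (λ ()) (n≤1+n _)
   , λ G′ κ small → forest-avoidable w (small-forest κ (m≤n⇒m≤1+n small))

-- Caterpillars

module _ {q : ℕ} where

  prev : Fin (suc q) → Fin (suc q)
  prev fzero    = fromℕ q
  prev (fsuc i) = inject₁ i

  next : Fin (suc q) → Fin (suc q)
  next i with view i
  ... | ‵fromℕ     = fzero
  ... | ‵inject₁ j = fsuc j

  prev-next : ∀ i → prev (next i) ≡ i
  prev-next i with view i
  ... | ‵fromℕ     = refl
  ... | ‵inject₁ j = refl

  prev-injective : ∀ {i j} → prev i ≡ prev j → i ≡ j
  prev-injective {fzero}  {fzero}  _  = refl
  prev-injective {fzero}  {fsuc j} eq = contradiction eq Finₚ.fromℕ≢inject₁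
  prev-injective {fsuc i} {fzero}  eq = contradiction (sym eq) Finₚ.fromℕ≢inject₁
  prev-injective {fsuc i} {fsuc j} eq = cong fsuc (Finₚ.inject₁-injective eq)

  next-unique : ∀ {i j} → prev j ≡ i → next i ≡ j
  next-unique eq = prev-injective (trans (prev-next _) (sym eq))

inject₁≢suc : ∀ {q} (i : Fin q) → inject₁ i ≢ fsuc i
inject₁≢suc i eq = 1+n≢n (sym (trans (sym (Finₚ.toℕ-inject₁ i)) (cong toℕ eq)))

prev≢ : ∀ {q} (i : Fin (2 + q)) → prev i ≢ i
prev≢ fzero    ()
prev≢ (fsuc i) eq = inject₁≢suc i eq

-- Rules out parallel cycle edges; this is where the cycle must have at least three vertices.
prev-prev≢ : ∀ {q} (i : Fin (3 + q)) → prev (prev i) ≢ i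
prev-prev≢ fzero           ()
prev-prev≢ (fsuc fzero)    ()
prev-prev≢ (fsuc (fsuc i)) eq = m≢1+n+m (toℕ i) {1} (trans (sym (trans (Finₚ.toℕ-inject₁ _) (Finₚ.toℕ-inject₁ i))) (cong toℕ eq))

next≢ : ∀ {q} (i : Fin (2 + q)) → next i ≢ i
next≢ i eq = prev≢ i (trans (cong prev (sym eq)) (prev-next i))

-- M copies of a cycle v₀ v₁ … with 3(k − 1) leaves at every vertex, k = suc k₀, and one further leaf at v₀.
-- Vertices and edges are indexed by the same set:  (c , nothing) is the further leaf and its edge,
-- (c , just (i , 0)) is the cycle vertex vᵢ and the edge from vᵢ to its predecessor on the cycle, and
-- (c , just (i , suc t)) is a leaf at vᵢ and its edge.
module Caterpillar (M m₀ k₀ : ℕ) where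

  m = 3 + m₀
  r = k₀ * 3
  k = suc k₀
  Slot = Maybe (Fin m × Fin (suc r))
  Cell = Fin M × Slot

  hub : Fin M → Fin m → Cell
  hub c i = c , just (i , fzero)

  hub-injective : ∀ {c c′ i i′} → hub c i ≡ hub c′ i′ → c ≡ c′ × i ≡ i′
  hub-injective refl = refl , refl

  source target : Cell → Cell
  source (c , nothing)       = hub c fzero
  source (c , just (i , j))  = hub c i
  target (c , nothing)             = c , nothing
  target (c , just (i , fzero))    = hub c (prev i)
  target (c , just (i , fsuc t))   = c , just (i , fsuc t)

  slots : List Slot
  slots = nothing ∷ List.map just (cartesianProduct (allFin m) (allFin (suc r)))

  slots-unique : Unique slots
  slots-unique = All.tabulate (λ s∈ eq → case ∈-map⁻ just s∈ of λ where (_ , _ , refl) → case eq of λ ())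
               ∷ Uniqueₚ.map⁺ Maybeₚ.just-injective (Uniqueₚ.cartesianProduct⁺ (Uniqueₚ.allFin⁺ m) (Uniqueₚ.allFin⁺ (suc r)))

  slot∈ : ∀ s → s ∈ slots
  slot∈ nothing        = here refl
  slot∈ (just (i , j)) = there (∈-map⁺ just (∈-cartesianProduct⁺ (∈-allFin i) (∈-allFin j)))

  slots-length : length slots ≡ suc (m * suc r)
  slots-length = cong suc (trans (length-map just (cartesianProduct (allFin m) (allFin (suc r))))
    (trans (length-cartesianProduct (allFin m) (allFin (suc r)))
           (cong₂ _*_ (length-tabulate {n = m} id) (length-tabulate {n = suc r} id))))

  private
    encode : Slot → Fin (suc (m * suc r))
    encode nothing        = fzero
    encode (just (i , j)) = fsuc (combine i j)

    decode : Fin (suc (m * suc r)) → Slot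
    decode fzero    = nothing
    decode (fsuc x) = just (remQuot {m} (suc r) x)

    decode-encode : ∀ s → decode (encode s) ≡ s
    decode-encode nothing        = refl
    decode-encode (just (i , j)) = cong just (Finₚ.remQuot-combine i j)

    encode-decode : ∀ x → encode (decode x) ≡ x
    encode-decode fzero    = refl
    encode-decode (fsuc x) = cong fsuc (Finₚ.combine-remQuot {m} (suc r) x)

    parallel : ∀ l l′ → source l ≡ source l′ → target l ≡ target l′ → l ≡ l′
    parallel (c , nothing)           (c′ , nothing)           _    eq   = eq
    parallel (c , nothing)           (c′ , just (i , fzero))  _    ()
    parallel (c , nothing)           (c′ , just (i , fsuc t)) _    ()
    parallel (c , just (i , fzero))  (c′ , nothing)           _    ()
    parallel (c , just (i , fsuc t)) (c′ , nothing)           _    ()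
    parallel (c , just (i , fzero))  (c′ , just (i′ , fzero)) eq   _    = eq
    parallel (c , just (i , fzero))  (c′ , just (_ , fsuc t)) _    ()
    parallel (c , just (_ , fsuc t)) (c′ , just (i , fzero))  _    ()
    parallel (c , just (_ , fsuc t)) (c′ , just (_ , fsuc _)) _    eq   = eq

    antiparallel : ∀ l l′ → source l ≡ target l′ → target l ≡ source l′ → ⊥
    antiparallel (c , nothing)           (c′ , nothing)           ()
    antiparallel (c , nothing)           (c′ , just (i , fzero))  _ ()
    antiparallel (c , nothing)           (c′ , just (i , fsuc t)) ()
    antiparallel (c , just (i , fzero))  (c′ , nothing)           ()
    antiparallel (c , just (i , fzero))  (c′ , just (i′ , fzero)) p q =
      prev-prev≢ i′ (trans (cong prev (sym (proj₂ (hub-injective p)))) (proj₂ (hub-injective q)))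
    antiparallel (c , just (i , fzero))  (c′ , just (_ , fsuc t)) ()
    antiparallel (c , just (i , fsuc t)) (c′ , nothing)           ()
    antiparallel (c , just (i , fsuc t)) (c′ , just (_ , fzero))  _ ()
    antiparallel (c , just (i , fsuc t)) (c′ , just (_ , fsuc _)) ()

  net : Net
  net = record
    { size = M * suc (m * suc r)
    ; Vertex = Cell
    ; enc = λ (c , s) → combine c (encode s)
    ; dec = λ x → let (c , y) = remQuot (suc (m * suc r)) x in c , decode y
    ; dec-enc = λ (c , s) → trans (cong (λ (c , y) → c , decode y) (Finₚ.remQuot-combine c (encode s))) (cong (c ,_) (decode-encode s))
    ; enc-dec = λ x → let (c , y) = remQuot {M} (suc (m * suc r)) x in
        trans (cong (combine c) (encode-decode y)) (Finₚ.combine-remQuot {M} (suc (m * suc r)) x)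
    ; Label = Cell
    ; _≟ˡ_ = Productₚ.≡-dec Fin._≟_ (Maybeₚ.≡-dec (Productₚ.≡-dec Fin._≟_ Fin._≟_))
    ; labels = cartesianProduct (allFin M) slots
    ; complete = λ (c , s) → ∈-cartesianProduct⁺ (∈-allFin c) (slot∈ s)
    ; labels-uniq = Uniqueₚ.cartesianProduct⁺ (Uniqueₚ.allFin⁺ M) slots-unique
    ; src = source
    ; dst = target
    ; loopless = loopless
    ; simple = simple
    }
    where
    loopless : ∀ l → source l ≢ target l
    loopless (c , nothing)          ()
    loopless (c , just (i , fzero)) eq = prev≢ i (sym (proj₂ (hub-injective eq)))
    loopless (c , just (i , fsuc t)) ()
    simple : ∀ {l l′ a b} → Ends source target l a b → Ends source target l′ a b → l ≡ l′
    simple {l} {l′} (fwd p q) (fwd p′ q′) = parallel l l′ (trans p (sym p′)) (trans q (sym q′))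
    simple {l} {l′} (bwd p q) (bwd p′ q′) = parallel l l′ (trans p (sym p′)) (trans q (sym q′))
    simple {l} {l′} (fwd p q) (bwd p′ q′) = ⊥-elim (antiparallel l l′ (trans p (sym q′)) (trans q (sym p′)))
    simple {l} {l′} (bwd p q) (fwd p′ q′) = ⊥-elim (antiparallel l l′ (trans p (sym q′)) (trans q (sym p′)))

  open NetGraph net public
  open Net net using (_≟ˡ_; simple)

  links-copy : ∀ {l a b} → Links l a b → proj₁ a ≡ proj₁ l × proj₁ b ≡ proj₁ l
  links-copy {c , nothing}          (fwd refl refl) = refl , refl
  links-copy {c , nothing}          (bwd refl refl) = refl , refl
  links-copy {c , just (_ , fzero)} (fwd refl refl) = refl , refl
  links-copy {c , just (_ , fzero)} (bwd refl refl) = refl , refl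
  links-copy {c , just (_ , fsuc _)} (fwd refl refl) = refl , refl
  links-copy {c , just (_ , fsuc _)} (bwd refl refl) = refl , refl

  -- All edges at vᵢ except the further leaf. The cycle edge towards the successor carries the
  -- successor's label, while the one towards the predecessor is listed with j = 0; together with
  -- the leaves these are 3k - 1.
  ordinary : Fin m → List Slot
  ordinary i = just (next i , fzero) ∷ List.map (λ j → just (i , j)) (allFin (suc r))

  star : Fin m → List Slot
  star fzero    = nothing ∷ ordinary fzero
  star (fsuc i) = ordinary (fsuc i)

  ordinary-unique : ∀ i → Unique (ordinary i)
  ordinary-unique i = All.tabulate (λ s∈ eq → case ∈-map⁻ (λ j → just (i , j)) s∈ of λ where
                        (_ , _ , refl) → next≢ i (cong proj₁ (Maybeₚ.just-injective eq)))
                    ∷ Uniqueₚ.map⁺ (λ eq → cong proj₂ (Maybeₚ.just-injective eq)) (Uniqueₚ.allFin⁺ (suc r))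

  star-unique : ∀ i → Unique (star i)
  star-unique fzero    = All.tabulate no-just ∷ ordinary-unique fzero
    where
    no-just : ∀ {s} → s ∈ ordinary fzero → nothing ≢ s
    no-just (here refl) ()
    no-just (there s∈) eq = case ∈-map⁻ (λ j → just (fzero , j)) s∈ of λ where (_ , _ , refl) → case eq of λ ()
  star-unique (fsuc i) = ordinary-unique (fsuc i)

  ordinary-length : ∀ i → length (ordinary i) ≡ 2 + r
  ordinary-length i = cong suc (trans (length-map _ (allFin (suc r))) (length-tabulate {n = suc r} id))

  star-length : ∀ i → length (star i) ≤ 3 + r
  star-length fzero    = ≤-reflexive (cong suc (ordinary-length fzero))
  star-length (fsuc i) = ≤-trans (≤-reflexive (ordinary-length (fsuc i))) (n≤1+n _)

  star-links : ∀ c i {s} → s ∈ star i → ∃[ b ] Links (c , s) (hub c i) b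
  star-links c i s∈ = go i s∈
    where
    go′ : ∀ i {s} → s ∈ ordinary i → ∃[ b ] Links (c , s) (hub c i) b
    go′ i (here refl) = _ , bwd refl (cong (hub c) (prev-next i))
    go′ i (there s∈) with ∈-map⁻ (λ j → just (i , j)) s∈
    ... | j , _ , refl = _ , fwd refl refl
    go : ∀ i {s} → s ∈ star i → ∃[ b ] Links (c , s) (hub c i) b
    go fzero    (here refl) = _ , fwd refl refl
    go fzero    (there s∈)  = go′ fzero s∈
    go (fsuc i) s∈          = go′ (fsuc i) s∈

  two-ends : ∀ {l a b} → incident a l ≡ true → incident b l ≡ true → a ≢ b → Links l a b
  two-ends {l} {a} {b} p q a≢b with other-ends {a} {l} p | other-ends {b} {l} q
  ... | fwd refl _ | fwd refl _ = contradiction refl a≢b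
  ... | bwd _ refl | bwd _ refl = contradiction refl a≢b
  ... | fwd refl _ | bwd _ refl = fwd refl refl
  ... | bwd _ refl | fwd refl _ = bwd refl refl

  -- `rays-many` provides the s = k + 1 edges of a largest star of F; `rays-few` limits how many
  -- other copies the star can be sent into.
  record FreeStar (g : Cell → Cell) (c : Fin M) : Set where
    field
      centre : Fin m
      rays   : List Cell
      rays-unique : Unique rays
      rays-many   : k < length rays
      rays-few    : length rays ≤ 3 + r
      rays-links  : ∀ {l} → l ∈ rays → incident (hub c centre) l ≡ true
      rays-free   : ∀ {l l′} → l ∈ rays → l′ ∈ rays → g l ≢ l′

  module _ (g : Cell → Cell) (g≢ : ∀ l → g l ≢ l) (c : Fin M) where

    private
      Star : Fin m → List Cell
      Star i = List.map (c ,_) (star i)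

      Star-unique : ∀ i → Unique (Star i)
      Star-unique i = Uniqueₚ.map⁺ (cong proj₂) (star-unique i)

      Star-length : ∀ i → length (Star i) ≡ length (star i)
      Star-length i = length-map (c ,_) (star i)

      Star-incident : ∀ i {l} → l ∈ Star i → incident (hub c i) l ≡ true
      Star-incident i l∈ with ∈-map⁻ (c ,_) l∈
      ... | s , s∈ , refl = incident-ends (proj₂ (star-links c i s∈))

      arcs : Fin m → ℕ
      arcs i = ∑ (Star i) (λ l → count (maps-to _≟ˡ_ g l) (Star i))

      inside : Fin m → Cell → Bool
      inside i l = incident (hub c i) l ∧ incident (hub c i) (g l)

      all : List Cell
      all = List.map (c ,_) slots

      arc-inside : ∀ i {l} → l ∈ Star i → count (maps-to _≟ˡ_ g l) (Star i) ≤ ⟦ inside i l ⟧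
      arc-inside i {l} l∈ with incident (hub c i) (g l) in eq
      ... | true rewrite Star-incident i l∈ = count-does≤1 (g l ≟ˡ_) (Star-unique i) λ _ _ p q → trans (sym p) q
      ... | false rewrite count-none (maps-to _≟ˡ_ g l) {Star i} (λ {x} x∈ → dec-false (g l ≟ˡ x)
                            λ gl≡x → true≢false (trans (cong (incident (hub c i)) gl≡x) (Star-incident i x∈)) eq) = z≤n

      -- Two edges share at most one vertex, so each arc of g is counted at most once.
      arcs-total : ∑ (allFin m) arcs ≤ suc (m * suc r)
      arcs-total = begin
        ∑ (allFin m) arcs                                     ≤⟨ ∑-mono (allFin m) (λ {i} _ → ≤-trans (∑-mono (Star i) (arc-inside i))
                                                                   (∑-⊆ _ (Star-unique i) (λ l∈ → case ∈-map⁻ (c ,_) l∈ of λ where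
                                                                      (s , _ , refl) → ∈-map⁺ (c ,_) (slot∈ s)))) ⟩
        ∑ (allFin m) (λ i → ∑ all (λ l → ⟦ inside i l ⟧))     ≡⟨ ∑-swap (allFin m) all (λ i l → ⟦ inside i l ⟧) ⟩
        ∑ all (λ l → count (λ i → inside i l) (allFin m))     ≤⟨ ∑-bound all (λ {l} _ → count≤1 (λ i → inside i l) (Uniqueₚ.allFin⁺ m) (λ {i} {j} _ _ → once l i j)) ⟩
        length all * 1                                        ≡⟨ trans (*-identityʳ _) (trans (length-map (c ,_) slots) slots-length) ⟩
        suc (m * suc r) ∎
        where
        open ≤-Reasoning
        once : ∀ l i j → inside i l ≡ true → inside j l ≡ true → i ≡ j
        once l i j p q with i Fin.≟ j
        ... | yes eq = eq
        ... | no i≢j = let (p₁ , p₂) = ∧-true (incident (hub c i) l) p ; (q₁ , q₂) = ∧-true (incident (hub c j) l) q in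
          contradiction (simple (two-ends p₂ q₂ (i≢j ∘ proj₂ ∘ hub-injective)) (two-ends p₁ q₁ (i≢j ∘ proj₂ ∘ hub-injective))) (g≢ l)

      lengths-total : ∑ (allFin m) (λ i → length (Star i)) ≡ suc (m * (2 + r))
      lengths-total = trans (∑-cong (allFin m) Star-length) (cong suc
        (cong₂ _+_ (ordinary-length fzero) (trans (tail (2 + m₀) fsuc (ordinary-length ∘ fsuc)) refl)))
        where
        tail : ∀ q (h : Fin q → Fin m) → (∀ i → length (star (h i)) ≡ 2 + r) →
               ∑ (List.tabulate h) (λ i → length (star i)) ≡ q * (2 + r)
        tail zero    h eq = refl
        tail (suc q) h eq = cong₂ _+_ (eq fzero) (tail q (h ∘ fsuc) (eq ∘ fsuc))

      -- With at most k independent edges at every cycle vertex, Turán's bound for q = 2 would bound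
      -- each term on the right by the one on the left. The degrees sum to m(3k - 1) + 1 and the
      -- arcs to at most m(3k - 2) + 1, and this misses by exactly 2.
      surplus : ∑ (allFin m) (λ i → 6 * k + 2 * arcs i) < ∑ (allFin m) (λ i → 4 * length (Star i))
      surplus = begin-strict
        ∑ (allFin m) (λ i → 6 * k + 2 * arcs i)          ≡⟨ ∑-+ (allFin m) (λ _ → 6 * k) (λ i → 2 * arcs i) ⟩
        ∑ (allFin m) (λ _ → 6 * k) + ∑ (allFin m) (λ i → 2 * arcs i)
          ≡⟨ cong₂ _+_ (trans (∑-const (allFin m) (6 * k)) (cong (_* (6 * k)) (length-tabulate {n = m} id))) (∑-*ˡ (allFin m) 2 arcs) ⟩
        m * (6 * k) + 2 * ∑ (allFin m) arcs              ≤⟨ +-monoʳ-≤ (m * (6 * k)) (*-monoʳ-≤ 2 arcs-total) ⟩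
        m * (6 * k) + 2 * suc (m * suc r)                <⟨ m<m+n _ {2} (s≤s z≤n) ⟩
        m * (6 * k) + 2 * suc (m * suc r) + 2            ≡⟨ identity m k₀ ⟩
        4 * suc (m * (2 + r))                            ≡⟨ cong (4 *_) (sym lengths-total) ⟩
        4 * ∑ (allFin m) (λ i → length (Star i))         ≡⟨ sym (∑-*ˡ (allFin m) 4 (λ i → length (Star i))) ⟩
        ∑ (allFin m) (λ i → 4 * length (Star i)) ∎
        where
        open ≤-Reasoning
        identity : ∀ m k₀ → m * (6 * suc k₀) + 2 * suc (m * suc (k₀ * 3)) + 2 ≡ 4 * suc (m * (2 + k₀ * 3))
        identity = solve-∀

    free-star : FreeStar g c
    free-star with ∑-exceeds (allFin m) (λ i → 6 * k + 2 * arcs i) (λ i → 4 * length (Star i)) surplus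
    -- The choice q = 2 is sharp for pairs and triangles, and larger cliques have more arcs than a
    -- map on their elements supplies.
    ... | i , _ , lt with turán-directed _≟ˡ_ (maps-to _≟ˡ_ g) (λ l → dec-false (g l ≟ˡ l) (g≢ l)) 2 (Star i) (Star-unique i)
    ...   | I , bound = record
      { centre = i
      ; rays = elems I
      ; rays-unique = unique I
      ; rays-many = *-cancelˡ-< 6 _ _ (+-cancelʳ-< (2 * arcs i) _ _ (<-≤-trans lt bound))
      ; rays-few = ≤-trans (length-⊆ (unique I) (sub I)) (≤-trans (≤-reflexive (Star-length i)) (star-length i))
      ; rays-links = λ l∈ → Star-incident i (sub I l∈)
      ; rays-free = λ {l} {l′} l∈ l′∈ eq → true≢false (dec-true (g l ≟ˡ l′) eq) (indep I l∈ l′∈)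
      }

-- Star forests

nbrs : ∀ F → Fin (n F) → List (Fin (n F))
nbrs F x = keep (adj F x) (allFin (n F))

∈-nbrs : ∀ F {x y} → adj F x y ≡ true → y ∈ nbrs F x
∈-nbrs F {x} {y} a = ∈-keep⁺ (adj F x) (∈-allFin y) a

nbrs-adj : ∀ F {x y} → y ∈ nbrs F x → adj F x y ≡ true
nbrs-adj F {x} y∈ = proj₂ (∈-keep⁻ (adj F x) {xs = allFin (n F)} y∈)

nbrs-unique : ∀ F x → Unique (nbrs F x)
nbrs-unique F x = keep-unique (adj F x) (Uniqueₚ.allFin⁺ (n F))

-- Bipartition into centres and leaves. At a leaf, `mate` is its centre; at a centre it is some
-- neighbour, so that the function is total.
record StarForest (F : Graph) (s : ℕ) : Set where
  field
    isHub     : Fin (n F) → Bool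
    mate      : Fin (n F) → Fin (n F)
    mate-adj  : ∀ x → adj F (mate x) x ≡ true
    hub-leaf  : ∀ {x y} → adj F x y ≡ true → isHub x ≡ true → isHub y ≡ false
    leaf-hub  : ∀ {x y} → adj F x y ≡ true → isHub x ≡ false → isHub y ≡ true
    leaf-mate : ∀ {x y} → isHub x ≡ false → adj F x y ≡ true → y ≡ mate x
    degree    : ∀ x → length (nbrs F x) ≤ s

-- Star forests in many copies of a caterpillar

module CaterpillarUnavoidable (M m₀ k₀ : ℕ) where
  open Caterpillar M m₀ k₀
  open FreeStar

  module _ (g : Cell → Cell) (stars : ∀ c → FreeStar g c) where

    -- The diagonal is excluded because arcs within a copy are already ruled out by `rays-free`, and
    -- Turán's bound is for irreflexive relations.
    clash : Fin M → Fin M → Bool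
    clash c c′ = not (does (c Fin.≟ c′)) ∧ does (Any.any? (λ l → proj₁ (g l) Fin.≟ c′) (rays (stars c)))

    clash-irrefl : ∀ c → clash c c ≡ false
    clash-irrefl c = cong (λ b → not b ∧ does (Any.any? (λ l → proj₁ (g l) Fin.≟ c) (rays (stars c)))) (dec-true (c Fin.≟ c) refl)

    clash-true : ∀ {c c′ l} → c ≢ c′ → l ∈ rays (stars c) → proj₁ (g l) ≡ c′ → clash c c′ ≡ true
    clash-true {c} {c′} c≢ l∈ eq = cong₂ (λ a b → not a ∧ b) (dec-false (c Fin.≟ c′) c≢)
      (dec-true (Any.any? (λ l → proj₁ (g l) Fin.≟ c′) (rays (stars c))) (lose l∈ eq))

    clash-few : ∀ c → count (clash c) (allFin M) ≤ 3 + r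
    clash-few c = begin
      count (clash c) (allFin M)                                                ≤⟨ ∑-mono (allFin M) (λ {c′} _ → witnessed c′) ⟩
      ∑ (allFin M) (λ c′ → count (λ l → does (proj₁ (g l) Fin.≟ c′)) R)          ≡⟨ ∑-swap (allFin M) R (λ c′ l → ⟦ does (proj₁ (g l) Fin.≟ c′) ⟧) ⟩
      ∑ R (λ l → count (λ c′ → does (proj₁ (g l) Fin.≟ c′)) (allFin M))          ≤⟨ ∑-bound R (λ {l} _ → count-does≤1 (proj₁ (g l) Fin.≟_) (Uniqueₚ.allFin⁺ M) λ _ _ p q → trans (sym p) q) ⟩
      length R * 1                                                              ≤⟨ ≤-trans (≤-reflexive (*-identityʳ _)) (rays-few (stars c)) ⟩
      3 + r ∎
      where
      open ≤-Reasoning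
      R = rays (stars c)
      witnessed : ∀ c′ → ⟦ clash c c′ ⟧ ≤ count (λ l → does (proj₁ (g l) Fin.≟ c′)) R
      witnessed c′ with not (does (c Fin.≟ c′)) | Any.any? (λ l → proj₁ (g l) Fin.≟ c′) R
      ... | false | _     = z≤n
      ... | true  | no _  = z≤n
      ... | true  | yes a = let (l , l∈ , eq) = find a in count-pos _ l∈ (dec-true (proj₁ (g l) Fin.≟ c′) eq)

    -- Each copy clashes with at most b = 3 + r others in the forward direction, so Turán's bound
    -- with q = 2b reads 4bM ≤ 2b(2b + 1)α + 2bM.
    independent-copies : Σ (Independent clash (allFin M)) λ I → M ≤ suc (2 * (3 + r)) * length (elems I)
    independent-copies with turán-directed Fin._≟_ clash clash-irrefl (2 * (3 + r)) (allFin M) (Uniqueₚ.allFin⁺ M)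
    ... | I , bound = I , *-cancelˡ-≤ (2 * b) (+-cancelʳ-≤ (2 * (M * b)) _ _ (begin
        2 * b * M + 2 * (M * b)                              ≡⟨ double M b ⟩
        2 * (2 * b) * M                                      ≡⟨ cong (2 * (2 * b) *_) (sym (length-tabulate {n = M} id)) ⟩
        2 * (2 * b) * length (allFin M)                      ≤⟨ bound ⟩
        2 * b * suc (2 * b) * α + 2 * ∑ (allFin M) (λ c → count (clash c) (allFin M))
          ≤⟨ +-monoʳ-≤ (2 * b * suc (2 * b) * α) (*-monoʳ-≤ 2 (≤-trans (∑-bound (allFin M) (λ {c} _ → clash-few c))
               (≤-reflexive (cong (_* b) (length-tabulate {n = M} id))))) ⟩
        2 * b * suc (2 * b) * α + 2 * (M * b)                ≡⟨ cong (_+ 2 * (M * b)) (*-assoc (2 * b) (suc (2 * b)) α) ⟩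
        2 * b * (suc (2 * b) * α) + 2 * (M * b) ∎))
      where
      open ≤-Reasoning
      b = 3 + r
      α = length (elems I)
      double : ∀ M b → 2 * b * M + 2 * (M * b) ≡ 2 * (2 * b) * M
      double = solve-∀

    module Embed {F : Graph} (sf : StarForest F (suc k)) (T : List (Fin M)) (T-unique : Unique T)
                 (T-indep : ∀ {c c′} → c ∈ T → c′ ∈ T → clash c c′ ≡ false) (enough : n F ≤ length T) where
      open StarForest sf

      -- Allotting a copy to every vertex of F, leaf or centre, saves numbering the centres and
      -- explains the demand for `n F` independent copies.
      spot : Fin (n F) → Fin M
      spot x = List.lookup T (Fin.inject≤ x enough)

      spot-injective : ∀ {x y} → spot x ≡ spot y → x ≡ y
      spot-injective eq = Finₚ.inject≤-injective enough enough _ _ (lookup-injective T-unique eq)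

      spot∈ : ∀ x → spot x ∈ T
      spot∈ x = ∈-lookup _

      middle : Fin (n F) → Cell
      middle x = hub (spot x) (centre (stars (spot x)))

      wide : ∀ h → length (nbrs F h) ≤ length (rays (stars (spot h)))
      wide h = ≤-trans (degree h) (rays-many (stars (spot h)))

      ray : ∀ h {x} → x ∈ nbrs F h → Cell
      ray h x∈ = List.lookup (rays (stars (spot h))) (Fin.inject≤ (Any.index x∈) (wide h))

      ray∈ : ∀ h {x} (x∈ : x ∈ nbrs F h) → ray h x∈ ∈ rays (stars (spot h))
      ray∈ h x∈ = ∈-lookup _

      ray-links : ∀ h {x} (x∈ : x ∈ nbrs F h) → Links (ray h x∈) (middle h) (other (middle h) (ray h x∈))
      ray-links h x∈ = other-ends (rays-links (stars (spot h)) (ray∈ h x∈))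

      ray-injective : ∀ {h h′ x y} (x∈ : x ∈ nbrs F h) (y∈ : y ∈ nbrs F h′) → h ≡ h′ → ray h x∈ ≡ ray h′ y∈ → x ≡ y
      ray-injective {h} x∈ y∈ refl eq = trans (lookup-index x∈) (trans
        (cong (List.lookup (nbrs F h)) (Finₚ.inject≤-injective (wide h) (wide h) _ _ (lookup-injective (rays-unique (stars (spot h))) eq)))
        (sym (lookup-index y∈)))

      mate∈ : ∀ x → x ∈ nbrs F (mate x)
      mate∈ x = ∈-nbrs F (mate-adj x)

      leafRay : Fin (n F) → Cell
      leafRay x = ray (mate x) (mate∈ x)

      leafCell : Fin (n F) → Cell
      leafCell x = other (middle (mate x)) (leafRay x)

      leafLinks : ∀ x → Links (leafRay x) (middle (mate x)) (leafCell x)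
      leafLinks x = ray-links (mate x) (mate∈ x)

      leafCopy : ∀ x → proj₁ (leafCell x) ≡ spot (mate x)
      leafCopy x = let (p , q) = links-copy {leafRay x} (leafLinks x) in trans q (sym p)

      place : Fin (n F) → Cell
      place x = if isHub x then middle x else leafCell x

      place-hub : ∀ {x} → isHub x ≡ true → place x ≡ middle x
      place-hub eq rewrite eq = refl

      place-leaf : ∀ {x} → isHub x ≡ false → place x ≡ leafCell x
      place-leaf eq rewrite eq = refl

      hub≢leaf : ∀ x y → middle x ≢ leafCell y
      hub≢leaf x y eq with spot-injective (trans (cong proj₁ eq) (leafCopy y))
      ... | refl = ends-≢ (leafLinks y) eq

      leaf-injective : ∀ x y → leafCell x ≡ leafCell y → x ≡ y
      leaf-injective x y eq = ray-injective (mate∈ x) (mate∈ y) same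
          (Net.simple net (leafLinks x) (subst (λ z → Links (leafRay y) (middle z) (leafCell x)) (sym same)
            (subst (Links (leafRay y) (middle (mate y))) (sym eq) (leafLinks y))))
        where
        same : mate x ≡ mate y
        same = spot-injective (trans (sym (leafCopy x)) (trans (cong proj₁ eq) (leafCopy y)))

      place-injective : ∀ {x y} → place x ≡ place y → x ≡ y
      place-injective {x} {y} = cases (isHub x) (isHub y)
        where
        cases : ∀ a b → (if a then middle x else leafCell x) ≡ (if b then middle y else leafCell y) → x ≡ y
        cases true  true  eq = spot-injective (cong proj₁ eq)
        cases true  false eq = contradiction eq (hub≢leaf x y)
        cases false true  eq = contradiction (sym eq) (hub≢leaf y x)
        cases false false eq = leaf-injective x y eq

      Chosen : Cell → Set
      Chosen l = ∃[ x ] l ∈ rays (stars (spot x))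

      rays-copy : ∀ {x l} → l ∈ rays (stars (spot x)) → proj₁ l ≡ spot x
      rays-copy {x} {l} l∈ = sym (proj₁ (links-copy {l} (other-ends {middle x} {l} (rays-links (stars (spot x)) l∈))))

      separated : ∀ {l l′} → Chosen l → Chosen l′ → g l ≢ l′
      separated {l} {l′} (x , l∈) (y , l′∈) eq with spot x Fin.≟ spot y
      ... | yes same = rays-free (stars (spot x)) l∈ (subst (λ c → l′ ∈ rays (stars c)) (sym same) l′∈) eq
      ... | no differ = true≢false (clash-true differ l∈ (trans (cong proj₁ eq) (rays-copy l′∈))) (T-indep (spot∈ x) (spot∈ y))

      realised-hub : ∀ {x y} → isHub x ≡ true → adj F x y ≡ true → ∃[ l ] Chosen l × Links l (place x) (place y)
      realised-hub {x} {y} hx a rewrite place-hub hx | place-leaf (hub-leaf a hx)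
        | leaf-mate (hub-leaf a hx) (trans (adj-sym F y x) a) = leafRay y , (mate y , ray∈ (mate y) (mate∈ y)) , leafLinks y

      realised : ∀ {x y} → adj F x y ≡ true → ∃[ l ] Chosen l × Links l (place x) (place y)
      realised {x} {y} a with isHub x in hx
      ... | true  = subst (λ z → ∃[ l ] Chosen l × Links l z (place y)) (place-hub hx) (realised-hub hx a)
      ... | false = let (l , ch , e) = realised-hub (leaf-hub a hx) (trans (adj-sym F y x) a)
                    in subst (λ z → ∃[ l ] Chosen l × Links l z (place y)) (place-leaf hx) (l , ch , ends-sym e)

      placement : Placement F g
      placement = record { place = place ; injective = place-injective ; Chosen = Chosen ; separated = separated ; realised = realised }

  -- Among M copies at least M / (2(3 + r) + 1) are independent, so this M leaves `n F` of them.
  caterpillar-unavoidable : ∀ {F} → StarForest F (suc k) → M ≡ suc (2 * (3 + r)) * n F → 1 ≤ M → Unavoidable F graph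
  caterpillar-unavoidable {F} sf M≡ 1≤M = net-unavoidable {F} {hub c₀ fzero} {hub c₀ (fsuc fzero)} (λ ()) λ g g≢ →
    let stars = free-star g g≢
        (I , bound) = independent-copies g stars
    in Embed.placement g stars sf (elems I) (unique I) (indep I) (*-cancelˡ-≤ (suc (2 * (3 + r))) (subst (_≤ suc (2 * (3 + r)) * length (elems I)) M≡ bound))
    where
    c₀ = fromℕ< 1≤M

-- Avoidability of small subgraphs of caterpillars

rotate : Fin 3 → Fin 3
rotate fzero               = fsuc fzero
rotate (fsuc fzero)        = fsuc (fsuc fzero)
rotate (fsuc (fsuc fzero)) = fzero

rotate≢ : ∀ a → rotate a ≢ a
rotate≢ fzero               ()
rotate≢ (fsuc fzero)        ()
rotate≢ (fsuc (fsuc fzero)) ()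

rotate-related : ∀ a b → a ≢ b → rotate a ≡ b ⊎ rotate b ≡ a
rotate-related fzero               fzero               h = contradiction refl h
rotate-related fzero               (fsuc fzero)        _ = inj₁ refl
rotate-related fzero               (fsuc (fsuc fzero)) _ = inj₂ refl
rotate-related (fsuc fzero)        fzero               _ = inj₂ refl
rotate-related (fsuc fzero)        (fsuc fzero)        h = contradiction refl h
rotate-related (fsuc fzero)        (fsuc (fsuc fzero)) _ = inj₁ refl
rotate-related (fsuc (fsuc fzero)) fzero               _ = inj₁ refl
rotate-related (fsuc (fsuc fzero)) (fsuc fzero)        _ = inj₂ refl
rotate-related (fsuc (fsuc fzero)) (fsuc (fsuc fzero)) h = contradiction refl h

-- When one cycle vertex `cut c` is absent from every copy c, cycle edges are sent towards v₀ on both sides of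
-- the cut, the two cycle edges and the further leaf at v₀ form a directed triangle, and the remaining leaves
-- at each vertex are grouped into directed triangles.  The edges at a vertex then split into k cliques.
module CaterpillarAvoidable (M m₀ k₀ : ℕ) (cut : Fin M → Fin (3 + m₀)) where
  open Caterpillar M m₀ k₀

  rotateLeaf : Fin r → Fin r
  rotateLeaf t = let (q , a) = remQuot {k₀} 3 t in combine q (rotate a)

  private
    remQuot-injective : ∀ {t t′ : Fin r} → remQuot {k₀} 3 t ≡ remQuot 3 t′ → t ≡ t′
    remQuot-injective {t} {t′} eq =
      trans (sym (Finₚ.combine-remQuot {k₀} 3 t)) (trans (cong (λ (q , a) → combine q a) eq) (Finₚ.combine-remQuot {k₀} 3 t′))

  rotateLeaf≢ : ∀ t → rotateLeaf t ≢ t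
  rotateLeaf≢ t eq = let (q , a) = remQuot {k₀} 3 t in
    rotate≢ a (cong proj₂ (trans (sym (Finₚ.remQuot-combine q (rotate a))) (cong (remQuot {k₀} 3) eq)))

  rotateLeaf-related : ∀ t t′ → t ≢ t′ → proj₁ (remQuot {k₀} 3 t) ≡ proj₁ (remQuot {k₀} 3 t′) →
                       rotateLeaf t ≡ t′ ⊎ rotateLeaf t′ ≡ t
  rotateLeaf-related t t′ t≢ same with rotate-related (proj₂ (remQuot {k₀} 3 t)) (proj₂ (remQuot {k₀} 3 t′))
                                         (λ eq → t≢ (remQuot-injective (cong₂ _,_ same eq)))
  ... | inj₁ eq = inj₁ (trans (cong₂ combine same eq) (Finₚ.combine-remQuot {k₀} 3 t′))
  ... | inj₂ eq = inj₂ (trans (cong₂ combine (sym same) eq) (Finₚ.combine-remQuot {k₀} 3 t))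

  nxt : Cell → Cell
  nxt (c , nothing)              = hub c (next fzero)
  nxt (c , just (i , fsuc t))    = c , just (i , fsuc (rotateLeaf t))
  nxt (c , just (fzero , fzero)) = c , nothing
  nxt (c , just (fsuc i , fzero)) with toℕ (fsuc i) ≤? toℕ (cut c)
  ... | yes _ = hub c (inject₁ i)
  ... | no _  = hub c (next (fsuc i))

  nxt≢ : ∀ l → nxt l ≢ l
  nxt≢ (c , nothing) ()
  nxt≢ (c , just (i , fsuc t)) eq = rotateLeaf≢ t (leaf-injective eq)
    where
    leaf-injective : ∀ {t t′} → (c , just (i , fsuc t)) ≡ (c , just (i , fsuc t′)) → t ≡ t′
    leaf-injective refl = refl
  nxt≢ (c , just (fzero , fzero)) ()
  nxt≢ (c , just (fsuc i , fzero)) with toℕ (fsuc i) ≤? toℕ (cut c)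
  ... | yes _ = λ eq → inject₁≢suc i (proj₂ (hub-injective eq))
  ... | no _  = λ eq → next≢ (fsuc i) (proj₂ (hub-injective eq))

  back : ∀ {c} i → toℕ (fsuc i) ≤ toℕ (cut c) → nxt (hub c (fsuc i)) ≡ hub c (inject₁ i)
  back {c} i le with toℕ (fsuc i) ≤? toℕ (cut c)
  ... | yes _ = refl
  ... | no h  = contradiction le h

  forth : ∀ {c} i → toℕ (cut c) < toℕ i → nxt (hub c i) ≡ hub c (next i)
  forth {c} (fsuc i) lt with toℕ (fsuc i) ≤? toℕ (cut c)
  ... | yes le = contradiction lt (≤⇒≯ le)
  ... | no _   = refl

  -- The cycle edges at vᵢ are labelled i and j. The two flows towards v₀ part only at the cut, so
  -- at any other vertex one of these edges is sent to the other.
  consecutive : ∀ {c i} j → prev j ≡ i → i ≢ cut c → nxt (hub c i) ≡ hub c j ⊎ nxt (hub c j) ≡ hub c i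
  consecutive {c} fzero refl i≢ = inj₁ (trans (forth (fromℕ _) (≤∧≢⇒< (≤-trans (Finₚ.toℕ≤pred[n] (cut c)) (≤-reflexive (sym (Finₚ.toℕ-fromℕ _))))
                                     (λ eq → i≢ (sym (Finₚ.toℕ-injective eq))))) (cong (hub c) (next-unique refl)))
  consecutive {c} (fsuc a) refl i≢ with toℕ (fsuc a) ≤? toℕ (cut c)
  ... | yes le = inj₂ refl
  ... | no gt  = inj₁ (trans (forth (inject₁ a) (≤∧≢⇒< (subst (toℕ (cut c) ≤_) (sym (Finₚ.toℕ-inject₁ a)) (s≤s⁻¹ (≰⇒> gt)))
                               (λ eq → i≢ (sym (Finₚ.toℕ-injective eq))))) (cong (hub c) (next-unique refl)))

  data At (c : Fin M) (i : Fin m) : Cell → Set where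
    extra : i ≡ fzero → At c i (c , nothing)
    own   : At c i (hub c i)
    up    : ∀ j → prev j ≡ i → At c i (hub c j)
    pendant : ∀ t → At c i (c , just (i , fsuc t))

  at-hub : ∀ {c i b} l → Links l (hub c i) b → At c i l
  at-hub (_ , nothing)           (fwd refl _) = extra refl
  at-hub (_ , nothing)           (bwd _ ())
  at-hub (_ , just (_ , fzero))  (fwd refl _) = own
  at-hub (_ , just (j , fzero))  (bwd _ refl) = up j refl
  at-hub (_ , just (_ , fsuc t)) (fwd refl _) = pendant t
  at-hub (_ , just (_ , fsuc t)) (bwd _ ())

  -- Class 0 holds the cycle edges and the further leaf, the k₀ others the triples of leaves. The
  -- numbering is common to all vertices, since classes are compared only for edges with a common
  -- end.
  class : Cell → Fin k
  class (c , just (i , fsuc t)) = fsuc (proj₁ (remQuot {k₀} 3 t))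
  class (c , just (i , fzero))  = fzero
  class (c , nothing)           = fzero

  hub-clique : ∀ {c i l l′} → i ≢ cut c → At c i l → At c i l′ → l ≢ l′ → class l ≡ class l′ → nxt l ≡ l′ ⊎ nxt l′ ≡ l
  hub-clique i≢ (extra _)    (extra _)    l≢ _  = contradiction refl l≢
  hub-clique i≢ (extra refl) own          l≢ _  = inj₂ refl
  hub-clique {c} i≢ (extra refl) (up j eq) l≢ _ = inj₁ (cong (hub c) (next-unique eq))
  hub-clique i≢ own          (extra refl) l≢ _  = inj₁ refl
  hub-clique {c} i≢ (up j eq) (extra refl) l≢ _ = inj₂ (cong (hub c) (next-unique eq))
  hub-clique i≢ own          own          l≢ _  = contradiction refl l≢
  hub-clique i≢ own          (up j eq)    l≢ _  = consecutive j eq i≢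
  hub-clique i≢ (up j eq)    own          l≢ _  = swap (consecutive j eq i≢)
  hub-clique {c} i≢ (up j eq) (up j′ eq′) l≢ _  = contradiction (cong (hub c) (prev-injective (trans eq (sym eq′)))) l≢
  hub-clique {c} {i} i≢ (pendant t) (pendant t′) l≢ eq
    with rotateLeaf-related t t′ (λ e → l≢ (cong (λ t → c , just (i , fsuc t)) e)) (Finₚ.suc-injective eq)
  ... | inj₁ e = inj₁ (cong (λ t → c , just (i , fsuc t)) e)
  ... | inj₂ e = inj₂ (cong (λ t → c , just (i , fsuc t)) e)
  hub-clique i≢ (extra _) (pendant _)  l≢ ()
  hub-clique i≢ own       (pendant _)  l≢ ()
  hub-clique i≢ (up _ _)  (pendant _)  l≢ ()
  hub-clique i≢ (pendant _)  (extra _) l≢ ()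
  hub-clique i≢ (pendant _)  own       l≢ ()
  hub-clique i≢ (pendant _)  (up _ _)  l≢ ()

  at-leaf : ∀ {c i t b} l → Links l (c , just (i , fsuc t)) b → l ≡ (c , just (i , fsuc t))
  at-leaf (_ , nothing)           (fwd () _)
  at-leaf (_ , nothing)           (bwd _ ())
  at-leaf (_ , just (_ , fzero))  (fwd () _)
  at-leaf (_ , just (_ , fzero))  (bwd _ ())
  at-leaf (_ , just (_ , fsuc _)) (fwd () _)
  at-leaf (_ , just (_ , fsuc _)) (bwd _ eq) = eq

  at-extra : ∀ {c b} l → Links l (c , nothing) b → l ≡ (c , nothing)
  at-extra (_ , nothing)           (fwd () _)
  at-extra (_ , nothing)           (bwd _ eq) = eq
  at-extra (_ , just (_ , fzero))  (fwd () _)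
  at-extra (_ , just (_ , fzero))  (bwd _ ())
  at-extra (_ , just (_ , fsuc _)) (fwd () _)
  at-extra (_ , just (_ , fsuc _)) (bwd _ ())

  -- A leaf of the caterpillar has a single edge, so two distinct edges can meet only at a cycle
  -- vertex, where the absence of the cut applies.
  clique : ∀ {l l′ b b′} a → (∀ c → a ≢ hub c (cut c)) → Links l a b → Links l′ a b′ → l ≢ l′ → class l ≡ class l′ →
           nxt l ≡ l′ ⊎ nxt l′ ≡ l
  clique (c , nothing)           _      e e′ l≢ _ = contradiction (trans (at-extra _ e) (sym (at-extra _ e′))) l≢
  clique (c , just (i , fsuc t)) _      e e′ l≢ _ = contradiction (trans (at-leaf _ e) (sym (at-leaf _ e′))) l≢
  clique (c , just (i , fzero))  uncut  e e′ l≢ q = hub-clique (λ i≡ → uncut c (cong (hub c) i≡)) (at-hub _ e) (at-hub _ e′) l≢ q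

module Blocking (N : Net) {G′ : Graph} (κ : Copy G′ (NetGraph.graph N)) where
  open Net N using (Vertex; Label)
  open NetGraph N
  open Sub κ

  missing-vertex : ∀ {q} (h : Fin q → Vertex) → (∀ {i j} → h i ≡ h j → i ≡ j) → n G′ < q → ∃[ j ] (∀ x → vertex x ≢ h j)
  missing-vertex {q} h h-inj small with escape (allFin (n G′)) (allFin q) (λ x j → does (vertex x ≟ᵛ h j)) few
    where
    few : ∑ (allFin (n G′)) (λ x → count (λ j → does (vertex x ≟ᵛ h j)) (allFin q)) < length (allFin q)
    few = begin-strict
      ∑ (allFin (n G′)) (λ x → count (λ j → does (vertex x ≟ᵛ h j)) (allFin q))
        ≤⟨ ∑-bound (allFin (n G′)) (λ {x} _ → count-does≤1 (λ j → vertex x ≟ᵛ h j) (Uniqueₚ.allFin⁺ q)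
             λ _ _ p q → h-inj (trans (sym p) q)) ⟩
      length (allFin (n G′)) * 1   ≡⟨ trans (*-identityʳ _) (length-tabulate {n = n G′} id) ⟩
      n G′                         <⟨ small ⟩
      q                            ≡⟨ sym (length-tabulate {n = q} id) ⟩
      length (allFin q) ∎
      where open ≤-Reasoning
  ... | j , _ , ok = j , λ x eq → true≢false (dec-true (vertex x ≟ᵛ h j) eq) (ok (∈-allFin x))

  -- By the pigeonhole principle two of the 2 + k edges of a star lie in the same clique.
  clique-cover : ∀ {k} (nxt : Label → Label) → (∀ l → nxt l ≢ l) → (class : Label → Fin (suc k)) →
    (∀ x {l l′ b b′} → Links l (vertex x) b → Links l′ (vertex x) b′ → l ≢ l′ → class l ≡ class l′ → nxt l ≡ l′ ⊎ nxt l′ ≡ l) →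
    ∀ {F} w → 2 + k ≤ length (nbrs F w) → ¬ Unavoidable F G′
  clique-cover {k} nxt nxt≢ class clique {F} w wide (c₀ , free) = blocked (proj₁ chosen) (proj₂ chosen)
    where
    ray : Fin (2 + k) → Fin (n F)
    ray i = List.lookup (nbrs F w) (Fin.inject≤ i wide)
    ray-injective : ∀ {i j} → ray i ≡ ray j → i ≡ j
    ray-injective eq = Finₚ.inject≤-injective wide wide _ _ (lookup-injective (nbrs-unique F w) eq)
    ray-adj : ∀ i → adj F w (ray i) ≡ true
    ray-adj i = nbrs-adj F (∈-lookup _)
    rayEdge : Copy F G′ → Fin (2 + k) → Edge G′
    rayEdge φ i = link G′ _ _ (hom φ _ _ (ray-adj i))
    rayJoins : ∀ φ i → Joins (rayEdge φ i) (map φ w) (map φ (ray i))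
    rayJoins φ i = link-joins G′ _ _ (hom φ _ _ (ray-adj i))
    rayEdge-injective : ∀ φ {i j} → rayEdge φ i ≡ rayEdge φ j → i ≡ j
    rayEdge-injective φ {i} {j} eq with joins-ends (rayJoins φ i) (subst (λ e → Joins e (map φ w) (map φ (ray j))) (sym eq) (rayJoins φ j))
    ... | inj₁ (_ , q) = ray-injective (inj φ q)
    ... | inj₂ (p , _) = contradiction (inj φ p) (adj-≢ F (ray-adj j))
    adv : Σ (F1 G′) λ f → ∀ {e e′} → nxt (subname e) ≡ subname e′ → proj₁ f e ≡ e′
    adv = net-adversary nxt nxt≢ (rayEdge c₀ fzero) (rayEdge c₀ (fsuc fzero)) λ eq → case rayEdge-injective c₀ eq of λ ()
    chosen : Σ (Copy F G′) λ φ → FFree φ (proj₁ (proj₁ adv))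
    chosen = free (proj₁ adv)
    within : ∀ φ i → InCopy φ (rayEdge φ i)
    within φ i = inCopy⁺ φ (ray-adj i) (rayJoins φ i)
    arc : ∀ φ i j → FFree φ (proj₁ (proj₁ adv)) → nxt (subname (rayEdge φ i)) ≢ subname (rayEdge φ j)
    arc φ i j fr eq = fr (rayEdge φ i) (within φ i) (subst (InCopy φ) (sym (proj₂ adv {rayEdge φ i} {rayEdge φ j} eq)) (within φ j))
    related : ∀ φ i j → i ≢ j → class (subname (rayEdge φ i)) ≡ class (subname (rayEdge φ j)) →
              nxt (subname (rayEdge φ i)) ≡ subname (rayEdge φ j) ⊎ nxt (subname (rayEdge φ j)) ≡ subname (rayEdge φ i)
    related φ i j i≢j = clique (map φ w) (subname-ends (rayJoins φ i)) (subname-ends (rayJoins φ j))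
      (λ eq → i≢j (rayEdge-injective φ (subname-injective {rayEdge φ i} {rayEdge φ j} eq)))
    blocked : ∀ φ → ¬ FFree φ (proj₁ (proj₁ adv))
    blocked φ fr = let (i , j , i<j , same) = Finₚ.pigeonhole (n<1+n (suc k)) (λ i → class (subname (rayEdge φ i))) in
      [ arc φ i j fr , arc φ j i fr ]′ (related φ i j (λ eq → <-irrefl (cong toℕ eq) i<j) same)

-- Each cycle has 3 + m₀ vertices, more than G′, so every copy loses one of them; the cut is placed
-- there, independently for each copy.
caterpillar-avoidable : ∀ M m₀ k₀ {F} w → 2 + k₀ ≤ length (nbrs F w) → ∀ G′ → Copy G′ (Caterpillar.graph M m₀ k₀) →
                        n G′ ≤ m₀ → ¬ Unavoidable F G′
caterpillar-avoidable M m₀ k₀ w wide G′ κ small =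
  clique-cover nxt nxt≢ class (λ x → clique (vertex x) (λ c → proj₂ (missing c) x)) w wide
  where
  open Caterpillar M m₀ k₀ using (hub; hub-injective; net; m)
  open Blocking net κ
  open NetGraph.Sub net κ using (vertex)
  missing : ∀ c → ∃[ j ] (∀ x → vertex x ≢ hub c j)
  missing c = missing-vertex (hub c) (λ eq → proj₂ (hub-injective eq)) (≤-<-trans small (m<n+m m₀ {3} (s≤s z≤n)))
  open CaterpillarAvoidable M m₀ k₀ (λ c → proj₁ (missing c)) using (nxt; nxt≢; class; clique)

-- Graphs without a walk along three edges

module _ {F : Graph} (no-isolated : NoIsolated F) (no-walk : ¬ Walk₃ F) where

  private
    deg : Fin (n F) → ℕ
    deg x = length (nbrs F x)

    friend : Fin (n F) → Fin (n F)
    friend x = proj₁ (no-isolated x)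

    friend-adj : ∀ x → adj F x (friend x) ≡ true
    friend-adj x = proj₂ (no-isolated x)

    second-neighbour : ∀ {x y} → 2 ≤ deg x → ∃[ z ] adj F x z ≡ true × z ≢ y
    second-neighbour {x} {y} two with escape (y ∷ []) (nbrs F x) (λ y z → does (z Fin.≟ y))
        (≤-trans (s≤s (subst (_≤ 1) (sym (+-identityʳ _)) (count-does≤1 (Fin._≟ y) (nbrs-unique F x)
           λ _ _ p q → trans p (sym q)))) two)
    ... | z , z∈ , ok = z , nbrs-adj F z∈ , λ z≡y → true≢false (dec-true (z Fin.≟ y) z≡y) (ok (here refl))

    only-neighbour : ∀ {x y z} → deg x ≤ 1 → adj F x y ≡ true → adj F x z ≡ true → y ≡ z
    only-neighbour {x} {y} {z} le a b = count≤1⇒≡ (adj F x) (subst (_≤ 1) (length-keep (adj F x) (allFin (n F))) le)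
      (∈-allFin y) (∈-allFin z) a b Fin._≟_

    -- Otherwise each end has a further neighbour, and the edge is the middle of a walk along three
    -- edges.
    not-both : ∀ {x y} → adj F x y ≡ true → 2 ≤ deg x → deg y ≤ 1
    not-both {x} {y} xy dx with deg y ≤? 1
    ... | yes le = le
    ... | no gt = let (a , xa , a≢y) = second-neighbour {x} {y} dx
                      (d , yd , d≢x) = second-neighbour {y} {x} (≰⇒> gt)
                  in ⊥-elim (no-walk (record { a = a ; b = x ; c = y ; d = d ; ab = trans (adj-sym F a x) xa ; bc = xy ; cd = yd
                                             ; a≢c = a≢y ; b≢d = d≢x ∘ sym }))

    -- A component with a single edge has no distinguished centre; the smaller end is taken.
    Hub : Fin (n F) → Set
    Hub x = 2 ≤ deg x ⊎ (deg (friend x) ≤ 1 × x Fin.< friend x)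

    hub? : ∀ x → Dec (Hub x)
    hub? x = (2 ≤? deg x) ⊎-dec ((deg (friend x) ≤? 1) ×-dec (x Finₚ.<? friend x))

    ¬hub⇒leaf : ∀ {x} → ¬ Hub x → deg x ≤ 1
    ¬hub⇒leaf {x} h = s≤s⁻¹ (≰⇒> λ two → h (inj₁ two))

    hub-¬hub : ∀ {x y} → adj F x y ≡ true → Hub x → ¬ Hub y
    hub-¬hub xy (inj₁ dx) (inj₁ dy) = contradiction dy (≤⇒≯ (not-both xy dx))
    hub-¬hub {x} {y} xy (inj₁ dx) (inj₂ (dfy , _)) =
      contradiction dx (≤⇒≯ (subst (λ z → deg z ≤ 1) (only-neighbour (not-both xy dx) (friend-adj y) (trans (adj-sym F y x) xy)) dfy))
    hub-¬hub {x} {y} xy (inj₂ (dfx , _)) (inj₁ dy) =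
      contradiction dy (≤⇒≯ (subst (λ z → deg z ≤ 1) (only-neighbour (not-both (trans (adj-sym F y x) xy) dy) (friend-adj x) xy) dfx))
    hub-¬hub {x} {y} xy hx@(inj₂ (dfx , x<)) (inj₂ (dfy , y<)) with 2 ≤? deg x | 2 ≤? deg y
    ... | yes dx | _ = hub-¬hub xy (inj₁ dx) (inj₂ (dfy , y<))
    ... | no _ | yes dy = hub-¬hub xy (inj₂ (dfx , x<)) (inj₁ dy)
    ... | no lx | no ly = contradiction (subst (x Fin.<_) (only-neighbour (s≤s⁻¹ (≰⇒> lx)) (friend-adj x) xy) x<)
                            (<-asym (subst (y Fin.<_) (only-neighbour (s≤s⁻¹ (≰⇒> ly)) (friend-adj y) (trans (adj-sym F y x) xy)) y<))

    ¬hub-hub : ∀ {x y} → adj F x y ≡ true → ¬ Hub x → Hub y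
    ¬hub-hub {x} {y} xy hx with 2 ≤? deg y
    ... | yes dy = inj₁ dy
    ... | no ly = inj₂ (subst (λ z → deg z ≤ 1) (sym fy) (¬hub⇒leaf hx) , subst (y Fin.<_) (sym fy) y<x)
      where
      fy : friend y ≡ x
      fy = only-neighbour (s≤s⁻¹ (≰⇒> ly)) (friend-adj y) (trans (adj-sym F y x) xy)
      fx : friend x ≡ y
      fx = only-neighbour (¬hub⇒leaf hx) (friend-adj x) xy
      y<x : y Fin.< x
      y<x with Finₚ.<-cmp x y
      ... | tri< x<y _ _ = contradiction (inj₂ (subst (λ z → deg z ≤ 1) (sym fx) (s≤s⁻¹ (≰⇒> ly)) , subst (x Fin.<_) (sym fx) x<y)) hx
      ... | tri≈ _ x≡y _ = contradiction x≡y (adj-≢ F xy)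
      ... | tri> _ _ y<x = y<x

    refute : {P : Set} (d : Dec P) → does d ≡ false → ¬ P
    refute d eq p = true≢false (dec-true d p) eq

  starForest : ∀ {s} → (∀ x → length (nbrs F x) ≤ s) → StarForest F s
  starForest degree = record
    { isHub = λ x → does (hub? x)
    ; mate = friend
    ; mate-adj = λ x → trans (adj-sym F (friend x) x) (friend-adj x)
    ; hub-leaf = λ {x} {y} a hx → dec-false (hub? y) (hub-¬hub a (witness (hub? x) hx))
    ; leaf-hub = λ {x} {y} a hx → dec-true (hub? y) (¬hub-hub a (refute (hub? x) hx))
    ; leaf-mate = λ {x} hx a → only-neighbour (¬hub⇒leaf (refute (hub? x) hx)) a (friend-adj x)
    ; degree = degree
    }

  star-infinite : ∀ {x} → 2 ≤ length (nbrs F x) → ¬ MFinite F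
  star-infinite {x} two with widest
    where
    widest : ∃[ w ] (∀ y → deg y ≤ deg w)
    -- A vertex of maximum degree, found by minimising the codegree; degrees are at most `n F`, so
    -- the subtraction can be cancelled.
    widest with argmin (λ y → n F ∸ deg y) x (allFin (n F))
    ... | w , _ , least = w , λ y → ∸-cancelʳ-≤ (≤-trans (length-⊆ (nbrs-unique F y) (λ _ → ∈-allFin _)) (≤-reflexive (length-tabulate id)))
                                      (least (there (∈-allFin y)))
  ... | w , widest with deg w in eq
  ...   | zero        = contradiction (≤-trans two (widest x)) λ ()
  ...   | suc zero    = contradiction (≤-trans two (widest x)) λ where (s≤s ())
  ...   | suc (suc k₀) = infinite-criterion F λ N →
            Caterpillar.graph (copies (n F)) N k₀
          , CaterpillarUnavoidable.caterpillar-unavoidable (copies (n F)) N k₀ (starForest widest) refl (inhabited x)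
          , caterpillar-avoidable (copies (n F)) N k₀ w (≤-reflexive (sym eq))
    where
    copies : ℕ → ℕ
    copies a = suc (2 * (3 + k₀ * 3)) * a
    inhabited : ∀ {a} → Fin a → 1 ≤ copies a
    inhabited {suc a} _ = s≤s z≤n

-- Matchings

bool-ext : ∀ {a b} → (a ≡ true → b ≡ true) → (b ≡ true → a ≡ true) → a ≡ b
bool-ext {true}  {true}  _ _ = refl
bool-ext {true}  {false} f _ = sym (f refl)
bool-ext {false} {true}  _ g = g refl
bool-ext {false} {false} _ _ = refl

private
  half : ∀ {t} (a : Fin t) (b : Fin 2) → toℕ (combine a b) / 2 ≡ toℕ a
  half a b rewrite Finₚ.toℕ-combine a b = trans (+-distrib-/-∣ˡ (toℕ b) (m∣m*n (toℕ a)))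
    (trans (cong₂ _+_ (trans (cong (_/ 2) (*-comm 2 (toℕ a))) (m*n/n≡m (toℕ a) 2)) (m<n⇒m/n≡0 (Finₚ.toℕ<n b))) (+-identityʳ _))

matching-adj⁻ : ∀ {t} {a a′ : Fin t} {b b′ : Fin 2} → adj (matching t) (combine a b) (combine a′ b′) ≡ true → a ≡ a′ × b ≢ b′
matching-adj⁻ {t} {a} {a′} {b} {b′} h with toℕ (combine a b) / 2 ≟ toℕ (combine a′ b′) / 2
... | no ¬p = contradiction h (λ h → ¬p (≡ᵇ⇒≡ _ _ (subst T (sym (proj₁ (∧-true _ h))) tt)))
... | yes p = a≡a′ , λ b≡b′ → adj-≢ (matching t) h (cong₂ combine a≡a′ b≡b′)
  where
  a≡a′ : a ≡ a′
  a≡a′ = Finₚ.toℕ-injective (trans (sym (half a b)) (trans p (half a′ b′)))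

matching-adj⁺ : ∀ {t} (a : Fin t) {b b′ : Fin 2} → b ≢ b′ → adj (matching t) (combine a b) (combine a b′) ≡ true
matching-adj⁺ a {b} {b′} b≢b′ = cong₂ (λ x y → x ∧ not y)
  (trans (cong₂ _≡ᵇ_ (half a b) (half a b′)) (same (toℕ a)))
  (not-true λ eq → b≢b′ (Finₚ.combine-injectiveʳ a b a b′ (Finₚ.toℕ-injective (≡ᵇ⇒≡ _ _ (subst T (sym eq) tt)))))
  where
  same : ∀ x → (x ≡ᵇ x) ≡ true
  same zero    = refl
  same (suc x) = same x

-- The intrinsic form of being a matching, free of the arithmetic in `matching`; without isolated
-- vertices the two agree up to isomorphism.
MatchingLike : Graph → Set
MatchingLike F = ∀ {x y z} → adj F x y ≡ true → adj F x z ≡ true → y ≡ z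

flip₂ : Fin 2 → Fin 2
flip₂ fzero        = fsuc fzero
flip₂ (fsuc fzero) = fzero

≢-flip₂ : ∀ b → b ≢ flip₂ b
≢-flip₂ fzero        ()
≢-flip₂ (fsuc fzero) ()

flip₂-unique : ∀ {b b′} → b ≢ b′ → b′ ≡ flip₂ b
flip₂-unique {fzero}      {fzero}      h = contradiction refl h
flip₂-unique {fzero}      {fsuc fzero} h = refl
flip₂-unique {fsuc fzero} {fzero}      h = refl
flip₂-unique {fsuc fzero} {fsuc fzero} h = contradiction refl h

≅matching⇒matchingLike : ∀ {F t} → F ≅ matching t → MatchingLike F
≅matching⇒matchingLike {F} {t} (φ , ψ , ψφ , φψ , φ-adj) {x} {y} {z} xy xz =
  trans (sym (ψφ y)) (trans (cong ψ (trans (opposite xy) (sym (opposite xz)))) (ψφ z))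
  where
  code : Fin (n F) → Fin t × Fin 2
  code x = remQuot {t} 2 (φ x)
  code-≡ : ∀ x → combine (proj₁ (code x)) (proj₂ (code x)) ≡ φ x
  code-≡ x = Finₚ.combine-remQuot {t} 2 (φ x)
  opposite : ∀ {y} → adj F x y ≡ true → φ y ≡ combine (proj₁ (code x)) (flip₂ (proj₂ (code x)))
  opposite {y} xy with matching-adj⁻ {t} {proj₁ (code x)} {proj₁ (code y)} {proj₂ (code x)} {proj₂ (code y)}
                         (trans (cong₂ (adj (matching t)) (code-≡ x) (code-≡ y)) (trans (φ-adj x y) xy))
  ... | a≡ , b≢ = trans (sym (code-≡ y)) (cong₂ combine (sym a≡) (flip₂-unique b≢))

-- The partner map p is an involution without fixed points, and each of its orbits is represented by
-- its smaller element.
matchingLike⇒≅matching : ∀ {F} → NoIsolated F → MatchingLike F → ∃[ t ] F ≅ matching t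
matchingLike⇒≅matching {F} no-isolated single = t , φ , ψ , ψφ , φψ , λ i j → bool-ext (φ-adj⁻ i j) (φ-adj⁺ i j)
  where
  p : Fin (n F) → Fin (n F)
  p x = proj₁ (no-isolated x)
  p-adj : ∀ x → adj F x (p x) ≡ true
  p-adj x = proj₂ (no-isolated x)
  pp : ∀ x → p (p x) ≡ x
  pp x = single (p-adj (p x)) (trans (adj-sym F (p x) x) (p-adj x))
  low : Fin (n F) → Bool
  low x = does (x Finₚ.<? p x)
  reps : List (Fin (n F))
  reps = keep low (allFin (n F))
  t = length reps
  rep : Fin t → Fin (n F)
  rep = List.lookup reps
  rep-low : ∀ a → low (rep a) ≡ true
  rep-low a = proj₂ (∈-keep⁻ low {xs = allFin (n F)} (∈-lookup a))
  index : ∀ x → low x ≡ true → ∃[ a ] rep a ≡ x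
  index x lx = let x∈ = ∈-keep⁺ low (∈-allFin x) lx in Any.index x∈ , sym (lookup-index x∈)
  p-low : ∀ x → low x ≡ false → low (p x) ≡ true
  p-low x hx with Finₚ.<-cmp x (p x)
  ... | tri< x<p _ _ = ⊥-elim (true≢false (dec-true (x Finₚ.<? p x) x<p) hx)
  ... | tri≈ _ eq _  = contradiction eq (adj-≢ F (p-adj x))
  ... | tri> _ _ p<x = dec-true (p x Finₚ.<? p (p x)) (subst (p x Fin.<_) (sym (pp x)) p<x)
  end : Fin t → Fin 2 → Fin (n F)
  end a fzero        = rep a
  end a (fsuc fzero) = p (rep a)
  ψ : Fin (t * 2) → Fin (n F)
  ψ y = let (a , b) = remQuot {t} 2 y in end a b
  ψ-combine : ∀ a b → ψ (combine a b) ≡ end a b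
  ψ-combine a b = cong (λ (a , b) → end a b) (Finₚ.remQuot-combine a b)
  locate : ∀ x → ∃[ a ] ∃[ b ] end a b ≡ x
  locate x with low x in lx
  ... | true  = let (a , eq) = index x lx in a , fzero , eq
  ... | false = let (a , eq) = index (p x) (p-low x lx) in a , fsuc fzero , trans (cong p eq) (pp x)
  φ : Fin (n F) → Fin (t * 2)
  φ x = let (a , b , _) = locate x in combine a b
  ψφ : ∀ x → ψ (φ x) ≡ x
  ψφ x = let (a , b , eq) = locate x in trans (ψ-combine a b) eq
  rep-injective : ∀ {a a′} → rep a ≡ rep a′ → a ≡ a′
  rep-injective = lookup-injective (keep-unique low (Uniqueₚ.allFin⁺ (n F)))
  rep≢p-rep : ∀ {a a′} → rep a ≢ p (rep a′)
  rep≢p-rep {a} {a′} eq = <-asym (witness (rep a′ Finₚ.<? p (rep a′)) (rep-low a′))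
    (subst₂ Fin._<_ eq (trans (cong p eq) (pp (rep a′))) (witness (rep a Finₚ.<? p (rep a)) (rep-low a)))
  end-injective : ∀ a b a′ b′ → end a b ≡ end a′ b′ → combine a b ≡ combine a′ b′
  end-injective a fzero        a′ fzero        eq = cong (λ a → combine a fzero) (rep-injective eq)
  end-injective a (fsuc fzero) a′ (fsuc fzero) eq =
    cong (λ a → combine a (fsuc fzero)) (rep-injective (trans (sym (pp (rep a))) (trans (cong p eq) (pp (rep a′)))))
  end-injective a fzero        a′ (fsuc fzero) eq = contradiction eq rep≢p-rep
  end-injective a (fsuc fzero) a′ fzero        eq = contradiction (sym eq) rep≢p-rep
  φψ : ∀ y → φ (ψ y) ≡ y
  φψ y = let (a , b) = remQuot {t} 2 y ; (a′ , b′ , eq) = locate (ψ y) in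
    trans (end-injective a′ b′ a b eq) (Finₚ.combine-remQuot {t} 2 y)
  end-adj : ∀ a b → adj F (end a b) (end a (flip₂ b)) ≡ true
  end-adj a fzero        = p-adj (rep a)
  end-adj a (fsuc fzero) = trans (adj-sym F _ _) (p-adj (rep a))
  φ-adj⁻ : ∀ i j → adj (matching t) (φ i) (φ j) ≡ true → adj F i j ≡ true
  φ-adj⁻ i j h with locate i | locate j
  ... | a , b , refl | a′ , b′ , refl with matching-adj⁻ {t} {a} {a′} {b} {b′} h
  ...   | refl , b≢ rewrite flip₂-unique b≢ = end-adj a b
  φ-adj⁺ : ∀ i j → adj F i j ≡ true → adj (matching t) (φ i) (φ j) ≡ true
  φ-adj⁺ i j ij with locate i | locate j
  ... | a , b , refl | a′ , b′ , refl = subst (λ z → adj (matching t) (combine a b) z ≡ true)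
        (end-injective a (flip₂ b) a′ b′ (single (end-adj a b) ij)) (matching-adj⁺ a (≢-flip₂ b))

module _ (m : ℕ) where

  matchingNet : Net
  matchingNet = record
    { size = m * 2
    ; Vertex = Fin m × Fin 2
    ; enc = λ (a , b) → combine a b
    ; dec = remQuot {m} 2
    ; dec-enc = λ (a , b) → Finₚ.remQuot-combine a b
    ; enc-dec = Finₚ.combine-remQuot {m} 2
    ; Label = Fin m
    ; _≟ˡ_ = Fin._≟_
    ; labels = allFin m
    ; complete = ∈-allFin
    ; labels-uniq = Uniqueₚ.allFin⁺ m
    ; src = λ a → a , fzero
    ; dst = λ a → a , fsuc fzero
    ; loopless = λ _ ()
    ; simple = λ where
        (fwd p _) (fwd p′ _) → cong proj₁ (trans p (sym p′))
        (bwd p _) (bwd p′ _) → cong proj₁ (trans p (sym p′))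
        (fwd refl _) (bwd _ ())
        (bwd _ refl) (fwd () _)
    }

disjointEdges : ℕ → Graph
disjointEdges m = NetGraph.graph (matchingNet m)

-- Among 3t edges t are independent. The additional 3 guarantee two distinct edges even for t = 0.
disjointEdges-unavoidable : ∀ {F t} → F ≅ matching t → Unavoidable F (disjointEdges (3 + 3 * t))
disjointEdges-unavoidable {F} {t} (φ , ψ , ψφ , φψ , φ-adj) = net-unavoidable {F} {fzero} {fsuc fzero} (λ ()) λ g g≢ →
  let (I , third) = functional-independent Fin._≟_ g g≢ (allFin m) (Uniqueₚ.allFin⁺ m)
  in placed g I (*-cancelˡ-≤ 3 (≤-trans (m≤n+m (3 * t) 3) (subst (_≤ 3 * length (elems I)) (length-tabulate {n = m} id) third)))
  where
  m = 3 + 3 * t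
  open NetGraph (matchingNet m)
  module _ (g : Fin m → Fin m) (I : Independent (maps-to Fin._≟_ g) (allFin m)) (enough : t ≤ length (elems I)) where
    slot : Fin t → Fin m
    slot a = List.lookup (elems I) (Fin.inject≤ a enough)
    slot-injective : ∀ {a a′} → slot a ≡ slot a′ → a ≡ a′
    slot-injective eq = Finₚ.inject≤-injective enough enough _ _ (lookup-injective (unique I) eq)
    code : Fin (n F) → Fin t × Fin 2
    code x = remQuot {t} 2 (φ x)
    code-≡ : ∀ x → combine (proj₁ (code x)) (proj₂ (code x)) ≡ φ x
    code-≡ x = Finₚ.combine-remQuot {t} 2 (φ x)
    place : Fin (n F) → Fin m × Fin 2
    place x = slot (proj₁ (code x)) , proj₂ (code x)
    links : ∀ a {b b′} → b ≢ b′ → Links a (a , b) (a , b′)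
    links a {fzero}      {fsuc fzero} _ = fwd refl refl
    links a {fsuc fzero} {fzero}      _ = bwd refl refl
    links a {fzero}      {fzero}      h = contradiction refl h
    links a {fsuc fzero} {fsuc fzero} h = contradiction refl h
    place-injective : ∀ {x y} → place x ≡ place y → x ≡ y
    place-injective {x} {y} eq = trans (sym (ψφ x)) (trans (cong ψ (trans (sym (code-≡ x)) (trans
      (cong₂ combine (slot-injective (cong proj₁ eq)) (cong proj₂ eq)) (code-≡ y)))) (ψφ y))
    realised : ∀ {x y} → adj F x y ≡ true → ∃[ l ] l ∈ elems I × Links l (place x) (place y)
    realised {x} {y} xy with matching-adj⁻ {t} {proj₁ (code x)} {proj₁ (code y)} {proj₂ (code x)} {proj₂ (code y)}
                               (trans (cong₂ (adj (matching t)) (code-≡ x) (code-≡ y)) (trans (φ-adj x y) xy))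
    ... | a≡ , b≢ = slot (proj₁ (code x)) , ∈-lookup _
                  , subst (λ a → Links (slot (proj₁ (code x))) (place x) (slot a , proj₂ (code y))) a≡ (links (slot (proj₁ (code x))) b≢)
    placed : Placement F g
    placed = record { place = place ; injective = place-injective ; Chosen = _∈ elems I
                    ; separated = λ {l} {l′} l∈ l′∈ eq → true≢false (dec-true (g l Fin.≟ l′) eq) (indep I l∈ l′∈)
                    ; realised = realised }

-- Minimal unavoidable graphs of a matching are bounded

deleteEdge : ∀ G → Edge G → Graph
deleteEdge G e .n = n G
deleteEdge G e .adj x y = adj G x y ∧ not (does (joins? e x y))
deleteEdge G e .adj-sym x y = cong₂ (λ a b → a ∧ not b) (adj-sym G x y)
  (bool-ext (λ h → dec-true (joins? e y x) (joins-sym (witness (joins? e x y) h)))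
            (λ h → dec-true (joins? e x y) (joins-sym (witness (joins? e y x) h))))
deleteEdge G e .irrefl x = cong (_∧ not (does (joins? e x x))) (irrefl G x)

_≟ᵐ_ : ∀ {G} → DecidableEquality (Maybe (Edge G))
_≟ᵐ_ = Maybeₚ.≡-dec _≟ᵉ_

module EdgeDeletion (G : Graph) (e₀ : Edge G) where

  G⁻ : Graph
  G⁻ = deleteEdge G e₀

  κ : Copy G⁻ G
  κ = copy id id λ x y h → proj₁ (∧-true (adj G x y) h)

  survives : ∀ {x y} → adj G x y ≡ true → ¬ Joins e₀ x y → adj G⁻ x y ≡ true
  survives {x} {y} a h = cong₂ (λ a b → a ∧ not b) a (dec-false (joins? e₀ x y) h)

  deleted : ∀ {x y} → adj G⁻ x y ≡ true → ¬ Joins e₀ x y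
  deleted {x} {y} h j with adj G x y | does (joins? e₀ x y) | dec-true (joins? e₀ x y) j
  deleted () j | true  | true | _
  deleted () j | false | true | _

  not-image : ∀ e → push κ e ≢ e₀
  not-image e eq = deleted (isE e) (subst (λ z → Joins z (u e) (v e)) eq (push-joins κ (self-joins e)))

  proper : ProperSub G⁻ G
  proper = κ , λ (_ , all) → let (i , j , a , p , q) = all e₀ in deleted {i} {j} a (fwd (sym p) (sym q))

-- A vertex r of large degree: its edge to x₀ may be deleted.  A function f on the remaining edges is extended by a
-- value that f takes on many of the edges at r, if there is one; a free copy using {r , x₀} is then
-- repaired by exchanging x₀ for another neighbour y of r.
module Exchange {F : Graph} (no-isolated : NoIsolated F) (single : MatchingLike F)
                {G : Graph} (r x₀ : Fin (n G)) (rx₀ : adj G r x₀ ≡ true) where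

  e₀ : Edge G
  e₀ = link G r x₀ rx₀

  e₀-joins : Joins e₀ r x₀
  e₀-joins = link-joins G r x₀ rx₀

  open EdgeDeletion G e₀

  spoke : ∀ {y} → adj G r y ≡ true → y ≢ x₀ → adj G⁻ r y ≡ true
  spoke ry y≢ = survives ry λ j → case joins-ends e₀-joins j of λ where
    (inj₁ (_ , eq)) → y≢ (sym eq)
    (inj₂ (r≡y , _)) → adj-≢ G ry r≡y

  p : Fin (n F) → Fin (n F)
  p i = proj₁ (no-isolated i)

  p-adj : ∀ i → adj F i (p i) ≡ true
  p-adj i = proj₂ (no-isolated i)

  module _ (f : F1 G⁻) where

    record Replacement (c : Copy F G) : Set where
      field
        y     : Fin (n G)
        ry    : adj G⁻ r y ≡ true
        fresh : ∀ i → y ≢ map c i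
        not-hit : ∀ e → InCopy c (push κ e) → ¬ Joins (proj₁ f e) r y
        not-hitting : ∀ e → Joins e r y → ¬ InCopy c (push κ (proj₁ f e))

    module _ (c : Copy F G) {i₀ j₀ : Fin (n F)} (ij : adj F i₀ j₀ ≡ true) (at-r : map c i₀ ≡ r) (at-x : map c j₀ ≡ x₀)
             (old-free : ∀ e → InCopy c (push κ e) → ¬ InCopy c (push κ (proj₁ f e))) (R : Replacement c) where
      open Replacement R

      private
        φ : Fin (n F) → Fin (n G)
        φ = update (map c) j₀ y

        φ-old : ∀ {i} → i ≢ j₀ → φ i ≡ map c i
        φ-old = update-other (map c) y

        φ-inj : ∀ {i j} → φ i ≡ φ j → i ≡ j
        φ-inj {i} {j} eq with i Fin.≟ j₀ | j Fin.≟ j₀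
        ... | yes refl | yes refl = refl
        ... | yes refl | no _     = contradiction eq (fresh j)
        ... | no _     | yes refl = contradiction (sym eq) (fresh i)
        ... | no _     | no _     = inj c eq

        -- In a matching j₀ has no neighbour but i₀, so moving its image from x₀ to y changes only
        -- the edge at r.
        partner : ∀ {i} → adj F j₀ i ≡ true → φ i ≡ r
        partner {i} a with single a (trans (adj-sym F j₀ i₀) ij)
        ... | refl = trans (φ-old (adj-≢ F ij)) at-r

        keeps : ∀ {i j} → i ≢ j₀ → j ≢ j₀ → adj F i j ≡ true → adj G⁻ (map c i) (map c j) ≡ true
        keeps {i} {j} i≢ j≢ a = survives (hom c i j a) λ jn → case joins-ends e₀-joins jn of λ where
          (inj₁ (_ , eq)) → j≢ (inj c (trans (sym eq) (sym at-x)))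
          (inj₂ (_ , eq)) → i≢ (inj c (trans (sym eq) (sym at-x)))

        φ-hom : Hom F G⁻ φ
        φ-hom i j a with i Fin.≟ j₀ | j Fin.≟ j₀
        ... | yes refl | yes refl = contradiction refl (adj-≢ F a)
        ... | yes refl | no j≢    = trans (cong (adj G⁻ y) (trans (sym (φ-old j≢)) (partner a))) (trans (adj-sym G⁻ y r) ry)
        ... | no i≢    | yes refl = trans (cong (λ z → adj G⁻ z y) (trans (sym (φ-old i≢)) (partner (trans (adj-sym F _ _) a)))) ry
        ... | no i≢    | no j≢    = keeps i≢ j≢ a

      repaired : Copy F G⁻
      repaired = copy φ φ-inj φ-hom

      private
        classify : ∀ e → InCopy repaired e → Joins e r y ⊎ InCopy c (push κ e)
        classify e (i , j , a , pi , pj) with i Fin.≟ j₀ | j Fin.≟ j₀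
        ... | yes refl | yes refl = contradiction refl (adj-≢ F a)
        ... | yes refl | no j≢    = inj₁ (bwd (sym pi) (trans (sym pj) (trans (sym (φ-old j≢)) (partner a))))
        ... | no i≢    | yes refl = inj₁ (fwd (trans (sym pi) (trans (sym (φ-old i≢)) (partner (trans (adj-sym F _ _) a)))) (sym pj))
        ... | no i≢    | no j≢    = inj₂ (inCopy⁺ c a (subst₂ (Joins (push κ e)) (sym pi) (sym pj) (push-joins κ (self-joins e))))

      repaired-free : FFree repaired (proj₁ f)
      repaired-free e e∈ fe∈ with classify e e∈ | classify (proj₁ f e) fe∈
      ... | inj₁ new | inj₁ new′ = F1-≢ f e (joins-unique new′ new)
      ... | inj₁ new | inj₂ old  = not-hitting e new old
      ... | inj₂ old | inj₁ new  = not-hit e old new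
      ... | inj₂ old | inj₂ old′ = old-free e old old′

    image : Fin (n G) → Maybe (Edge G⁻)
    image y with adj G⁻ r y ≟ᵇ true
    ... | yes a = just (proj₁ f (link G⁻ r y a))
    ... | no _  = nothing

    image-≡ : ∀ {y e} → Joins e r y → image y ≡ just (proj₁ f e)
    image-≡ {y} {e} j with adj G⁻ r y ≟ᵇ true
    ... | yes a = cong (just ∘ proj₁ f) (joins-unique (link-joins G⁻ r y a) j)
    ... | no h  = contradiction (joins-adj j) h

    module Choose (c : Copy F G) (ys : List (Fin (n G))) (ys-unique : Unique ys) (ys-adj : ∀ {y} → y ∈ ys → adj G⁻ r y ≡ true) where

      -- In a matching without isolated vertices an edge is determined by either end, so the edges
      -- of the copy are indexed by vertices of F. The value `nothing` stands for the deleted edge.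
      copyEdge : Fin (n F) → Maybe (Edge G⁻)
      copyEdge i with adj G⁻ (map c i) (map c (p i)) ≟ᵇ true
      ... | yes a = just (link G⁻ _ _ a)
      ... | no _  = nothing

      copyEdge-≡ : ∀ {e} → InCopy c (push κ e) → ∃[ i ] copyEdge i ≡ just e
      copyEdge-≡ {e} (i , j , a , pi , pj) = i , found
        where
        e-joins : Joins e (map c i) (map c (p i))
        e-joins with single a (p-adj i)
        ... | refl with joins-ends (push-joins κ (self-joins e)) (fwd {e = push κ e} (sym pi) (sym pj))
        ...   | inj₁ (q , q′) = fwd q q′
        ...   | inj₂ (q , q′) = bwd q q′
        found : copyEdge i ≡ just e
        found with adj G⁻ (map c i) (map c (p i)) ≟ᵇ true
        ... | yes b = cong just (joins-unique (link-joins G⁻ _ _ b) e-joins)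
        ... | no h  = contradiction (joins-adj e-joins) h

      covered : Fin (n F) → Fin (n G) → Bool
      covered i y = does (y Fin.≟ map c i)

      hit : Fin (n F) → Fin (n G) → Bool
      hit i y with copyEdge i
      ... | just e  = does (joins? (proj₁ f e) r y)
      ... | nothing = false

      hitting : Fin (n F) → Fin (n G) → Bool
      hitting i y with copyEdge i
      ... | just e  = does (image y ≟ᵐ just e)
      ... | nothing = false

      covered-few : ∀ i → count (covered i) ys ≤ 1
      covered-few i = count-does≤1 (Fin._≟ map c i) ys-unique λ _ _ p q → trans p (sym q)

      hit-few : ∀ i → count (hit i) ys ≤ 1
      hit-few i with copyEdge i
      ... | nothing = ≤-trans (≤-reflexive (count-none (λ _ → false) {ys} (λ _ → refl))) z≤n
      ... | just e  = count-does≤1 (joins? (proj₁ f e) r) ys-unique λ _ b∈ p q → case joins-ends p q of λ where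
                (inj₁ (_ , eq)) → eq
                (inj₂ (r≡b , _)) → contradiction r≡b (adj-≢ G⁻ (ys-adj b∈))

      -- A value taken at some y₁ of the list is bounded by the hypothesis at y₁; any other value is
      -- not taken at all.
      hitting-few : ∀ {τ} → (∀ {y₁} → y₁ ∈ ys → count (λ y → does (image y ≟ᵐ image y₁)) ys ≤ τ) → ∀ i → count (hitting i) ys ≤ τ
      hitting-few {τ} unpopular i with copyEdge i
      ... | nothing = ≤-trans (≤-reflexive (count-none (λ _ → false) {ys} (λ _ → refl))) z≤n
      ... | just e with search (λ y → image y ≟ᵐ just e) ys
      ...   | inj₁ (y₁ , y₁∈ , eq) = subst (λ m → count (λ y → does (image y ≟ᵐ m)) ys ≤ τ) eq (unpopular y₁∈)
      ...   | inj₂ none = ≤-trans (≤-reflexive (count-none (λ y → does (image y ≟ᵐ just e)) {ys}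
                                    (λ {y} y∈ → dec-false (image y ≟ᵐ just e) (none y∈)))) z≤n

      not-hit-by : ∀ {y} → (∀ i → hit i y ≡ false) → ∀ e → InCopy c (push κ e) → ¬ Joins (proj₁ f e) r y
      not-hit-by {y} ok e e∈ j with copyEdge-≡ {e} e∈
      ... | i , eq with copyEdge i | ok i
      not-hit-by {y} ok e e∈ j | i , refl | just .e | no-hit = true≢false (dec-true (joins? (proj₁ f e) r y) j) no-hit

      not-hitting-by : ∀ {y} → (∀ i → hitting i y ≡ false) → ∀ e → Joins e r y → ¬ InCopy c (push κ (proj₁ f e))
      not-hitting-by {y} ok e j fe∈ with copyEdge-≡ {proj₁ f e} fe∈
      ... | i , eq with copyEdge i | ok i
      not-hitting-by {y} ok e j fe∈ | i , refl | just _ | no-hit = true≢false (dec-true (image y ≟ᵐ just (proj₁ f e)) (image-≡ j)) no-hit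

      -- Each vertex of F excludes one y as the image of that vertex, one y whose edge is the value
      -- of f on the copy edge there, and at most τ further ones; hence 2 + τ.
      avoid : (bad : Fin (n F) → Fin (n G) → Bool) → ∀ {τ} → (∀ i → count (bad i) ys ≤ τ) → n F * (2 + τ) < length ys →
              ∃[ y ] y ∈ ys × (∀ i → y ≢ map c i) × (∀ i → hit i y ≡ false) × (∀ i → bad i y ≡ false)
      avoid bad {τ} few lt with escape (allFin (n F)) ys (λ i y → covered i y ∨ (hit i y ∨ bad i y))
          (≤-<-trans (≤-trans (∑-bound (allFin (n F)) λ {i} _ → ≤-trans (count-∨ (covered i) (λ y → hit i y ∨ bad i y) ys)
             (+-mono-≤ (covered-few i) (≤-trans (count-∨ (hit i) (bad i) ys) (+-mono-≤ (hit-few i) (few i)))))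
             (≤-reflexive (cong (_* (2 + τ)) (length-tabulate {n = n F} id)))) lt)
      ... | y , y∈ , ok = y , y∈
          , (λ i eq → true≢false (dec-true (y Fin.≟ map c i) eq) (proj₁ (∨-false (covered i y) (ok (∈-allFin i)))))
          , (λ i → proj₁ (∨-false (hit i y) (proj₂ (∨-false (covered i y) (ok (∈-allFin i))))))
          , (λ i → proj₂ (∨-false (hit i y) (proj₂ (∨-false (covered i y) (ok (∈-allFin i))))))

      replacement-unpopular : ∀ {τ} → (∀ {y₁} → y₁ ∈ ys → count (λ y → does (image y ≟ᵐ image y₁)) ys ≤ τ) →
                              n F * (2 + τ) < length ys → Replacement c
      replacement-unpopular unpopular lt with avoid hitting (hitting-few unpopular) lt
      ... | y , y∈ , fr , nh , nb = record
        { y = y ; ry = ys-adj y∈ ; fresh = fr ; not-hit = not-hit-by nh ; not-hitting = not-hitting-by nb }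

      -- All candidates share the value e₁, which lies outside the copy, so none of their edges is
      -- sent into the copy and only two exclusions per vertex of F remain.
      replacement-popular : ∀ {e₁} → (∀ {y} → y ∈ ys → image y ≡ just e₁) → ¬ InCopy c (push κ e₁) →
                            n F * 2 < length ys → Replacement c
      replacement-popular {e₁} popular e₁∉ lt
        with avoid (λ _ _ → false) {0} (λ i → ≤-reflexive (count-none (λ _ → false) {ys} (λ _ → refl))) lt
      ... | y , y∈ , fr , nh , _ = record
        { y = y ; ry = ys-adj y∈ ; fresh = fr ; not-hit = not-hit-by nh
        ; not-hitting = λ e j → subst (λ z → ¬ InCopy c (push κ z)) (Maybeₚ.just-injective (trans (sym (popular y∈)) (image-≡ j))) e₁∉ }

module DegreeBound {F : Graph} (no-isolated : NoIsolated F) (single : MatchingLike F) {G : Graph} (un : Unavoidable F G)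
                   (r x₀ : Fin (n G)) (rx₀ : adj G r x₀ ≡ true) where
  open Exchange {F} no-isolated single {G} r x₀ rx₀
  open EdgeDeletion G e₀ using (G⁻; κ; survives; not-image; proper)

  module _ (f : F1 G⁻) (ys : List (Fin (n G))) (ys-unique : Unique ys) (ys-adj : ∀ {y} → y ∈ ys → adj G⁻ r y ≡ true)
           (large : n F * (2 + n F * 2) < length ys) where

    private
      Good : Edge G⁻ → Set
      Good e₁ = ∀ (c : Copy F G) → ¬ InCopy c (push κ e₁) → Replacement f c

      same : Fin (n G) → Fin (n G) → Bool
      same y₁ y = does (image f y ≟ᵐ image f y₁)

      popular-good : ∀ {y₁} (y₁∈ : y₁ ∈ ys) → n F * 2 < count (same y₁) ys → Good (proj₁ f (link G⁻ r y₁ (ys-adj y₁∈)))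
      popular-good {y₁} y₁∈ popular c e₁∉ =
        Choose.replacement-popular f c (keep (same y₁) ys) (keep-unique (same y₁) ys-unique) (ys-adj ∘ proj₁ ∘ ∈-keep⁻ (same y₁))
          (λ {y} y∈ → trans (witness (image f y ≟ᵐ image f y₁) (proj₂ (∈-keep⁻ (same y₁) {xs = ys} y∈))) (image-≡ f (link-joins G⁻ r y₁ (ys-adj y₁∈))))
          e₁∉ (subst (n F * 2 <_) (sym (length-keep (same y₁) ys)) popular)

      unpopular-good : (∀ {y₁} → y₁ ∈ ys → ¬ n F * 2 < count (same y₁) ys) → ∀ e₁ → Good e₁
      unpopular-good none e₁ c _ = Choose.replacement-unpopular f c ys ys-unique ys-adj (λ y₁∈ → ≮⇒≥ (none y₁∈)) large

      someone : ∀ (zs : List (Fin (n G))) → n F * (2 + n F * 2) < length zs → ∃[ z ] z ∈ zs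
      someone (z ∷ _) _ = z , here refl

      -- A value taken on more than 2 `n F` edges at r leaves a choice among these edges. If no
      -- value is that frequent, the exclusions number at most 2 + 2 `n F` per vertex of F, which
      -- explains the size of `large`, and any value will do at e₀.
      good-value : (∃[ y₁ ] y₁ ∈ ys × n F * 2 < count (same y₁) ys) ⊎ (∀ {y₁} → y₁ ∈ ys → ¬ n F * 2 < count (same y₁) ys) →
                   ∃[ e₁ ] Good e₁
      good-value (inj₁ (y₁ , y₁∈ , popular)) = proj₁ f (link G⁻ r y₁ (ys-adj y₁∈)) , popular-good y₁∈ popular
      good-value (inj₂ none) = let (z , z∈) = someone ys large ; e₁ = proj₁ f (link G⁻ r z (ys-adj z∈)) in e₁ , unpopular-good none e₁

      module _ (e₁ : Edge G⁻) (good : Good e₁) where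
        open Extension κ f (λ _ → push κ e₁) (λ e new → new e₁)

        Uses : Copy F G → Set
        Uses c = ∃[ i ] ∃[ j ] adj F i j ≡ true × map c i ≡ r × map c j ≡ x₀

        uses? : ∀ c → Dec (Uses c)
        uses? c = Finₚ.any? λ i → Finₚ.any? λ j → (adj F i j ≟ᵇ true) ×-dec ((map c i Fin.≟ r) ×-dec (map c j Fin.≟ x₀))

        unused : ∀ c → ¬ Uses c → Copy F G⁻
        unused c none = copy (map c) (inj c) λ i j a → survives (hom c i j a) λ jn → case joins-ends e₀-joins jn of λ where
          (inj₁ (p , q)) → none (i , j , a , sym p , sym q)
          (inj₂ (p , q)) → none (j , i , trans (adj-sym F j i) a , sym p , sym q)

        old-free : ∀ (c : Copy F G) → FFree c (proj₁ extended) → ∀ e → InCopy c (push κ e) → ¬ InCopy c (push κ (proj₁ f e))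
        old-free c free e e∈ fe∈ = free (push κ e) e∈ (subst (InCopy c) (sym (extended-push e)) fe∈)

        -- Since e₀ is sent to e₁, a free copy through e₀ cannot contain e₁; this is the hypothesis
        -- under which e₁ is good.
        replacement : ∀ (c : Copy F G) → FFree c (proj₁ extended) → Uses c → Replacement f c
        replacement c free (i , j , a , at-r , at-x) = good c λ e₁∈ →
          free e₀ (inCopy⁺ c a (subst₂ (Joins e₀) (sym at-r) (sym at-x) e₀-joins)) (subst (InCopy c) (sym (extended-new e₀ not-image)) e₁∈)

        finish : ∀ (c : Copy F G) → FFree c (proj₁ extended) → Dec (Uses c) → Σ (Copy F G⁻) λ c → FFree c (proj₁ f)
        finish c free (no none) = unused c none , pull-free c (unused c none) (λ _ → refl) free
        finish c free (yes use@(i , j , a , at-r , at-x)) =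
          repaired f c a at-r at-x (old-free c free) (replacement c free use)
          , repaired-free f c a at-r at-x (old-free c free) (replacement c free use)

        free-copy-by : Σ (Copy F G⁻) λ c → FFree c (proj₁ f)
        free-copy-by = let (c , free) = proj₂ un extended in finish c free (uses? c)

    free-copy : Σ (Copy F G⁻) λ c → FFree c (proj₁ f)
    free-copy = let (e₁ , good) = good-value (search (λ y₁ → n F * 2 <? count (same y₁) ys) ys) in free-copy-by e₁ good

  deleted-unavoidable : 2 + n F * (2 + n F * 2) < length (nbrs G r) → Unavoidable F G⁻
  deleted-unavoidable big = proj₁ (free some) , free
    where
    open Delete (Fin._≟_ {n G})
    ys : List (Fin (n G))
    ys = delete x₀ (nbrs G r)
    ys-unique : Unique ys
    ys-unique = delete-unique x₀ (nbrs-unique G r)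
    ys-adj : ∀ {y} → y ∈ ys → adj G⁻ r y ≡ true
    ys-adj y∈ = let (y∈′ , y≢) = ∈-delete⁻ {xs = nbrs G r} y∈ in spoke (nbrs-adj G y∈′) y≢
    ys-length : 2 + n F * (2 + n F * 2) ≤ length ys
    ys-length = s≤s⁻¹ (≤-trans big (length-⊆ {ys = x₀ ∷ ys} (nbrs-unique G r) into))
      where
      into : ∀ {y} → y ∈ nbrs G r → y ∈ x₀ ∷ ys
      into {y} y∈ with y Fin.≟ x₀
      ... | yes refl = here refl
      ... | no y≢    = there (∈-delete⁺ y∈ y≢)
    free : (f : F1 G⁻) → Σ (Copy F G⁻) λ c → FFree c (proj₁ f)
    free f = free-copy f ys ys-unique ys-adj (≤-trans (n≤1+n _) ys-length)
    two : ∀ (zs : List (Fin (n G))) → Unique zs → 2 ≤ length zs → ∃[ a ] ∃[ b ] a ∈ zs × b ∈ zs × a ≢ b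
    two (a ∷ b ∷ _) ((a≢b ∷ _) ∷ _) _ = a , b , here refl , there (here refl) , a≢b
    two (_ ∷ []) _ (s≤s ())
    -- The bare copy demanded by `Unavoidable` comes from any map without fixed points. The summand
    -- 2 in the degree bound leaves two edges at r from which to define one, even if `n F` is 0.
    some : F1 G⁻
    some = let (a , b , a∈ , b∈ , a≢b) = two ys ys-unique (≤-trans (m≤m+n 2 _) ys-length) in
      proj₁ (adversary {G⁻} (λ _ _ → ⊥) (λ _ _ → no λ ()) (λ ()) (λ ()) (link G⁻ r a (ys-adj a∈)) (link G⁻ r b (ys-adj b∈))
        λ eq → case joins-ends (link-joins G⁻ r a (ys-adj a∈)) (subst (λ z → Joins z r b) (sym eq) (link-joins G⁻ r b (ys-adj b∈))) of λ where
          (inj₁ (_ , q)) → a≢b q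
          (inj₂ (q , _)) → adj-≢ G⁻ (ys-adj b∈) q)

-- Deleting an isolated vertex

record Skip {k : ℕ} (z : Fin k) : Set where
  field
    {m}     : ℕ
    skip    : Fin m → Fin k
    skip-injective : Injective _≡_ _≡_ skip
    skip-≢  : ∀ i → skip i ≢ z
    skip-onto : ∀ {x} → x ≢ z → ∃[ i ] skip i ≡ x

-- The existence of z reveals that k is a successor; packaging the result keeps this case
-- distinction away from `n G`.
skipping : ∀ {k} (z : Fin k) → Skip z
skipping {suc k} z = record
  { skip = Fin.punchIn z
  ; skip-injective = λ {i} {j} → Finₚ.punchIn-injective z i j
  ; skip-≢ = Finₚ.punchInᵢ≢i z
  ; skip-onto = λ x≢z → Fin.punchOut (x≢z ∘ sym) , Finₚ.punchIn-punchOut (x≢z ∘ sym)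
  }

module IsolatedVertex {F : Graph} (no-isolated : NoIsolated F) {G : Graph} (un : Unavoidable F G)
                      (z : Fin (n G)) (isolated : ∀ y → adj G z y ≢ true) where
  open Skip (skipping z)

  G⁻ : Graph
  G⁻ = record { n = m ; adj = λ i j → adj G (skip i) (skip j) ; adj-sym = λ i j → adj-sym G _ _ ; irrefl = λ i → irrefl G _ }

  κ : Copy G⁻ G
  κ = copy skip skip-injective λ _ _ a → a

  proper : ProperSub G⁻ G
  proper = κ , λ (onto , _) → let (i , eq) = onto z in skip-≢ i eq

  edge-≢z : ∀ {x y} → adj G x y ≡ true → x ≢ z
  edge-≢z {y = y} a refl = isolated y a

  in-image : ∀ e → ∃[ e′ ] push κ e′ ≡ e
  in-image e with skip-onto (edge-≢z (isE e)) | skip-onto (edge-≢z (trans (adj-sym G _ _) (isE e)))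
  ... | i , eqi | j , eqj = e′ , joins-unique (push-joins κ (link-joins G⁻ i j a)) (fwd (sym eqi) (sym eqj))
    where
    a : adj G⁻ i j ≡ true
    a = trans (cong₂ (adj G) eqi eqj) (isE e)
    e′ = link G⁻ i j a

  lower : (c : Copy F G) → Σ (Copy F G⁻) λ c′ → ∀ x → skip (map c′ x) ≡ map c x
  lower c = copy (λ x → proj₁ (site x)) (λ {x} {y} eq → inj c (trans (sym (proj₂ (site x))) (trans (cong skip eq) (proj₂ (site y)))))
              (λ i j a → trans (cong₂ (adj G) (proj₂ (site i)) (proj₂ (site j))) (hom c i j a))
          , λ x → proj₂ (site x)
    where
    site : ∀ x → ∃[ i ] skip i ≡ map c x
    site x = skip-onto (edge-≢z (hom c x _ (proj₂ (no-isolated x))))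

  removed-unavoidable : Unavoidable F G⁻
  removed-unavoidable = proj₁ (lower (proj₁ un)) , λ f →
    -- The identity is admissible as default because no edge of G lies outside the image of κ: the
    -- ends of an edge are not isolated.
    let open Extension κ f id (λ e new → contradiction (proj₂ (in-image e)) (new (proj₁ (in-image e))))
        (c , free) = proj₂ un extended
        (c′ , eq) = lower c
    in c′ , pull-free c c′ eq free

-- Large matchings in graphs of bounded degree

record EdgeSystem (G : Graph) (k : ℕ) : Set where
  field
    pt     : Fin k × Fin 2 → Fin (n G)
    pt-inj : ∀ {a b} → pt a ≡ pt b → a ≡ b
    pt-adj : ∀ a → adj G (pt (a , fzero)) (pt (a , fsuc fzero)) ≡ true
open EdgeSystem

edgeSystem-copy : ∀ {G k} → EdgeSystem G k → Copy (disjointEdges k) G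
edgeSystem-copy {G} {k} S = copy (pt S ∘ dec) (λ eq → dec-injective (pt-inj S eq)) λ i j a → joined (proj₂ (label a))
  where
  open Net (matchingNet k) using (dec)
  open NetGraph (matchingNet k)
  joined : ∀ {l a b} → Links l a b → adj G (pt S a) (pt S b) ≡ true
  joined {l} (fwd refl refl) = pt-adj S l
  joined {l} (bwd refl refl) = trans (adj-sym G _ _) (pt-adj S l)

module _ {G : Graph} (no-isolated : NoIsolated G) {D : ℕ} (degree : ∀ x → length (nbrs G x) ≤ D) where

  -- A vertex x outside the closed neighbourhoods of the 2k end points has all its neighbours off
  -- the matching too, so any edge at x can be added.
  add-edge : ∀ {k} → EdgeSystem G k → k * 2 * (1 + D) < n G → EdgeSystem G (suc k)
  add-edge {k} S lt with escape (cartesianProduct (allFin k) (allFin 2)) (allFin (n G)) (λ a z → does (z Fin.≟ pt S a) ∨ adj G (pt S a) z) few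
    where
    few : ∑ (cartesianProduct (allFin k) (allFin 2)) (λ a → count (λ z → does (z Fin.≟ pt S a) ∨ adj G (pt S a) z) (allFin (n G))) < length (allFin (n G))
    few = begin-strict
      ∑ (cartesianProduct (allFin k) (allFin 2)) (λ a → count (λ z → does (z Fin.≟ pt S a) ∨ adj G (pt S a) z) (allFin (n G)))
        ≤⟨ ∑-bound (cartesianProduct (allFin k) (allFin 2)) (λ {a} _ → ≤-trans (count-∨ (λ z → does (z Fin.≟ pt S a)) (adj G (pt S a)) (allFin (n G)))
               (+-mono-≤ (count-does≤1 (Fin._≟ pt S a) (Uniqueₚ.allFin⁺ (n G)) λ _ _ p q → trans p (sym q))
                         (subst (_≤ D) (length-keep (adj G (pt S a)) (allFin (n G))) (degree (pt S a))))) ⟩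
      length (cartesianProduct (allFin k) (allFin 2)) * (1 + D)
        ≡⟨ cong (_* (1 + D)) (trans (length-cartesianProduct (allFin k) (allFin 2)) (cong (_* 2) (length-tabulate {n = k} id))) ⟩
      k * 2 * (1 + D)        <⟨ lt ⟩
      n G                    ≡⟨ sym (length-tabulate {n = n G} id) ⟩
      length (allFin (n G)) ∎
      where open ≤-Reasoning
  ... | x , _ , ok = record { pt = pt′ ; pt-inj = pt′-inj ; pt-adj = pt′-adj }
    where
    y = proj₁ (no-isolated x)
    xy : adj G x y ≡ true
    xy = proj₂ (no-isolated x)
    away : ∀ a → x ≢ pt S a × adj G (pt S a) x ≢ true
    away (a , b) with does (x Fin.≟ pt S (a , b)) | dec-true (x Fin.≟ pt S (a , b)) | adj G (pt S (a , b)) x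
                    | ok (∈-cartesianProduct⁺ (∈-allFin a) (∈-allFin b))
    ... | false | h | false | _ = (λ eq → case h eq of λ ()) , λ ()
    x≢ : ∀ a → x ≢ pt S a
    x≢ a = proj₁ (away a)
    y≢ : ∀ a → y ≢ pt S a
    y≢ a eq = proj₂ (away a) (trans (cong (λ z → adj G z x) (sym eq)) (trans (adj-sym G y x) xy))
    pt′ : Fin (suc k) × Fin 2 → Fin (n G)
    pt′ (fzero , fzero)      = x
    pt′ (fzero , fsuc fzero) = y
    pt′ (fsuc a , b)         = pt S (a , b)
    pt′-inj : ∀ {a b} → pt′ a ≡ pt′ b → a ≡ b
    pt′-inj {fzero , fzero}      {fzero , fzero}      eq = refl
    pt′-inj {fzero , fzero}      {fzero , fsuc fzero} eq = contradiction eq (adj-≢ G xy)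
    pt′-inj {fzero , fzero}      {fsuc a , b}         eq = contradiction eq (x≢ (a , b))
    pt′-inj {fzero , fsuc fzero} {fzero , fzero}      eq = contradiction (sym eq) (adj-≢ G xy)
    pt′-inj {fzero , fsuc fzero} {fzero , fsuc fzero} eq = refl
    pt′-inj {fzero , fsuc fzero} {fsuc a , b}         eq = contradiction eq (y≢ (a , b))
    pt′-inj {fsuc a , b}         {fzero , fzero}      eq = contradiction (sym eq) (x≢ (a , b))
    pt′-inj {fsuc a , b}         {fzero , fsuc fzero} eq = contradiction (sym eq) (y≢ (a , b))
    pt′-inj {fsuc a , b}         {fsuc a′ , b′}       eq = cong (λ (a , b) → fsuc a , b) (pt-inj S eq)
    pt′-adj : ∀ a → adj G (pt′ (a , fzero)) (pt′ (a , fsuc fzero)) ≡ true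
    pt′-adj fzero    = xy
    pt′-adj (fsuc a) = pt-adj S a

  greedy-matching : ∀ k → k * 2 * (1 + D) ≤ n G → EdgeSystem G k
  greedy-matching zero    _  = record { pt = λ () ; pt-inj = λ { {()} } ; pt-adj = λ () }
  greedy-matching (suc k) le = add-edge (greedy-matching k (<⇒≤ lt)) lt
    where
    lt : k * 2 * (1 + D) < n G
    lt = ≤-trans (s≤s (m≤n+m _ (D + (1 + D)))) (subst (_≤ n G) (expand k D) le)
      where
      expand : ∀ k D → suc k * 2 * (1 + D) ≡ suc (D + (1 + D) + k * 2 * (1 + D))
      expand = solve-∀

module _ {F : Graph} (no-isolated : NoIsolated F) (single : MatchingLike F) {G : Graph} (min : MinUnavoidable F G) where

  minimal-no-isolated : NoIsolated G
  minimal-no-isolated z = decide (Finₚ.any? (λ y → adj G z y ≟ᵇ true))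
    where
    decide : Dec (∃[ y ] adj G z y ≡ true) → ∃[ y ] adj G z y ≡ true
    decide (yes r) = r
    decide (no isolated) = ⊥-elim (proj₂ min I.G⁻ I.proper I.removed-unavoidable)
      where module I = IsolatedVertex {F} no-isolated {G} (proj₁ min) z (λ y a → isolated (y , a))

  degreeBound : ℕ
  degreeBound = 2 + n F * (2 + n F * 2)

  minimal-degree : ∀ r → length (nbrs G r) ≤ degreeBound
  minimal-degree r = ≮⇒≥ λ big → let (x₀ , rx₀) = minimal-no-isolated r in
    proj₂ min _ (EdgeDeletion.proper G (link G r x₀ rx₀))
      (DegreeBound.deleted-unavoidable {F} no-isolated single {G} (proj₁ min) r x₀ rx₀ big)

  -- A larger G contains m disjoint edges, and properly so because it has more than 2m vertices,
  -- which contradicts minimality.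
  minimal-size : ∀ m → Unavoidable F (disjointEdges m) → n G ≤ m * 2 * (1 + degreeBound)
  minimal-size m un = ≮⇒≥ λ large → proj₂ min (disjointEdges m) (c (<⇒≤ large) , too-few large ∘ proj₁) un
    where
    c : m * 2 * (1 + degreeBound) ≤ n G → Copy (disjointEdges m) G
    c le = edgeSystem-copy (greedy-matching {G} minimal-no-isolated minimal-degree m le)
    too-few : ∀ large → ¬ (∀ x → ∃[ i ] map (c (<⇒≤ large)) i ≡ x)
    too-few large onto = <⇒≱ large (≤-trans (Finₚ.injective⇒≤ {f = λ x → proj₁ (onto x)}
      λ {x} {y} eq → trans (sym (proj₂ (onto x))) (trans (cong (map (c (<⇒≤ large))) eq) (proj₂ (onto y)))) (m≤m*n (m * 2) (1 + degreeBound)))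

-- Enumeration of graphs

codedGraph : ∀ m → Fin (2 ^ (m * m)) → Graph
codedGraph m code = record
  { n = m
  -- Symmetrised and cleared on the diagonal, so that every code yields a graph; on the adjacency
  -- matrix of a graph this changes nothing.
  ; adj = λ i j → not (does (i Fin.≟ j)) ∧ (bit i j ∧ bit j i)
  ; adj-sym = λ i j → cong₂ (λ a b → not a ∧ b)
      (bool-ext (λ h → dec-true (j Fin.≟ i) (sym (witness (i Fin.≟ j) h))) (λ h → dec-true (i Fin.≟ j) (sym (witness (j Fin.≟ i) h))))
      (∧-comm (bit i j) (bit j i))
  ; irrefl = λ i → cong (λ a → not a ∧ (bit i i ∧ bit i i)) (dec-true (i Fin.≟ i) refl)
  }
  where
  bit : Fin m → Fin m → Bool
  bit i j = does (finToFun {2} {m * m} code (combine i j) Fin.≟ fsuc fzero)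

allGraphs : ℕ → List Graph
allGraphs N = concatMap (λ m → List.map (codedGraph m) (allFin (2 ^ (m * m)))) (List.upTo (suc N))

allGraphs-complete : ∀ {N} G → n G ≤ N → Any (G ≅_) (allGraphs N)
allGraphs-complete {N} G le = lose
  (∈-concatMap⁺ (λ m → List.map (codedGraph m) (allFin (2 ^ (m * m)))) (lose (∈-upTo⁺ (s≤s le)) (∈-map⁺ (codedGraph (n G)) (∈-allFin code))))
  (id , id , (λ _ → refl) , (λ _ → refl) , same)
  where
  value : Bool → Fin 2
  value true  = fsuc fzero
  value false = fzero
  decoded : ∀ b → does (value b Fin.≟ fsuc fzero) ≡ b
  decoded true  = refl
  decoded false = refl
  entry : Fin (n G) × Fin (n G) → Fin 2
  entry (i , j) = value (adj G i j)
  code : Fin (2 ^ (n G * n G))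
  code = funToFin (entry ∘ remQuot (n G))
  bit : ∀ i j → does (finToFun {2} {n G * n G} code (combine i j) Fin.≟ fsuc fzero) ≡ adj G i j
  bit i j = trans (cong (λ b → does (b Fin.≟ fsuc fzero)) (trans (Finₚ.finToFun-funToFin (entry ∘ remQuot {n G} (n G)) (combine i j))
                    (cong entry (Finₚ.remQuot-combine i j)))) (decoded (adj G i j))
  same : ∀ i j → adj (codedGraph (n G) code) i j ≡ adj G i j
  same i j rewrite bit i j | bit j i | adj-sym G j i with i Fin.≟ j
  ... | yes refl = sym (irrefl G i)
  ... | no _     = ∧-idem (adj G i j)

matching-finite : ∀ {F} → NoIsolated F → MatchingLike F → ∀ m → Unavoidable F (disjointEdges m) → MFinite F
matching-finite {F} no-isolated single m un = allGraphs (m * 2 * (1 + (2 + n F * (2 + n F * 2)))) , λ G min →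
  allGraphs-complete G (minimal-size {F} no-isolated single {G} min m un)

-- The two directions of the characterisation

walk? : ∀ F → Dec (Walk₃ F)
walk? F = map′ (λ (a , b , c , d , ab , bc , cd , a≢c , b≢d) → record { ab = ab ; bc = bc ; cd = cd ; a≢c = a≢c ; b≢d = b≢d })
               (λ w → let open Walk₃ w in a , b , c , d , ab , bc , cd , a≢c , b≢d)
  (Finₚ.any? λ a → Finₚ.any? λ b → Finₚ.any? λ c → Finₚ.any? λ d →
    (adj F a b ≟ᵇ true) ×-dec ((adj F b c ≟ᵇ true) ×-dec ((adj F c d ≟ᵇ true) ×-dec (¬? (a Fin.≟ c) ×-dec ¬? (b Fin.≟ d)))))

finite⇒matching : ∀ F → Forest F → NoIsolated F → MFinite F → ∃[ t ] F ≅ matching t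
finite⇒matching F forest no-isolated finite with walk? F
... | yes w = contradiction finite (walk-infinite {F} forest w)
... | no ¬w with Finₚ.any? (λ x → 2 ≤? length (nbrs F x))
...   | yes (x , two) = contradiction finite (star-infinite {F} no-isolated ¬w two)
...   | no leaves = matchingLike⇒≅matching {F} no-isolated λ {x} {y} {z} xy xz →
          count≤1⇒≡ (adj F x) (subst (_≤ 1) (length-keep (adj F x) (allFin (n F))) (s≤s⁻¹ (≰⇒> (λ two → leaves (x , two)))))
            (∈-allFin y) (∈-allFin z) xy xz Fin._≟_

matching⇒finite : ∀ {F t} → NoIsolated F → F ≅ matching t → MFinite F
matching⇒finite {F} {t} no-isolated iso =
  matching-finite {F} no-isolated (≅matching⇒matchingLike {F} {t} iso) (3 + 3 * t) (disjointEdges-unavoidable {F} {t} iso)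

theorem1p3 : (F : Graph) → Forest F → NoIsolated F →
    (MFinite F ⇔ (∃[ t ] (F ≅ matching t)))
theorem1p3 F forest no-isolated = mk⇔ (finite⇒matching F forest no-isolated) λ (t , iso) → matching⇒finite {F} {t} no-isolated iso
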